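{- Let $\mathcal{B}$ be an arbitrary (finite or infinite) structure. (1) If there exists $\phi$ that breaks $\wedge$ on $\mathcal{B}$, then $\mathrm{MC}(\mathcal{B})$ is NP-hard. (2) If there exists $\psi$ that breaks $\vee$ on $\mathcal{B}$, then $\mathrm{MC}(\mathcal{B})$ is co-NP-hard. (3) If there exist $\phi$ and $\psi$ such that $\phi$ breaks $\wedge$ on $\mathcal{B}$ and $\psi$ breaks $\vee$ on $\mathcal{B}$, then $\mathrm{MC}(\mathcal{B})$ is Pspace-hard.
   Context: All structures have a finite relational signature and nonempty domain. A positive equality-free formula is a first-order formula built from relational atoms of the signature (the equality symbol is not available unless it is one of the relations) using only $\forall,\exists,\wedge,\vee$. For a fixed structure $\mathcal{B}$, $\mathrm{MC}(\mathcal{B})$ is the decision problem: given as input a positive equality-free sentence $\theta$ over the signature of $\mathcal{B}$, decide whether $\mathcal{B}\models\theta$. A positive equality-free sentence $\phi = Q_1v_1\ldots Q_kv_k\,(\phi_1\wedge\phi_2)$, with $Q_i\in\{\forall,\exists\}$ and $\phi_1,\phi_2$ positive equality-free formulas (not necessarily quantifier-free), breaks $\wedge$ on $\mathcal{B}$ if $\mathcal{B}\not\models\phi$ but $\mathcal{B}\models Q_1v_1\ldots Q_kv_k\,\phi_1$ and $\mathcal{B}\models Q_1v_1\ldots Q_kv_k\,\phi_2$. A positive equality-free sentence $\psi = Q'_1w_1\ldots Q'_\ell w_\ell\,(\psi_1\vee\psi_2)$ breaks $\vee$ on $\mathcal{B}$ if $\mathcal{B}\models\psi$ but $\mathcal{B}\not\models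 Q'_1w_1\ldots Q'_\ell w_\ell\,\psi_1$ and $\mathcal{B}\not\models Q'_1w_1\ldots Q'_\ell w_\ell\,\psi_2$. Hardness is with respect to polynomial-time many-one reductions. -}

module Defs where

open import Data.Bool.Base using (Bool; true; false)
open import Data.Fin.Base using (Fin; zero; suc)
open import Data.List.Base using (List; []; _∷_; _++_; length) renaming (map to mapᴸ)
open import Data.List.Properties using (++-assoc; ∷-injectiveʳ)
open import Data.Maybe.Base using (Maybe; just; nothing)
open import Data.Nat.Base using (ℕ; zero; suc; _+_; _*_; _≤_)
open import Data.Product.Base using (Σ-syntax; ∃-syntax; _×_; _,_; proj₁)
open import Data.Sum.Base using (_⊎_)
open import Data.Vec.Base using (Vec; []; _∷_; lookup; map; zipWith; replicate; sum) renaming (_++_ to _++ⱽ_)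
open import Function.Bundles using (_⇔_; _↔_)
open import Level using (Level; 0ℓ) renaming (suc to lsuc; _⊔_ to _⊔ˡ_)
open import Relation.Binary.PropositionalEquality using (_≡_; refl; sym; trans; cong)
open import Relation.Nullary.Negation using (¬_)
open import Relation.Unary using (Pred; ∁)

private
  variable
    ℓ : Level
    m n k : ℕ

record Signature : Set where
  field
    #relations : ℕ
    arity      : Fin #relations → ℕ

open Signature public

record Structure (σ : Signature) (ℓ : Level) : Set (lsuc ℓ) where
  field
    Carrier  : Set ℓ
    nonempty : Carrier
    ⟦_⟧ᴿ     : (R : Fin (#relations σ)) → Pred (Vec Carrier (arity σ R)) ℓ

data Quantifier : Set where
  all ex : Quantifier

infixr 7 _∧_
infixr 6 _∨_

-- Formulas with n free variables, in de Bruijn notation: index zero is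
-- bound by the innermost enclosing quantifier.
data Formula (σ : Signature) (n : ℕ) : Set where
  rel     : (R : Fin (#relations σ)) → Vec (Fin n) (arity σ R) → Formula σ n
  _∧_ _∨_ : Formula σ n → Formula σ n → Formula σ n
  quant   : Quantifier → Formula σ (suc n) → Formula σ n

Sentence : Signature → Set
Sentence σ = Formula σ 0

-- The block Q₁v₁ … Qₖvₖ is listed innermost quantifier first, Qₖ ∷ … ∷ Q₁ ∷ [].
quantify : ∀ {σ} → Vec Quantifier k → Formula σ k → Sentence σ
quantify []       φ = φ
quantify (Q ∷ Qs) φ = quantify Qs (quant Q φ)

module _ {σ : Signature} (B : Structure σ ℓ) where
  open Structure B

  Sat : Formula σ n → Vec Carrier n → Set ℓ
  Sat (rel R xs)      ρ = ⟦ R ⟧ᴿ (map (lookup ρ) xs)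
  Sat (φ ∧ ψ)         ρ = Sat φ ρ × Sat ψ ρ
  Sat (φ ∨ ψ)         ρ = Sat φ ρ ⊎ Sat ψ ρ
  Sat (quant all φ)   ρ = (b : Carrier) → Sat φ (b ∷ ρ)
  Sat (quant ex  φ)   ρ = Σ[ b ∈ Carrier ] Sat φ (b ∷ ρ)

infix 4 _⊨_

_⊨_ : ∀ {σ} → Structure σ ℓ → Sentence σ → Set ℓ
B ⊨ φ = Sat B φ []

record _Breaks-∧-on_ {σ} (φ : Sentence σ) (B : Structure σ ℓ) : Set ℓ where
  field
    {length-prefix} : ℕ
    prefix : Vec Quantifier length-prefix
    φ₁ φ₂  : Formula σ length-prefix
    shape  : φ ≡ quantify prefix (φ₁ ∧ φ₂)
    fails  : ¬ (B ⊨ φ)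
    holds₁ : B ⊨ quantify prefix φ₁
    holds₂ : B ⊨ quantify prefix φ₂

record _Breaks-∨-on_ {σ} (ψ : Sentence σ) (B : Structure σ ℓ) : Set ℓ where
  field
    {length-prefix} : ℕ
    prefix : Vec Quantifier length-prefix
    ψ₁ ψ₂  : Formula σ length-prefix
    shape  : ψ ≡ quantify prefix (ψ₁ ∨ ψ₂)
    holds  : B ⊨ ψ
    fails₁ : ¬ (B ⊨ quantify prefix ψ₁)
    fails₂ : ¬ (B ⊨ quantify prefix ψ₂)

Word : Set
Word = List Bool

Language : (ℓ : Level) → Set (lsuc ℓ)
Language ℓ = Pred Word ℓ

unary : Fin n → Word
unary zero    = false ∷ []
unary (suc i) = true ∷ unary i

unaries : Vec (Fin n) k → Word
unaries []       = []
unaries (i ∷ is) = unary i ++ unaries is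

-- Polish notation.  A de Bruijn index is smaller than the number of
-- quantifiers, so unary indices keep the code polynomial in the size of
-- the formula.
encode : ∀ {σ} → Formula σ n → Word
encode (rel R xs)    = true ∷ true ∷ unary R ++ unaries xs
encode (φ ∧ ψ)       = false ∷ false ∷ encode φ ++ encode ψ
encode (φ ∨ ψ)       = false ∷ true ∷ encode φ ++ encode ψ
encode (quant all φ) = true ∷ false ∷ false ∷ encode φ
encode (quant ex φ)  = true ∷ false ∷ true ∷ encode φ

private
  reassoc : (u v : Word) {r s : Word} (u′ : Word) {v′ : Word} →
            (u ++ v) ++ r ≡ (u′ ++ v′) ++ s → u ++ (v ++ r) ≡ u′ ++ (v′ ++ s)
  reassoc u v {r} {s = s} u′ {v′} eq =
    trans (sym (++-assoc u v r)) (trans eq (++-assoc u′ v′ s))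

  unary-prefix-free : (i j : Fin n) {r s : Word} →
                      unary i ++ r ≡ unary j ++ s → i ≡ j × r ≡ s
  unary-prefix-free zero    zero    eq = refl , ∷-injectiveʳ eq
  unary-prefix-free (suc i) (suc j) eq with refl , q ← unary-prefix-free i j (∷-injectiveʳ eq) = refl , q

  unaries-prefix-free : (is js : Vec (Fin n) k) {r s : Word} →
                        unaries is ++ r ≡ unaries js ++ s → is ≡ js × r ≡ s
  unaries-prefix-free []       []       eq = refl , eq
  unaries-prefix-free (i ∷ is) (j ∷ js) eq
    with refl , eq′ ← unary-prefix-free i j (reassoc (unary i) (unaries is) (unary j) eq)
    with refl , q ← unaries-prefix-free is js eq′ = refl , q

  drop₂ : ∀ {a b c d} {u v : Word} → a ∷ b ∷ u ≡ c ∷ d ∷ v → u ≡ v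
  drop₂ eq = ∷-injectiveʳ (∷-injectiveʳ eq)

encode-prefix-free : ∀ {σ} (φ ψ : Formula σ n) {r s : Word} →
                     encode φ ++ r ≡ encode ψ ++ s → φ ≡ ψ × r ≡ s
encode-prefix-free (rel R xs) (rel S ys) eq
  with refl , eq′ ← unary-prefix-free R S (reassoc (unary R) (unaries xs) (unary S) (drop₂ eq))
  with refl , q ← unaries-prefix-free xs ys eq′ = refl , q
encode-prefix-free (φ ∧ φ′) (ψ ∧ ψ′) eq
  with refl , eq′ ← encode-prefix-free φ ψ (reassoc (encode φ) (encode φ′) (encode ψ) (drop₂ eq))
  with refl , q ← encode-prefix-free φ′ ψ′ eq′ = refl , q
encode-prefix-free (φ ∨ φ′) (ψ ∨ ψ′) eq
  with refl , eq′ ← encode-prefix-free φ ψ (reassoc (encode φ) (encode φ′) (encode ψ) (drop₂ eq))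
  with refl , q ← encode-prefix-free φ′ ψ′ eq′ = refl , q
encode-prefix-free (quant all φ) (quant all ψ) eq
  with refl , q ← encode-prefix-free φ ψ (∷-injectiveʳ (drop₂ eq)) = refl , q
encode-prefix-free (quant ex φ) (quant ex ψ) eq
  with refl , q ← encode-prefix-free φ ψ (∷-injectiveʳ (drop₂ eq)) = refl , q
encode-prefix-free (rel _ _)       (_ ∧ _)         ()
encode-prefix-free (rel _ _)       (_ ∨ _)         ()
encode-prefix-free (rel _ _)       (quant all _)   ()
encode-prefix-free (rel _ _)       (quant ex _)    ()
encode-prefix-free (_ ∧ _)         (rel _ _)       ()
encode-prefix-free (_ ∧ _)         (_ ∨ _)         ()
encode-prefix-free (_ ∧ _)         (quant all _)   ()
encode-prefix-free (_ ∧ _)         (quant ex _)    ()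
encode-prefix-free (_ ∨ _)         (rel _ _)       ()
encode-prefix-free (_ ∨ _)         (_ ∧ _)         ()
encode-prefix-free (_ ∨ _)         (quant all _)   ()
encode-prefix-free (_ ∨ _)         (quant ex _)    ()
encode-prefix-free (quant all _)   (rel _ _)       ()
encode-prefix-free (quant all _)   (_ ∧ _)         ()
encode-prefix-free (quant all _)   (_ ∨ _)         ()
encode-prefix-free (quant all _)   (quant ex _)    ()
encode-prefix-free (quant ex _)    (rel _ _)       ()
encode-prefix-free (quant ex _)    (_ ∧ _)         ()
encode-prefix-free (quant ex _)    (_ ∨ _)         ()
encode-prefix-free (quant ex _)    (quant all _)   ()

encode-injective : ∀ {σ} (φ ψ : Formula σ n) → encode φ ≡ encode ψ → φ ≡ ψ
encode-injective φ ψ eq = proj₁ (encode-prefix-free φ ψ (cong (_++ []) eq))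

MC : ∀ {σ} → Structure σ ℓ → Language ℓ
MC {σ = σ} B w = Σ[ θ ∈ Sentence σ ] (w ≡ encode θ × B ⊨ θ)

Finite : Set → Set
Finite A = ∃[ n ] (A ↔ Fin n)

data Symbol (A : Set) : Set where
  blank : Symbol A
  bit   : Bool → Symbol A
  aux   : A → Symbol A

data Direction : Set where
  left stay right : Direction

-- A two-way infinite tape, blank outside the part recorded here; the
-- cells to the left of the head are listed from the head outwards.
record Tape (A : Set) : Set where
  constructor tape
  field
    before : List (Symbol A)
    head   : Symbol A
    after  : List (Symbol A)

open Tape public

module _ {A : Set} where

  fromWord : Word → Tape A
  fromWord []      = tape [] blank []
  fromWord (b ∷ w) = tape [] (bit b) (mapᴸ bit w)

  leadingBits : List (Symbol A) → Word
  leadingBits (bit b ∷ xs) = b ∷ leadingBits xs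
  leadingBits _            = []

  -- The maximal block of bits that starts at the head and runs rightwards.
  toWord : Tape A → Word
  toWord (tape _ h r) = leadingBits (h ∷ r)

  move : Direction → Tape A → Tape A
  move left  (tape []      h r)       = tape [] blank (h ∷ r)
  move left  (tape (x ∷ l) h r)       = tape l x (h ∷ r)
  move stay  t                        = t
  move right (tape l       h [])      = tape (h ∷ l) blank []
  move right (tape l       h (x ∷ r)) = tape (h ∷ l) x r

  act : Symbol A × Direction → Tape A → Tape A
  act (s , d) (tape l _ r) = move d (tape l s r)

  -- Recorded cells are never discarded, so this counts the input cells
  -- and every cell visited so far.
  cells : Tape A → ℕ
  cells (tape l _ r) = length l + suc (length r)

-- m is the number of input tapes.  The machine halts in the states and on
-- the scanned symbols where δ is nothing.
record TM (m : ℕ) : Set₁ where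
  field
    State         : Set
    Aux           : Set
    finite-State  : Finite State
    finite-Aux    : Finite Aux
    #work         : ℕ
    start         : State
    accepting     : State → Bool
    δ             : State → Vec (Symbol Aux) (m + #work) →
                    Maybe (State × Vec (Symbol Aux × Direction) (m + #work))

module _ (M : TM m) where
  open TM M

  record Config : Set where
    constructor config
    field
      state : State
      tapes : Vec (Tape Aux) (m + #work)

  open Config

  initial : Vec Word m → Config
  initial ws = config start (map fromWord ws ++ⱽ replicate #work (fromWord []))

  next : Config → Maybe (State × Vec (Symbol Aux × Direction) (m + #work))
  next c = δ (state c) (map head (tapes c))

  step : Config → Config
  step c with next c
  ... | nothing       = c
  ... | just (q , as) = config q (zipWith act as (tapes c))

  -- A halted configuration is repeated, so "halted after exactly t steps"
  -- below means "halts within t steps".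
  run : ℕ → Config → Config
  run zero    c = c
  run (suc t) c = run t (step c)

  Halted : Config → Set
  Halted c = next c ≡ nothing

  Accepting : Config → Set
  Accepting c = accepting (state c) ≡ true

  space : Config → ℕ
  space c = sum (map cells (tapes c))

output : (M : TM 1) → Config M → Word
output M (config _ (t ∷ _)) = toWord t

data Polynomial : Set where
  X       : Polynomial
  const   : ℕ → Polynomial
  _⊕_ _⊗_ : Polynomial → Polynomial → Polynomial

eval : Polynomial → ℕ → ℕ
eval X         n = n
eval (const c) n = c
eval (p ⊕ q)   n = eval p n + eval q n
eval (p ⊗ q)   n = eval p n * eval q n

size : Vec Word m → ℕ
size ws = sum (map length ws)

PolyTimeDecidable : Pred (Vec Word m) 0ℓ → Set₁
PolyTimeDecidable {m} R =
  Σ[ M ∈ TM m ] Σ[ p ∈ Polynomial ] ∀ ws →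
    let c = run M (eval p (size ws)) (initial M ws) in
    Halted M c × (R ws ⇔ Accepting M c)

PolyTimeComputable : (Word → Word) → Set₁
PolyTimeComputable f =
  Σ[ M ∈ TM 1 ] Σ[ p ∈ Polynomial ] ∀ w →
    let c = run M (eval p (length w)) (initial M (w ∷ [])) in
    Halted M c × output M c ≡ f w

NP : Language 0ℓ → Set₁
NP L =
  Σ[ R ∈ Pred (Vec Word 2) 0ℓ ] PolyTimeDecidable R ×
  (Σ[ p ∈ Polynomial ] ∀ w →
    L w ⇔ (∃[ y ] (length y ≤ eval p (length w) × R (w ∷ y ∷ []))))

coNP : Language 0ℓ → Set₁
coNP L = NP (∁ L)

PSPACE : Language 0ℓ → Set₁
PSPACE L =
  Σ[ M ∈ TM 1 ] Σ[ p ∈ Polynomial ] ∀ w →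
    let c = λ t → run M t (initial M (w ∷ [])) in
    (∀ t → space M (c t) ≤ eval p (length w)) ×
    (∃[ t ] (Halted M (c t) × (L w ⇔ Accepting M (c t))))

infix 4 _≤ₚ_

_≤ₚ_ : ∀ {ℓ₁ ℓ₂} → Language ℓ₁ → Language ℓ₂ → Set (lsuc 0ℓ ⊔ˡ ℓ₁ ⊔ˡ ℓ₂)
L ≤ₚ A = Σ[ f ∈ (Word → Word) ] PolyTimeComputable f × (∀ w → L w ⇔ A (f w))

Hard : (Language 0ℓ → Set₁) → Language ℓ → Set (lsuc 0ℓ ⊔ˡ ℓ)
Hard 𝒞 A = ∀ L → 𝒞 L → L ≤ₚ A

NP-hard coNP-hard PSPACE-hard : Language ℓ → Set (lsuc 0ℓ ⊔ˡ ℓ)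
NP-hard     = Hard NP
coNP-hard   = Hard coNP
PSPACE-hard = Hard PSPACE

{-# OPTIONS --safe #-}
-- A prefix Q₁v₁ … Qₖvₖ with two formulas φ₁, φ₂ that breaks ∧ behaves like a
-- Boolean existential quantifier whose two literals are φ₁ and φ₂: the prefix
-- lets either literal be made true, but not both.  Dually, breaking ∨ gives a
-- Boolean universal quantifier.  So quantified Boolean formulas translate into
-- positive equality-free sentences, and it remains to express acceptance.  A
-- configuration is a block of Boolean variables, arranged in columns, column i holding the cells at
-- distance i from the heads, so that one step is a conjunction of tests of
-- bounded size.  For NP a guess is followed by an existential chain of
-- configurations; co-NP follows by duality; for PSPACE the run of length 2 ^ k
-- is halved k times as in Savitch's theorem.  The code of the formula is a
-- concatenation of words over nested counting loops, which a program with
-- counters writes in polynomial time.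
module Submission where

open import Defs
open import Axiom.ExcludedMiddle using (ExcludedMiddle)
open import Data.Bool.Base using (Bool; true; false; not; if_then_else_) renaming (_∧_ to _∧ᵇ_; _∨_ to _∨ᵇ_)
import Data.Bool.Properties as Bool
open import Data.Empty using (⊥; ⊥-elim)
open import Data.Fin.Base as Fin using (Fin; zero; suc; toℕ; combine; _↑ˡ_; _↑ʳ_)
open import Data.Fin.Patterns using (0F; 1F; 2F; 3F; 4F; 5F; 6F)
open import Data.Fin.Properties using (0↔⊥; 1↔⊤; 2↔Bool; +↔⊎; *↔×; toℕ-↑ˡ; toℕ-↑ʳ; toℕ<n; pigeonhole; combine-injective)
open import Data.List.Base using (List; []; _∷_; _++_; [_]; length; replicate; reverse; _ʳ++_) renaming (map to mapᴸ)
open import Data.List.Properties using (++-assoc; ++-identityʳ; length-++; length-map; length-replicate; length-reverse; reverse-++; reverse-involutive; unfold-reverse)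
open import Data.Maybe.Base using (Maybe; just; nothing; maybe′; fromMaybe; is-just; is-nothing) renaming (map to mapᴹ)
open import Data.Nat.Base using (ℕ; zero; suc; pred; _+_; _*_; _^_; _≤_; _<_; z≤n; s≤s)
open import Data.Nat.Properties
open import Data.Nat.Tactic.RingSolver using (solve-∀)
open import Data.Product.Base using (Σ-syntax; ∃-syntax; ∃₂; _×_; _,_; proj₁; proj₂; map₁)
open import Data.Product.Function.NonDependent.Propositional using (_×-↔_)
open import Data.Sum.Base using (_⊎_; inj₁; inj₂; [_,_]′)
open import Data.Sum.Function.Propositional using (_⊎-↔_)
open import Data.Sum.Properties using (inj₁-injective)
open import Data.Unit.Base using (⊤; tt)
open import Data.Vec.Base using (Vec; []; _∷_; lookup; updateAt; zipWith; tabulate; toList; concat; group; sum) renaming (map to mapⱽ; replicate to replicateⱽ; _++_ to _++ⱽ_)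
open import Data.Vec.Properties using (lookup-map; map-∘; map-cong; map-++; map-replicate; lookup-++ˡ; lookup-++ʳ; tabulate∘lookup; tabulate-cong; toList-++; updateAt-updateAt; updateAt-id; ≡-dec)
open import Data.Vec.Relation.Binary.Pointwise.Inductive using (Pointwise; []; _∷_)
open import Data.Vec.Relation.Unary.All using (All; []; _∷_)
open import Function.Base using (_∘_)
open import Function.Bundles using (_↔_; _⇔_; mk⇔; mk↔ₛ′; Inverse; Equivalence)
open import Function.Construct.Composition using (_↔-∘_)
open import Function.Construct.Symmetry using (↔-sym)
open import Level using (Level; 0ℓ; Lift; lift; lower)
open import Relation.Binary.PropositionalEquality using (_≡_; refl; sym; trans; cong; cong₂; subst)
open import Relation.Nullary.Decidable using (does; yes; no; dec-true)
open import Relation.Nullary.Negation using (¬_; contradiction)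
open import Relation.Unary using (Pred; ∁)

-- A tuple chosen by a breaking prefix may satisfy both literals or neither, so the value of a
-- Boolean variable cannot be read off its tuple. The translation is positive in its literals,
-- however: for one direction it is enough that every tuple satisfies at least the literal of its
-- bit, for the other that it satisfies at most that one. Excluded middle decides the literals,
-- since satisfaction in an infinite structure need not be decidable. Every Boolean variable takes
-- the same number of first-order variables, so that the shift of a de Bruijn index is a fixed
-- multiple of a position. A block has `v + 2` columns because the last one has no right neighbour
-- to be computed from and is forced to be blank instead. The number of layers is the number W of
-- bits of a block. For NP this suffices because W is at least `v`, which bounds the running time;
-- for PSPACE because there are only `2 ^ W` blocks, so that a run within the space bound that halts
-- at all has halted by time `2 ^ W`.

private
  variable
    K : ℕ
    A Y Z : Set

-- Structured programs for Turing machines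

Sym : Set
Sym = Symbol ⊥

Finite-⊤ : Finite ⊤
Finite-⊤ = 1 , ↔-sym 1↔⊤

Finite-⊥ : Finite ⊥
Finite-⊥ = 0 , ↔-sym 0↔⊥

Finite-⊎ : ∀ {A B} → Finite A → Finite B → Finite (A ⊎ B)
Finite-⊎ (m , f) (n , g) = m + n , ↔-sym +↔⊎ ↔-∘ (f ⊎-↔ g)

infixr 5 _⨟_

-- Tests look only at the scanned symbols and a primitive acts on all tapes in one step, so a
-- command becomes a finite control without further data. Correctness and time are proved for
-- commands and carried over to Turing machines once.
data Cmd (K : ℕ) : Set where
  prim  : (Vec Sym K → Vec (Sym × Direction) K) → Cmd K
  _⨟_   : Cmd K → Cmd K → Cmd K
  while : (Vec Sym K → Bool) → Cmd K → Cmd K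
  cond  : (Vec Sym K → Bool) → Cmd K → Cmd K → Cmd K

idle-act : ∀ {k} (T : Vec (Tape ⊥) k) → zipWith act (mapⱽ (_, stay) (mapⱽ head T)) T ≡ T
idle-act []      = refl
idle-act (t ∷ T) = cong (t ∷_) (idle-act T)

module _ {K : ℕ} where

  private
    Tapes : Set
    Tapes = Vec (Tape ⊥) K

  infix 4 _⊢_⇓[_]_

  -- The index is the exact number of machine steps: one for a primitive, one for each test, and
  -- none for passing from a command to the one after it.
  data _⊢_⇓[_]_ : Cmd K → Tapes → ℕ → Tapes → Set where
    prim⇓  : ∀ {f T} → prim f ⊢ T ⇓[ 1 ] zipWith act (f (mapⱽ head T)) T
    seq⇓   : ∀ {c d T U V s t} → c ⊢ T ⇓[ s ] U → d ⊢ U ⇓[ t ] V → c ⨟ d ⊢ T ⇓[ s + t ] V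
    stop⇓  : ∀ {b c T} → b (mapⱽ head T) ≡ false → while b c ⊢ T ⇓[ 1 ] T
    go⇓    : ∀ {b c T U V s t} → b (mapⱽ head T) ≡ true → c ⊢ T ⇓[ s ] U →
             while b c ⊢ U ⇓[ t ] V → while b c ⊢ T ⇓[ suc (s + t) ] V
    then⇓  : ∀ {b c d T U t} → b (mapⱽ head T) ≡ true → c ⊢ T ⇓[ t ] U → cond b c d ⊢ T ⇓[ suc t ] U
    else⇓  : ∀ {b c d T U t} → b (mapⱽ head T) ≡ false → d ⊢ T ⇓[ t ] U → cond b c d ⊢ T ⇓[ suc t ] U

  -- One control point for each primitive and each test; these are the states of the compiled
  -- machine.
  Point : Cmd K → Set
  Point (prim _)     = ⊤
  Point (c ⨟ d)      = Point c ⊎ Point d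
  Point (while _ c)  = ⊤ ⊎ Point c
  Point (cond _ c d) = ⊤ ⊎ (Point c ⊎ Point d)

  Finite-Point : ∀ c → Finite (Point c)
  Finite-Point (prim _)     = Finite-⊤
  Finite-Point (c ⨟ d)      = Finite-⊎ (Finite-Point c) (Finite-Point d)
  Finite-Point (while _ c)  = Finite-⊎ Finite-⊤ (Finite-Point c)
  Finite-Point (cond _ c d) = Finite-⊎ Finite-⊤ (Finite-⊎ (Finite-Point c) (Finite-Point d))

  entry : ∀ c → Point c
  entry (prim _)     = tt
  entry (c ⨟ _)      = inj₁ (entry c)
  entry (while _ _)  = inj₁ tt
  entry (cond _ _ _) = inj₁ tt

  idle : Vec Sym K → Vec (Sym × Direction) K
  idle = mapⱽ (_, stay)

  -- The point nothing is the exit.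
  goto : ∀ c → Point c → Vec Sym K → Maybe (Point c) × Vec (Sym × Direction) K
  goto (prim f)     _               σ = nothing , f σ
  goto (c ⨟ d)      (inj₁ p)        σ = map₁ (maybe′ (just ∘ inj₁) (just (inj₂ (entry d)))) (goto c p σ)
  goto (c ⨟ d)      (inj₂ p)        σ = map₁ (maybe′ (just ∘ inj₂) nothing) (goto d p σ)
  goto (while b c)  (inj₁ _)        σ with b σ
  ... | true  = just (inj₂ (entry c)) , idle σ
  ... | false = nothing , idle σ
  goto (while b c)  (inj₂ p)        σ = map₁ (maybe′ (just ∘ inj₂) (just (inj₁ tt))) (goto c p σ)
  goto (cond b c d) (inj₁ _)        σ with b σ
  ... | true  = just (inj₂ (inj₁ (entry c))) , idle σ
  ... | false = just (inj₂ (inj₂ (entry d))) , idle σ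
  goto (cond b c d) (inj₂ (inj₁ p)) σ = map₁ (maybe′ (just ∘ inj₂ ∘ inj₁) nothing) (goto c p σ)
  goto (cond b c d) (inj₂ (inj₂ p)) σ = map₁ (maybe′ (just ∘ inj₂ ∘ inj₂) nothing) (goto d p σ)

  data Steps (c : Cmd K) : Point c → Tapes → ℕ → Maybe (Point c) → Tapes → Set where
    last : ∀ {p T r as} → goto c p (mapⱽ head T) ≡ (r , as) → Steps c p T 1 r (zipWith act as T)
    more : ∀ {p q T t r U as} → goto c p (mapⱽ head T) ≡ (just q , as) →
           Steps c q (zipWith act as T) t r U → Steps c p T (suc t) r U

  Steps-trans : ∀ {c p q T U V s t r} → Steps c p T s (just q) U → Steps c q U t r V → Steps c p T (s + t) r V
  Steps-trans (last e)   ys = more e ys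
  Steps-trans (more e xs) ys = more e (Steps-trans xs ys)

  -- A subcommand runs inside a larger command as it does alone, except that its exit leads to `x`.
  -- This one statement serves every way of composing commands.
  Steps-embed : ∀ {c d} (ι : Point c → Point d) (x : Maybe (Point d)) →
                (∀ p σ → goto d (ι p) σ ≡ map₁ (maybe′ (just ∘ ι) x) (goto c p σ)) →
                ∀ {p T t r U} → Steps c p T t r U → Steps d (ι p) T t (maybe′ (just ∘ ι) x r) U
  Steps-embed ι x h {p} (last e)    = last (trans (h p _) (cong (map₁ _) e))
  Steps-embed ι x h {p} (more e xs) = more (trans (h p _) (cong (map₁ (maybe′ (just ∘ ι) x)) e)) (Steps-embed ι x h xs)

  private
    idle-step : ∀ {c p r T} → goto c p (mapⱽ head T) ≡ (r , idle (mapⱽ head T)) → Steps c p T 1 r T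
    idle-step {c} {p} {r} {T} e = subst (Steps c p T 1 r) (idle-act T) (last e)

    while-true : ∀ {b c σ} → b σ ≡ true → goto (while b c) (inj₁ tt) σ ≡ (just (inj₂ (entry c)) , idle σ)
    while-true e rewrite e = refl

    while-false : ∀ {b c σ} → b σ ≡ false → goto (while b c) (inj₁ tt) σ ≡ (nothing , idle σ)
    while-false e rewrite e = refl

    cond-true : ∀ {b c d σ} → b σ ≡ true → goto (cond b c d) (inj₁ tt) σ ≡ (just (inj₂ (inj₁ (entry c))) , idle σ)
    cond-true e rewrite e = refl

    cond-false : ∀ {b c d σ} → b σ ≡ false → goto (cond b c d) (inj₁ tt) σ ≡ (just (inj₂ (inj₂ (entry d))) , idle σ)
    cond-false e rewrite e = refl

  ⇓⇒Steps : ∀ {c T t U} → c ⊢ T ⇓[ t ] U → Steps c (entry c) T t nothing U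
  ⇓⇒Steps prim⇓ = last refl
  ⇓⇒Steps (seq⇓ {d = d} x y) =
    Steps-trans (Steps-embed inj₁ (just (inj₂ (entry d))) (λ _ _ → refl) (⇓⇒Steps x))
                (Steps-embed inj₂ nothing (λ _ _ → refl) (⇓⇒Steps y))
  ⇓⇒Steps (stop⇓ {b} {c} e) = idle-step (while-false {b} {c} e)
  ⇓⇒Steps (go⇓ {b} {c} e x y) =
    Steps-trans (idle-step (while-true {b} {c} e))
      (Steps-trans (Steps-embed inj₂ (just (inj₁ tt)) (λ _ _ → refl) (⇓⇒Steps x)) (⇓⇒Steps y))
  ⇓⇒Steps (then⇓ {b} {c} {d} e x) =
    Steps-trans (idle-step (cond-true {b} {c} {d} e)) (Steps-embed (inj₂ ∘ inj₁) nothing (λ _ _ → refl) (⇓⇒Steps x))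
  ⇓⇒Steps (else⇓ {b} {c} {d} e x) =
    Steps-trans (idle-step (cond-false {b} {c} {d} e)) (Steps-embed (inj₂ ∘ inj₂) nothing (λ _ _ → refl) (⇓⇒Steps x))

-- The extra state `inj₁ tt` stands for the exit and is the only one where the machine halts.
machine : ∀ {k} → Cmd (1 + k) → TM 1
machine {k} c = record
  { State = ⊤ ⊎ Point c
  ; Aux = ⊥
  ; finite-State = Finite-⊎ Finite-⊤ (Finite-Point c)
  ; finite-Aux = Finite-⊥
  ; #work = k
  ; start = inj₂ (entry c)
  ; accepting = λ _ → true
  ; δ = transition
  }
  where
  transition : ⊤ ⊎ Point c → Vec Sym (1 + k) → Maybe ((⊤ ⊎ Point c) × Vec (Sym × Direction) (1 + k))
  transition (inj₁ _) σ = nothing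
  transition (inj₂ p) σ = just (map₁ (maybe′ inj₂ (inj₁ tt)) (goto c p σ))

run-+ : ∀ {m} (M : TM m) s t c → run M (s + t) c ≡ run M t (run M s c)
run-+ M zero    t c = refl
run-+ M (suc s) t c = run-+ M s t (step M c)

module _ {m : ℕ} (M : TM m) where

  step-halted : ∀ {c} → Halted M c → step M c ≡ c
  step-halted {c} e with next M c
  step-halted {c} refl | nothing = refl

  run-halted : ∀ {c} t → Halted M c → run M t c ≡ c
  run-halted zero    e = refl
  run-halted (suc t) e = trans (cong (run M t) (step-halted e)) (run-halted t e)

  run-halted-≤ : ∀ {c s t} → s ≤ t → Halted M (run M s c) → run M t c ≡ run M s c
  run-halted-≤ {c} {s} s≤t e with o , refl ← m≤n⇒∃[o]m+o≡n s≤t = trans (run-+ M s o c) (run-halted o e)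

module _ {k : ℕ} (c : Cmd (1 + k)) where

  step-machine : ∀ p T {r as} → goto c p (mapⱽ head T) ≡ (r , as) →
                 step (machine c) (config (inj₂ p) T) ≡ config (maybe′ inj₂ (inj₁ tt) r) (zipWith act as T)
  step-machine p T e rewrite e = refl

  run-machine : ∀ {p T t U} → Steps c p T t nothing U → run (machine c) t (config (inj₂ p) T) ≡ config (inj₁ tt) U
  run-machine (last e)    = step-machine _ _ e
  run-machine (more {t = t} e xs) = trans (cong (run (machine c) t) (step-machine _ _ e)) (run-machine xs)

isBlank : Sym → Bool
isBlank blank   = true
isBlank (bit _) = false

isBit : Sym → Bool
isBit blank   = false
isBit (bit _) = true

-- Hoare triples with time bounds

Assertion : ℕ → Set₁
Assertion K = Vec (Tape ⊥) K → Set

-- Total correctness. The bound is an inequality although the semantics counts exactly, so that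
-- costs can be rounded up to polynomials.
record Hoare (c : Cmd K) (P Q : Assertion K) (b : ℕ) : Set where
  constructor hoare
  field
    exec : ∀ {T} → P T → ∃₂ λ U t → c ⊢ T ⇓[ t ] U × Q U × t ≤ b

open Hoare

module _ {P Q : Assertion K} where

  weaken : ∀ {c b b′} → b ≤ b′ → Hoare c P Q b → Hoare c P Q b′
  weaken b≤b′ h .exec p with U , t , x , q , t≤b ← exec h p = U , t , x , q , ≤-trans t≤b b≤b′

  seq : ∀ {R : Assertion K} {c d a b} → Hoare c P Q a → Hoare d Q R b → Hoare (c ⨟ d) P R (a + b)
  seq h k .exec p with U , s , x , q , s≤a ← exec h p with V , t , y , r , t≤b ← exec k q =
    V , s + t , seq⇓ x y , r , +-mono-≤ s≤a t≤b

  while-go : ∀ {R : Assertion K} {f c a b} → (∀ {T} → P T → f (mapⱽ head T) ≡ true) →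
             Hoare c P Q a → Hoare (while f c) Q R b → Hoare (while f c) P R (1 + (a + b))
  while-go e h k .exec p with U , s , x , q , s≤a ← exec h p with V , t , y , r , t≤b ← exec k q =
    V , 1 + (s + t) , go⇓ (e p) x y , r , s≤s (+-mono-≤ s≤a t≤b)

  then-go : ∀ {f c d a} → (∀ {T} → P T → f (mapⱽ head T) ≡ true) → Hoare c P Q a → Hoare (cond f c d) P Q (1 + a)
  then-go e h .exec p with U , s , x , q , s≤a ← exec h p = U , 1 + s , then⇓ (e p) x , q , s≤s s≤a

  else-go : ∀ {f c d a} → (∀ {T} → P T → f (mapⱽ head T) ≡ false) → Hoare d P Q a → Hoare (cond f c d) P Q (1 + a)
  else-go e h .exec p with U , s , x , q , s≤a ← exec h p = U , 1 + s , else⇓ (e p) x , q , s≤s s≤a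

  prim-runs : ∀ {f} → (∀ {T} → P T → Q (zipWith act (f (mapⱽ head T)) T)) → Hoare (prim f) P Q 1
  prim-runs h .exec p = _ , 1 , prim⇓ , h p , ≤-refl

while-stop : ∀ {P : Assertion K} {f c} → (∀ {T} → P T → f (mapⱽ head T) ≡ false) → Hoare (while f c) P P 1
while-stop e .exec {T} p = T , 1 , stop⇓ (e p) , p , ≤-refl

only : Fin K → (Sym → Sym × Direction) → Cmd K
only x f = prim λ σ → updateAt (idle σ) x (f ∘ proj₁)

zipWith-only : ∀ (x : Fin K) f (T : Vec (Tape ⊥) K) →
               zipWith act (updateAt (idle (mapⱽ head T)) x (f ∘ proj₁)) T ≡ updateAt T x (λ t → act (f (head t)) t)
zipWith-only zero    f (t ∷ T) = cong (_ ∷_) (idle-act T)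
zipWith-only (suc x) f (t ∷ T) = cong (t ∷_) (zipWith-only x f T)

only-runs : ∀ {P Q : Assertion K} x f → (∀ {T} → P T → Q (updateAt T x (λ t → act (f (head t)) t))) →
            Hoare (only x f) P Q 1
only-runs {Q = Q} x f h = prim-runs λ {T} p → subst Q (sym (zipWith-only x f T)) (h p)

-- Counters, stack and output on tapes

blanks : ℕ → List Sym
blanks k = replicate k blank

-- A counter marks cell 0 by a bit, and its value is the position of the head.
counter : ℕ → ℕ → Tape ⊥
counter zero    k = tape [] (bit true) (blanks k)
counter (suc v) k = tape (blanks v ++ [ bit true ]) blank (blanks k)

-- Visited cells stay recorded, so the value does not determine the tape: `k` counts the visited
-- cells beyond the head.
IsCounter : ℕ → Tape ⊥ → Set
IsCounter v t = ∃[ k ] t ≡ counter v k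

-- The output goes on the input tape after the input has been erased there; the `k` blanks are what
-- the erased input leaves behind.
IsOutput : Word → Tape ⊥ → Set
IsOutput w t = ∃[ k ] t ≡ tape (mapᴸ bit (reverse w) ++ blanks k) blank []

-- The top is under the head. Popping moves left without erasing, so arbitrary rubbish `r` may lie
-- to the right.
stack : Word → List Sym → Tape ⊥
stack []      r = tape [] blank r
stack (b ∷ w) r = tape (mapᴸ bit w) (bit b) r

IsStack : Word → Tape ⊥ → Set
IsStack w t = ∃[ r ] t ≡ stack w r

record Store : Set where
  constructor store
  field
    out stk  : Word
    counters : Vec ℕ 7

open Store

#tapes : ℕ
#tapes = 9

infix 4 _∼_

data _∼_ : Vec (Tape ⊥) #tapes → Store → Set where
  rep : ∀ {o k cs t u T} → IsOutput o t → IsStack k u → Pointwise IsCounter cs T → t ∷ u ∷ T ∼ store o k cs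

Runs : Cmd #tapes → Store → Store → ℕ → Set
Runs c S S′ b = Hoare c (_∼ S) (_∼ S′) b

skip : Cmd #tapes
skip = prim idle

skip-runs : ∀ {S} → Runs skip S S 1
skip-runs {S} = prim-runs λ {T} p → subst (_∼ S) (sym (idle-act T)) p

emit₁ : Bool → Cmd #tapes
emit₁ b = only zero (λ _ → bit b , right)

emit₁-runs : ∀ {o k cs} b → Runs (emit₁ b) (store o k cs) (store (o ++ [ b ]) k cs) 1
emit₁-runs {o} b = only-runs zero _ λ where
  (rep (k , refl) s cs) →
    rep (k , cong (λ w → tape (mapᴸ bit w ++ blanks k) blank []) (sym (reverse-++ o [ b ]))) s cs

incr decr : Fin 7 → Cmd #tapes
incr x = only (suc (suc x)) (λ s → s , right)
decr x = only (suc (suc x)) (λ s → s , left)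

counter-incr : ∀ {v t} → IsCounter v t → IsCounter (suc v) (move right t)
counter-incr {zero}  (zero  , refl) = 0 , refl
counter-incr {zero}  (suc k , refl) = k , refl
counter-incr {suc v} (zero  , refl) = 0 , refl
counter-incr {suc v} (suc k , refl) = k , refl

counter-decr : ∀ {v t} → IsCounter (suc v) t → IsCounter v (move left t)
counter-decr {zero}  (k , refl) = suc k , refl
counter-decr {suc v} (k , refl) = suc k , refl

Pointwise-updateAt : ∀ {n} {cs : Vec ℕ n} {T} x {f g} → (IsCounter (lookup cs x) (lookup T x) →
                     IsCounter (f (lookup cs x)) (g (lookup T x))) → Pointwise IsCounter cs T →
                     Pointwise IsCounter (updateAt cs x f) (updateAt T x g)
Pointwise-updateAt zero    h (r ∷ rs) = h r ∷ rs
Pointwise-updateAt (suc x) h (r ∷ rs) = r ∷ Pointwise-updateAt x h rs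

incr-runs : ∀ {o k cs} x → Runs (incr x) (store o k cs) (store o k (updateAt cs x suc)) 1
incr-runs x = only-runs (suc (suc x)) _ λ where
  (rep o k cs) → rep o k (Pointwise-updateAt x counter-incr cs)

decr-runs : ∀ {o k cs v} x → lookup cs x ≡ suc v → Runs (decr x) (store o k cs) (store o k (updateAt cs x pred)) 1
decr-runs x e = only-runs (suc (suc x)) _ λ where
  (rep o k cs) → rep o k (Pointwise-updateAt x
    (λ c → subst (λ v → IsCounter (pred v) _) (sym e) (counter-decr (subst (λ v → IsCounter v _) e c))) cs)

while≢0 : Fin 7 → Cmd #tapes → Cmd #tapes
while≢0 x = while (λ σ → isBlank (lookup σ (suc (suc x))))

counter-blank : ∀ {n} {cs : Vec ℕ n} {T} x → Pointwise IsCounter cs T → ∃[ k ] lookup T x ≡ counter (lookup cs x) k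
counter-blank zero    (r ∷ rs) = r
counter-blank (suc x) (r ∷ rs) = counter-blank x rs

nonzero : ∀ {T S v} x → lookup (counters S) x ≡ suc v → T ∼ S → isBlank (lookup (mapⱽ head T) (suc (suc x))) ≡ true
nonzero {T = T} x e (rep {cs = cs} o k r)
  with c , eq ← counter-blank x r
  rewrite lookup-map (suc (suc x)) head T | eq | e = refl

is-zero : ∀ {T S} x → lookup (counters S) x ≡ 0 → T ∼ S → isBlank (lookup (mapⱽ head T) (suc (suc x))) ≡ false
is-zero {T = T} x e (rep {cs = cs} o k r)
  with c , eq ← counter-blank x r
  rewrite lookup-map (suc (suc x)) head T | eq | e = refl

-- In `S k j`, `k` rounds are left and `j` are done. The equation given to the body supplies
-- `j < n`, which a body needs when its cost is only bounded for small indices.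
countdown : ∀ x {c b n} (S : ℕ → ℕ → Store) → (∀ k j → lookup (counters (S k j)) x ≡ k) →
            (∀ k j → suc (k + j) ≡ n → Runs c (S (suc k) j) (S k (suc j)) b) →
            Runs (while≢0 x c) (S n 0) (S 0 n) (1 + n * (1 + b))
countdown x {c} {b} {n} S ctr h = loop n 0 (+-identityʳ n)
  where
  loop : ∀ k j → k + j ≡ n → Runs (while≢0 x c) (S k j) (S 0 n) (1 + k * (1 + b))
  loop zero    j refl = while-stop (is-zero x (ctr 0 j))
  loop (suc k) j e    = weaken (≤-reflexive (cong suc (+-suc b (k * (1 + b) ))))
    (while-go (nonzero x (ctr (suc k) j)) (h k j e) (loop k (suc j) (trans (+-suc k j) e)))

emit : Word → Cmd #tapes
emit []      = skip
emit (b ∷ w) = emit₁ b ⨟ emit w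

emit-runs : ∀ {o k cs} w → Runs (emit w) (store o k cs) (store (o ++ w) k cs) (1 + length w)
emit-runs {o} {k} {cs} []      = subst (λ w → Runs skip (store o k cs) (store w k cs) 1) (sym (++-identityʳ o)) skip-runs
emit-runs {o} {k} {cs} (b ∷ w) =
  subst (λ u → Runs (emit (b ∷ w)) (store o k cs) (store u k cs) (2 + length w)) (++-assoc o [ b ] w)
    (seq (emit₁-runs b) (emit-runs w))

incrs : Fin 7 → ℕ → Cmd #tapes
incrs x zero    = skip
incrs x (suc c) = incrs x c ⨟ incr x

-- Quantified Boolean formulas and their codes

-- The tag in `A` determines how a variable is quantified and which gadget implements it. Literals
-- repeat the tag of their variable, so that code can be emitted without knowing the context.
data QBF (A Y : Set) : Set where
  lit      : A → Bool → Y → QBF A Y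
  _and_    : QBF A Y → QBF A Y → QBF A Y
  _or_     : QBF A Y → QBF A Y → QBF A Y
  bind : A → QBF A Y → QBF A Y

-- In a literal code, nothing stands for the shift of the free variables.
record Style (A : Set) : Set where
  field
    width : ℕ
    andW  : Word
    orW   : Word
    quW   : A → Word
    litW  : A → Bool → List (Maybe Bool)

fill : ℕ → List (Maybe Bool) → Word
fill d []             = []
fill d (just b ∷ ts)  = b ∷ fill d ts
fill d (nothing ∷ ts) = replicate d true ++ fill d ts

-- Positions of variables are affine in the size parameter `v` and a loop index `i`. This is what
-- makes a unary index a concatenation of repeated constant words.
record Affine : Set where
  constructor affine
  field
    a b c : ℕ

value : ℕ → ℕ → Affine → ℕ
value v i (affine a b c) = a * v + (b * i + c)

Template : Set → Set
Template A = QBF A Affine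

inst : ℕ → ℕ → Template A → QBF A ℕ
inst v i (lit a b x)    = lit a b (value v i x)
inst v i (t and u)      = inst v i t and inst v i u
inst v i (t or u)       = inst v i t or inst v i u
inst v i (bind a t) = bind a (inst v i t)

module _ (σ : Style A) where
  open Style σ

  code : QBF A ℕ → Word
  code (lit a b x)    = fill (width * x) (litW a b)
  code (φ and ψ)      = andW ++ code φ ++ code ψ
  code (φ or ψ)       = orW ++ code φ ++ code ψ
  code (bind a φ) = quW a ++ code φ

-- Repetition of words, and programs that emit templates

power : ℕ → List Z → List Z
power zero    w = []
power (suc n) w = w ++ power n w

power-comm : (n : ℕ) (w : List Z) → power n w ++ w ≡ power (suc n) w
power-comm zero    w = sym (++-identityʳ w)
power-comm (suc n) w = trans (++-assoc w (power n w) w) (cong (w ++_) (power-comm n w))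

++-snoc-power : (o : List Z) (n : ℕ) (w : List Z) → (o ++ power n w) ++ w ≡ o ++ power (suc n) w
++-snoc-power o n w = trans (++-assoc o (power n w) w) (cong (o ++_) (power-comm n w))

concatUpTo : (ℕ → List Z) → ℕ → List Z
concatUpTo f zero    = []
concatUpTo f (suc n) = concatUpTo f n ++ f n

replicate-+ : (z : Z) (m n : ℕ) → replicate (m + n) z ≡ replicate m z ++ replicate n z
replicate-+ z zero    n = refl
replicate-+ z (suc m) n = cong (z ∷_) (replicate-+ z m n)

power-replicate : (z : Z) (n m : ℕ) → power n (replicate m z) ≡ replicate (n * m) z
power-replicate z zero    m = refl
power-replicate z (suc n) m = trans (cong (replicate m z ++_) (power-replicate z n m)) (sym (replicate-+ z m (n * m)))

-- The input length, the bounds of the specification, a scratch counter, the index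
-- of a template, and the counters of the inner and outer loops.
pattern #N = 0F
pattern #V = 1F
pattern #Q = 2F
pattern #S = 3F
pattern #I = 4F
pattern #R = 5F
pattern #L = 6F

st : Word → Word → (n v q s i r l : ℕ) → Store
st o k n v q s i r l = store o k (n ∷ v ∷ q ∷ s ∷ i ∷ r ∷ l ∷ [])

-- Bounding the index by `v` makes the cost a polynomial in `v` alone. The scratch counter is zero
-- before and after, so that such programs compose.
record Emits (c : Cmd #tapes) (f : ℕ → ℕ → Word) (p : Polynomial) : Set where
  constructor emitting
  field
    run-emit : ∀ {o k n v q i r l} → i ≤ v →
               Runs c (st o k n v q 0 i r l) (st (o ++ f v i) k n v q 0 i r l) (eval p v)

open Emits

out-≡ : ∀ {c P o o′ k cs b} → o ≡ o′ → Hoare c P (_∼ store o k cs) b → Hoare c P (_∼ store o′ k cs) b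
out-≡ refl h = h

Emits-≡ : ∀ {c f g p} → (∀ v i → f v i ≡ g v i) → Emits c f p → Emits c g p
Emits-≡ e h .run-emit {o} {v = v} {i = i} i≤v = out-≡ (cong (o ++_) (e v i)) (run-emit h i≤v)

emit-emits : ∀ w → Emits (emit w) (λ _ _ → w) (const (1 + length w))
emit-emits w .run-emit _ = emit-runs w

seq-emits : ∀ {c d f g p q} → Emits c f p → Emits d g q → Emits (c ⨟ d) (λ v i → f v i ++ g v i) (p ⊕ q)
seq-emits h k .run-emit {o} i≤v = out-≡ (++-assoc o _ _) (seq (run-emit h i≤v) (run-emit k i≤v))

-- A counter is read by draining it. Loops therefore copy it to the scratch counter, from which it
-- is moved back here.
restore : Fin 7 → Cmd #tapes
restore x = while≢0 #S (decr #S ⨟ incr x)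

loopCost : ℕ → Polynomial
loopCost c = const 1 ⊕ (X ⊗ const (1 + c))

powV powI : Word → Cmd #tapes
powV w = while≢0 #V (decr #V ⨟ incr #S ⨟ emit w) ⨟ restore #V
powI w = while≢0 #I (decr #I ⨟ incr #S ⨟ emit w) ⨟ restore #I

powCost : Word → Polynomial
powCost w = loopCost (1 + (1 + (1 + length w))) ⊕ loopCost 2

powV-emits : ∀ w → Emits (powV w) (λ v _ → power v w) (powCost w)
powV-emits w .run-emit {o} {k} {n} {v} {q} {i} {r} {l} _ =
  seq (countdown #V (λ x j → st (o ++ power j w) k n x q j i r l) (λ _ _ → refl)
        (λ x j _ → out-≡ (++-snoc-power o j w) (seq (decr-runs #V refl) (seq (incr-runs #S) (emit-runs w)))) ▹)
      (countdown #S (λ x j → st (o ++ power v w) k n j q x i r l) (λ _ _ → refl)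
        (λ x j _ → seq (decr-runs #S refl) (incr-runs #V)))
  where
  _▹ : ∀ {c cs b T′} → Hoare c (_∼ store (o ++ []) k cs) T′ b → Hoare c (_∼ store o k cs) T′ b
  _▹ {c} {cs} {b} {T′} = subst (λ u → Hoare c (_∼ store u k cs) T′ b) (++-identityʳ o)

powI-emits : ∀ w → Emits (powI w) (λ _ i → power i w) (powCost w)
powI-emits w .run-emit {o} {k} {n} {v} {q} {i} {r} {l} i≤v =
  weaken (+-mono-≤ (s≤s (*-monoˡ-≤ _ i≤v)) (s≤s (*-monoˡ-≤ 3 i≤v)))
  (seq (countdown #I (λ x j → st (o ++ power j w) k n v q j x r l) (λ _ _ → refl)
        (λ x j _ → out-≡ (++-snoc-power o j w) (seq (decr-runs #I refl) (seq (incr-runs #S) (emit-runs w)))) ▹)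
      (countdown #S (λ x j → st (o ++ power i w) k n v q x j r l) (λ _ _ → refl)
        (λ x j _ → seq (decr-runs #S refl) (incr-runs #I))))
  where
  _▹ : ∀ {c cs b T′} → Hoare c (_∼ store (o ++ []) k cs) T′ b → Hoare c (_∼ store o k cs) T′ b
  _▹ {c} {cs} {b} {T′} = subst (λ u → Hoare c (_∼ store u k cs) T′ b) (++-identityʳ o)

module _ (σ : Style A) where
  open Style σ

  trues : ℕ → Word
  trues n = replicate n true

  -- Multiplication by `width` is done when the program is written, not when it runs: `v` copies of
  -- one constant word, `i` copies of a second, then a third.
  emitGap : Affine → Cmd #tapes
  emitGap (affine a b c) = powV (trues (width * a)) ⨟ powI (trues (width * b)) ⨟ emit (trues (width * c))

  gapCost : Affine → Polynomial
  gapCost (affine a b c) =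
    powCost (trues (width * a)) ⊕ (powCost (trues (width * b)) ⊕ const (1 + length (trues (width * c))))

  emitGap-emits : ∀ x → Emits (emitGap x) (λ v i → trues (width * value v i x)) (gapCost x)
  emitGap-emits x@(affine a b c) =
    Emits-≡ eq (seq-emits (powV-emits _) (seq-emits (powI-emits _) (emit-emits _)))
    where
    distr : ∀ w a b c v i → v * (w * a) + (i * (w * b) + w * c) ≡ w * (a * v + (b * i + c))
    distr = solve-∀

    eq : ∀ v i → power v (trues (width * a)) ++ power i (trues (width * b)) ++ trues (width * c)
               ≡ trues (width * value v i x)
    eq v i rewrite power-replicate true v (width * a) | power-replicate true i (width * b)
                 | sym (replicate-+ true (i * (width * b)) (width * c))
                 | sym (replicate-+ true (v * (width * a)) (i * (width * b) + width * c)) =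
      cong trues (distr width a b c v i)

  emitLit : Affine → List (Maybe Bool) → Cmd #tapes
  emitLit x []             = skip
  emitLit x (just b ∷ ts)  = emit [ b ] ⨟ emitLit x ts
  emitLit x (nothing ∷ ts) = emitGap x ⨟ emitLit x ts

  litCost : Affine → List (Maybe Bool) → Polynomial
  litCost x []             = const 1
  litCost x (just b ∷ ts)  = const 2 ⊕ litCost x ts
  litCost x (nothing ∷ ts) = gapCost x ⊕ litCost x ts

  emitLit-emits : ∀ x ts → Emits (emitLit x ts) (λ v i → fill (width * value v i x) ts) (litCost x ts)
  emitLit-emits x []             = emit-emits []
  emitLit-emits x (just b ∷ ts)  = seq-emits (emit-emits [ b ]) (emitLit-emits x ts)
  emitLit-emits x (nothing ∷ ts) = seq-emits (emitGap-emits x) (emitLit-emits x ts)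

  emitTemplate : Template A → Cmd #tapes
  emitTemplate (lit a b x)    = emitLit x (litW a b)
  emitTemplate (t and u)      = emit andW ⨟ emitTemplate t ⨟ emitTemplate u
  emitTemplate (t or u)       = emit orW ⨟ emitTemplate t ⨟ emitTemplate u
  emitTemplate (bind a t) = emit (quW a) ⨟ emitTemplate t

  templateCost : Template A → Polynomial
  templateCost (lit a b x)    = litCost x (litW a b)
  templateCost (t and u)      = const (1 + length andW) ⊕ (templateCost t ⊕ templateCost u)
  templateCost (t or u)       = const (1 + length orW) ⊕ (templateCost t ⊕ templateCost u)
  templateCost (bind a t) = const (1 + length (quW a)) ⊕ templateCost t

  emitTemplate-emits : ∀ t → Emits (emitTemplate t) (λ v i → code σ (inst v i t)) (templateCost t)
  emitTemplate-emits (lit a b x)    = emitLit-emits x (litW a b)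
  emitTemplate-emits (t and u)      =
    seq-emits (emit-emits andW) (seq-emits (emitTemplate-emits t) (emitTemplate-emits u))
  emitTemplate-emits (t or u)       =
    seq-emits (emit-emits orW) (seq-emits (emitTemplate-emits t) (emitTemplate-emits u))
  emitTemplate-emits (bind a t) = seq-emits (emit-emits (quW a)) (emitTemplate-emits t)

start-≡ : ∀ {c Q o o′ k cs b} → o ≡ o′ → Hoare c (_∼ store o k cs) Q b → Hoare c (_∼ store o′ k cs) Q b
start-≡ refl h = h

counters-≡ : ∀ {c P o k cs cs′ b} → cs ≡ cs′ → Hoare c P (_∼ store o k cs) b → Hoare c P (_∼ store o k cs′) b
counters-≡ refl h = h

incrs-runs : ∀ {o k cs} x m → Runs (incrs x m) (store o k cs) (store o k (updateAt cs x (m +_))) (1 + m)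
incrs-runs {cs = cs} x zero    = counters-≡ (sym (updateAt-id x cs)) skip-runs
incrs-runs {cs = cs} x (suc m) =
  weaken (≤-reflexive (+-comm (1 + m) 1))
    (counters-≡ (updateAt-updateAt x cs) (seq (incrs-runs x m) (incr-runs x)))

-- Evaluation of polynomials by Horner's rule

polynomial : List ℕ → Polynomial
polynomial []       = const 0
polynomial (c ∷ cs) = const c ⊕ (polynomial cs ⊗ X)

-- `addN` adds `#N` to `#R` and keeps `#N`; `mulN` multiplies `#V` by `#N`, with `#R` as
-- accumulator.
addN mulN : Cmd #tapes
addN = while≢0 #N (decr #N ⨟ incr #S ⨟ incr #R) ⨟ restore #N
mulN = while≢0 #V (decr #V ⨟ addN) ⨟ while≢0 #R (decr #R ⨟ incr #V)

horner : List ℕ → Cmd #tapes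
horner []       = skip
horner (c ∷ cs) = horner cs ⨟ mulN ⨟ incrs #V c

addCost : Polynomial
addCost = loopCost 3 ⊕ loopCost 2

hornerCost : List ℕ → Polynomial
hornerCost []       = const 1
hornerCost (c ∷ cs) = hornerCost cs ⊕
  (((const 1 ⊕ (polynomial cs ⊗ (const 2 ⊕ addCost))) ⊕ (const 1 ⊕ ((polynomial cs ⊗ X) ⊗ const 3))) ⊕ const (1 + c))

addN-runs : ∀ {o k n v q i r l} →
            Runs addN (st o k n v q 0 i r l) (st o k n v q 0 i (n + r) l) (eval addCost n)
addN-runs {o} {k} {n} {v} {q} {i} {r} {l} =
  seq (countdown #N (λ x j → st o k x v q j i (j + r) l) (λ _ _ → refl)
        (λ x j _ → seq (decr-runs #N refl) (seq (incr-runs #S) (incr-runs #R))))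
      (countdown #S (λ x j → st o k j v q x i (n + r) l) (λ _ _ → refl)
        (λ x j _ → seq (decr-runs #S refl) (incr-runs #N)))

horner-runs : ∀ {o k n q i l} cs → Runs (horner cs) (st o k n 0 q 0 i 0 l)
              (st o k n (eval (polynomial cs) n) q 0 i 0 l) (eval (hornerCost cs) n)
horner-runs []       = skip-runs
horner-runs {o} {k} {n} {q} {i} {l} (c ∷ cs) =
  seq (horner-runs cs)
  (seq (seq (countdown #V (λ x j → st o k n x q 0 i (j * n) l) (λ _ _ → refl)
              (λ x j _ → seq (decr-runs #V refl) addN-runs))
            (countdown #R (λ x j → st o k n j q 0 i x l) (λ _ _ → refl)
              (λ x j _ → seq (decr-runs #R refl) (incr-runs #V))))
       (incrs-runs #V c))

-- Chains of conjuncts and binders, and their generators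

data Item (A Y : Set) : Set where
  conj  : QBF A Y → Item A Y
  bound : A → Item A Y

-- A formula with a single spine, each item having the rest of the formula as its last argument. In
-- prefix notation nothing has to be closed, so the code of a chain is the concatenation of the
-- codes of its items.
Chain : Set → Set
Chain A = List (Item A ℕ)

apply : Chain A → QBF A ℕ → QBF A ℕ
apply []             φ = φ
apply (conj ψ ∷ ch)  φ = ψ and apply ch φ
apply (bound a ∷ ch) φ = bind a (apply ch φ)

-- (v + 2) * e, in the affine form that the program can emit.
blockSize : ℕ → ℕ → ℕ
blockSize e v = e * v + 2 * e

data Gen (A : Set) : Set where
  block : A → Gen A
  test  : Template A → Gen A
  tests : Template A → Gen A
  _▸_   : Gen A → Gen A → Gen A

infixr 5 _▸_

module _ (e : ℕ) where

  chain : Gen A → ℕ → Chain A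
  chain (block a) v = replicate (blockSize e v) (bound a)
  chain (test t)  v = [ conj (inst v 0 t) ]
  chain (tests t) v = concatUpTo (λ i → [ conj (inst v i t) ]) v
  chain (g ▸ h)   v = chain g v ++ chain h v

module _ (σ : Style A) where
  open Style σ

  codeItem : Item A ℕ → Word
  codeItem (conj φ)  = andW ++ code σ φ
  codeItem (bound a) = quW a

  codeChain : Chain A → Word
  codeChain []       = []
  codeChain (x ∷ xs) = codeItem x ++ codeChain xs

  codeChain-++ : ∀ xs ys → codeChain (xs ++ ys) ≡ codeChain xs ++ codeChain ys
  codeChain-++ []       ys = refl
  codeChain-++ (x ∷ xs) ys =
    trans (cong (codeItem x ++_) (codeChain-++ xs ys)) (sym (++-assoc (codeItem x) (codeChain xs) (codeChain ys)))

  codeChain-power : ∀ n xs → codeChain (power n xs) ≡ power n (codeChain xs)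
  codeChain-power zero    xs = refl
  codeChain-power (suc n) xs = trans (codeChain-++ xs (power n xs)) (cong (codeChain xs ++_) (codeChain-power n xs))

  codeChain-replicate : ∀ n x → codeChain (replicate n x) ≡ power n (codeItem x)
  codeChain-replicate zero    x = refl
  codeChain-replicate (suc n) x = cong (codeItem x ++_) (codeChain-replicate n x)

  codeChain-concatUpTo : ∀ f n → codeChain (concatUpTo f n) ≡ concatUpTo (codeChain ∘ f) n
  codeChain-concatUpTo f zero    = refl
  codeChain-concatUpTo f (suc n) =
    trans (codeChain-++ (concatUpTo f n) (f n)) (cong (_++ codeChain (f n)) (codeChain-concatUpTo f n))

  code-apply : ∀ ch φ → code σ (apply ch φ) ≡ codeChain ch ++ code σ φ
  code-apply []             φ = refl
  code-apply (conj ψ ∷ ch)  φ = trans (cong (λ w → andW ++ code σ ψ ++ w) (code-apply ch φ))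
    (sym (trans (++-assoc (andW ++ code σ ψ) (codeChain ch) (code σ φ)) (++-assoc andW (code σ ψ) _)))
  code-apply (bound a ∷ ch) φ = trans (cong (quW a ++_) (code-apply ch φ)) (sym (++-assoc (quW a) _ _))

-- Here `#I` and `#R` start and end at zero, because `forV` takes them as its index and its loop
-- counter; `#L` is left to the loop over layers.
record Emits₀ (c : Cmd #tapes) (f : ℕ → Word) (p : Polynomial) : Set where
  field
    run-emit₀ : ∀ {o k n v q l} → Runs c (st o k n v q 0 0 0 l) (st (o ++ f v) k n v q 0 0 0 l) (eval p v)

open Emits₀

Emits₀-≡ : ∀ {c f g p} → (∀ v → f v ≡ g v) → Emits₀ c f p → Emits₀ c g p
Emits₀-≡ e h .run-emit₀ {o} {v = v} = out-≡ (cong (o ++_) (e v)) (run-emit₀ h)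

at-zero : ∀ {c f p} → Emits c f p → Emits₀ c (λ v → f v 0) p
at-zero h .run-emit₀ = run-emit h z≤n

seq₀ : ∀ {c d f g p q} → Emits₀ c f p → Emits₀ d g q → Emits₀ (c ⨟ d) (λ v → f v ++ g v) (p ⊕ q)
seq₀ h k .run-emit₀ {o} = out-≡ (++-assoc o _ _) (seq (run-emit₀ h) (run-emit₀ k))

forV : Cmd #tapes → Cmd #tapes
forV c = (while≢0 #V (decr #V ⨟ incr #S ⨟ incr #R) ⨟ restore #V)
  ⨟ while≢0 #R (decr #R ⨟ c ⨟ incr #I) ⨟ while≢0 #I (decr #I)

forCost : Polynomial → Polynomial
forCost p = (loopCost 3 ⊕ loopCost 2) ⊕ ((const 1 ⊕ (X ⊗ (const 1 ⊕ (const 1 ⊕ (p ⊕ const 1))))) ⊕ loopCost 1)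

for-emits : ∀ {c f p} → Emits c f p → Emits₀ (forV c) (λ v → concatUpTo (f v) v) (forCost p)
for-emits {f = f} h .run-emit₀ {o} {k} {n} {v} {q} {l} =
  seq (seq (countdown #V (λ x j → st o k n x q j 0 j l) (λ _ _ → refl)
             (λ x j _ → seq (decr-runs #V refl) (seq (incr-runs #S) (incr-runs #R))))
           (countdown #S (λ x j → st o k n j q x 0 v l) (λ _ _ → refl)
             (λ x j _ → seq (decr-runs #S refl) (incr-runs #V))))
  (seq (start-≡ (++-identityʳ o)
         (countdown #R (λ x j → st (o ++ concatUpTo (f v) j) k n v q 0 j x l) (λ _ _ → refl)
           (λ x j e → out-≡ (++-assoc o _ _)
             (seq (decr-runs #R refl)
               (seq (run-emit h (≤-trans (m≤n+m j (suc x)) (≤-reflexive e))) (incr-runs #I))))))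
       (countdown #I (λ x j → st (o ++ concatUpTo (f v) v) k n v q 0 x 0 l) (λ _ _ → refl)
           (λ x j _ → decr-runs #I refl)))

module Generator (e : ℕ) (σ : Style A) where
  open Style σ

  emitConj : Template A → Cmd #tapes
  emitConj t = emit andW ⨟ emitTemplate σ t

  conjCost : Template A → Polynomial
  conjCost t = const (1 + length andW) ⊕ templateCost σ t

  emitConj-emits : ∀ t → Emits (emitConj t) (λ v i → codeChain σ [ conj (inst v i t) ]) (conjCost t)
  emitConj-emits t = Emits-≡ (λ v i → sym (++-identityʳ _)) (seq-emits (emit-emits andW) (emitTemplate-emits σ t))

  emitGen : Gen A → Cmd #tapes
  emitGen (block a) = powV (power e (quW a)) ⨟ emit (power (2 * e) (quW a))
  emitGen (test t)  = emitConj t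
  emitGen (tests t) = forV (emitConj t)
  emitGen (g ▸ h)   = emitGen g ⨟ emitGen h

  genCost : Gen A → Polynomial
  genCost (block a) = powCost (power e (quW a)) ⊕ const (1 + length (power (2 * e) (quW a)))
  genCost (test t)  = conjCost t
  genCost (tests t) = forCost (conjCost t)
  genCost (g ▸ h)   = genCost g ⊕ genCost h

  power-+ : ∀ m n (w : List Z) → power (m + n) w ≡ power m w ++ power n w
  power-+ zero    n w = refl
  power-+ (suc m) n w = trans (cong (w ++_) (power-+ m n w)) (sym (++-assoc w _ _))

  power-* : ∀ m n (w : List Z) → power m (power n w) ≡ power (m * n) w
  power-* zero    n w = refl
  power-* (suc m) n w = trans (cong (power n w ++_) (power-* m n w)) (sym (power-+ n (m * n) w))

  emitGen-emits : ∀ g → Emits₀ (emitGen g) (λ v → codeChain σ (chain e g v)) (genCost g)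
  emitGen-emits (block a) = Emits₀-≡ eq (seq₀ (at-zero (powV-emits _)) (at-zero (emit-emits _)))
    where
    eq : ∀ v → power v (power e (quW a)) ++ power (2 * e) (quW a) ≡ codeChain σ (chain e (block a) v)
    eq v = trans (cong (_++ power (2 * e) (quW a)) (trans (power-* v e (quW a)) (cong (λ m → power m (quW a)) (*-comm v e))))
      (trans (sym (power-+ (e * v) (2 * e) (quW a))) (sym (codeChain-replicate σ (blockSize e v) (bound a))))
  emitGen-emits (test t)  = at-zero (emitConj-emits t)
  emitGen-emits (tests t) = Emits₀-≡ (λ v → sym (codeChain-concatUpTo σ _ v)) (for-emits (emitConj-emits t))
  emitGen-emits (g ▸ h)   = Emits₀-≡ (λ v → sym (codeChain-++ σ (chain e g v) (chain e h v)))
                              (seq₀ (emitGen-emits g) (emitGen-emits h))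

infix 30 _⟪_⟫

_⟪_⟫ : Polynomial → Polynomial → Polynomial
X       ⟪ q ⟫ = q
const c ⟪ q ⟫ = const c
(p ⊕ r) ⟪ q ⟫ = p ⟪ q ⟫ ⊕ r ⟪ q ⟫
(p ⊗ r) ⟪ q ⟫ = p ⟪ q ⟫ ⊗ r ⟪ q ⟫

eval-⟪⟫ : ∀ p q n → eval (p ⟪ q ⟫) n ≡ eval p (eval q n)
eval-⟪⟫ X       q n = refl
eval-⟪⟫ (const c) q n = refl
eval-⟪⟫ (p ⊕ r) q n = cong₂ _+_ (eval-⟪⟫ p q n) (eval-⟪⟫ r q n)
eval-⟪⟫ (p ⊗ r) q n = cong₂ _*_ (eval-⟪⟫ p q n) (eval-⟪⟫ r q n)

swap : ∀ a b c → a + (b + c) ≡ b + a + c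
swap a b c = trans (sym (+-assoc a b c)) (cong (_+ c) (+-comm a b))

-- Growth of tapes, loading of the input and rewinding of the output

move-growthˡ : ∀ {A} d (t : Tape A) → length (before (move d t)) ≤ suc (length (before t))
move-growthˡ left  (tape []      h r)       = z≤n
move-growthˡ left  (tape (x ∷ l) h r)       = m≤n+m _ 2
move-growthˡ stay  t                        = n≤1+n _
move-growthˡ right (tape l       h [])      = ≤-refl
move-growthˡ right (tape l       h (x ∷ r)) = ≤-refl

move-growthʳ : ∀ {A} d (t : Tape A) → length (after (move d t)) ≤ suc (length (after t))
move-growthʳ left  (tape []      h r)       = ≤-refl
move-growthʳ left  (tape (x ∷ l) h r)       = ≤-refl
move-growthʳ stay  t                        = n≤1+n _
move-growthʳ right (tape l       h [])      = z≤n
move-growthʳ right (tape l       h (x ∷ r)) = m≤n+m _ 2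

act-growth : ∀ {k} (as : Vec (Sym × Direction) k) T x →
             length (before (lookup (zipWith act as T) x)) ≤ suc (length (before (lookup T x)))
act-growth ((s , d) ∷ as) (tape l h r ∷ T) zero    = move-growthˡ d (tape l s r)
act-growth (a ∷ as)       (t ∷ T)          (suc x) = act-growth as T x

-- This bounds the length of the output by the time spent on it, and so the time of the final
-- rewind.
growth : ∀ {K} {c : Cmd K} {T t U} → c ⊢ T ⇓[ t ] U → ∀ x → length (before (lookup U x)) ≤ t + length (before (lookup T x))
growth {T = T} (prim⇓ {f}) x = act-growth (f (mapⱽ head T)) T x
growth {T = T} (seq⇓ {s = s} {t = t} y z) x = ≤-trans (growth z x)
    (≤-trans (+-monoʳ-≤ t (growth y x)) (≤-reflexive (swap t s _)))
growth (stop⇓ e) x = n≤1+n _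
growth (go⇓ {s = s} {t = t} e y z) x = m≤n⇒m≤1+n (≤-trans (growth z x)
    (≤-trans (+-monoʳ-≤ t (growth y x)) (≤-reflexive (swap t s _))))
growth (then⇓ e y) x = m≤n⇒m≤1+n (growth y x)
growth (else⇓ e y) x = m≤n⇒m≤1+n (growth y x)

onBit : Vec Sym #tapes → Bool
onBit σ = isBit (lookup σ 0F)

-- `setup` marks cell 0 of all counters. `transfer` erases one input bit while pushing it on the
-- stack and incrementing `#N`. Afterwards the last bit of the input is on top, and the first tape
-- is free for the output.
setup transfer load : Cmd #tapes
setup = prim λ where
  (a ∷ b ∷ σ) → (a , stay) ∷ (b , stay) ∷ mapⱽ (λ _ → bit true , stay) σ
transfer = prim λ where
  (a ∷ _ ∷ c ∷ σ) → (blank , right) ∷ (a , right) ∷ (c , right) ∷ mapⱽ (_, stay) σ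
load = while onBit transfer ⨟ only 1F (_, left)

remaining : ℕ → Word → Tape ⊥
remaining j []      = tape (blanks j) blank []
remaining j (b ∷ u) = tape (blanks j) (bit b) (mapᴸ bit u)

data Loading (n : ℕ) (u v : Word) : Vec (Tape ⊥) #tapes → Set where
  loading : ∀ {T} j → Pointwise IsCounter (n ∷ 0 ∷ 0 ∷ 0 ∷ 0 ∷ 0 ∷ 0 ∷ []) T →
            Loading n u v (remaining j u ∷ tape (mapᴸ bit v) blank [] ∷ T)

setup-runs : ∀ w → Hoare setup (_≡ (fromWord w ∷ replicateⱽ 8 (fromWord []))) (Loading 0 w []) 1
setup-runs []      = prim-runs λ where
  refl → loading 0 ((0 , refl) ∷ (0 , refl) ∷ (0 , refl) ∷ (0 , refl) ∷ (0 , refl) ∷ (0 , refl) ∷ (0 , refl) ∷ [])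
setup-runs (b ∷ w) = prim-runs λ where
  refl → loading 0 ((0 , refl) ∷ (0 , refl) ∷ (0 , refl) ∷ (0 , refl) ∷ (0 , refl) ∷ (0 , refl) ∷ (0 , refl) ∷ [])

transfer-runs : ∀ {n b u v} → Hoare transfer (Loading n (b ∷ u) v) (Loading (suc n) u (b ∷ v)) 1
transfer-runs {u = []}    = prim-runs λ where
  (loading j (c ∷ cs)) → loading (suc j) (counter-incr c ∷ subst (Pointwise IsCounter _) (sym (idle-act _)) cs)
transfer-runs {u = _ ∷ _} = prim-runs λ where
  (loading j (c ∷ cs)) → loading (suc j) (counter-incr c ∷ subst (Pointwise IsCounter _) (sym (idle-act _)) cs)

load-runs : ∀ w → Hoare load (Loading 0 w []) (_∼ st [] (reverse w) (length w) 0 0 0 0 0 0) ((1 + length w * 2) + 1)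
load-runs w = seq (loop w [] 0) (only-runs 1F _ unload)
  where
  loop : ∀ u v n → Hoare (while onBit transfer)
                         (Loading n u v) (Loading (length u + n) [] (u ʳ++ v)) (1 + length u * 2)
  loop []      v n = while-stop λ where (loading _ _) → refl
  loop (b ∷ u) v n =
    subst (λ m → Hoare (while onBit transfer)
                       (Loading n (b ∷ u) v) (Loading m [] ((b ∷ u) ʳ++ v)) (1 + length (b ∷ u) * 2))
      (+-suc (length u) n)
      (while-go (λ where (loading _ _) → refl) transfer-runs (loop u (b ∷ v) (suc n)))

  unload : ∀ {T} → Loading (length w + 0) [] (w ʳ++ []) T →
           updateAt T 1F (λ t → act (head t , left) t) ∼ st [] (reverse w) (length w) 0 0 0 0 0 0
  unload (loading j cs) with reverse w | length w + 0 | +-identityʳ (length w)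
  ... | []    | _ | refl = rep (j , refl) (_ , refl) cs
  ... | _ ∷ _ | _ | refl = rep (j , refl) (_ , refl) cs

-- The output consists of bits with a blank on either side, so walking left over bits finds its
-- beginning, and `toWord` then reads exactly the output.
back rewind : Cmd #tapes
back = while onBit (only 0F (_, left))
rewind = only 0F (_, left) ⨟ back ⨟ only 0F (_, right)

toWord-blank : ∀ w l → toWord (move {⊥} right (tape l blank (mapᴸ bit w ++ [ blank ]))) ≡ w
toWord-blank []      l = refl
toWord-blank (b ∷ w) l = cong (b ∷_) (go w)
  where
  go : ∀ w → leadingBits {⊥} (mapᴸ bit w ++ [ blank ]) ≡ w
  go []      = refl
  go (b ∷ w) = cong (b ∷_) (go w)

data Rewinding (v : Word) : Word → Vec (Tape ⊥) #tapes → Set where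
  at-end : ∀ {T} l → Rewinding v [] (tape l blank (mapᴸ bit v ++ [ blank ]) ∷ T)
  at-bit : ∀ {T b u} j → Rewinding v (b ∷ u) (tape (mapᴸ bit u ++ blanks j) (bit b) (mapᴸ bit v ++ [ blank ]) ∷ T)

rewind-runs : ∀ {w k cs} → Hoare rewind (_∼ store w k cs) (λ T → toWord (lookup T 0F) ≡ w) (1 + ((1 + length w * 2) + 1))
rewind-runs {w} =
  seq (only-runs {Q = Rewinding [] (reverse w)} 0F _ λ where (rep (j , refl) _ _) → first (reverse w) j)
  (seq (subst (λ n → Hoare back (Rewinding [] (reverse w)) (Rewinding (reverse w ʳ++ []) []) (1 + n * 2))
         (length-reverse w) (loop (reverse w) []))
       (only-runs {P = Rewinding (reverse w ʳ++ []) []} 0F _ finish))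
  where
  first : ∀ {T} u j → Rewinding [] u (move left (tape (mapᴸ bit u ++ blanks j) blank []) ∷ T)
  first []      zero    = at-end _
  first []      (suc j) = at-end _
  first (b ∷ u) j       = at-bit j

  next-left : ∀ {T v b} u j →
              Rewinding (b ∷ v) u (move left (tape (mapᴸ bit u ++ blanks j) (bit b) (mapᴸ bit v ++ [ blank ])) ∷ T)
  next-left []      zero    = at-end _
  next-left []      (suc j) = at-end _
  next-left (b ∷ u) j       = at-bit j

  loop : ∀ u v → Hoare back (Rewinding v u) (Rewinding (u ʳ++ v) []) (1 + length u * 2)
  loop []      v = while-stop λ where (at-end _) → refl
  loop (b ∷ u) v = while-go (λ where (at-bit _) → refl)
    (only-runs 0F _ λ where (at-bit j) → next-left u j) (loop u (b ∷ v))

  finish : ∀ {T} → Rewinding (reverse w ʳ++ []) [] T → toWord (lookup (updateAt T 0F (λ t → act (head t , right) t)) 0F) ≡ w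
  finish (at-end {T} l) = trans (toWord-blank (reverse w ʳ++ []) l) (reverse-involutive w)

-- From programs to polynomial-time reductions

computes : ∀ {k f} (c : Cmd (1 + k)) p →
           (∀ w → ∃₂ λ T t → c ⊢ fromWord w ∷ replicateⱽ k (fromWord []) ⇓[ t ] T ×
             toWord (lookup T 0F) ≡ f w × t ≤ eval p (length w)) →
           PolyTimeComputable f
computes {f = f} c p h = machine c , p , λ w → correct w (h w)
  where
  M = machine c

  correct : ∀ w → (∃₂ λ T t → c ⊢ fromWord w ∷ replicateⱽ _ (fromWord []) ⇓[ t ] T ×
              toWord (lookup T 0F) ≡ f w × t ≤ eval p (length w)) →
            let d = run M (eval p (length w)) (initial M (w ∷ [])) in Halted M d × output M d ≡ f w
  correct w (T ∷ Ts , t , x , e , t≤) =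
    -- The polynomial may exceed the actual time; the halted configuration is repeated until then.
    subst (λ d → Halted M d × output M d ≡ f w) (sym (trans (run-halted-≤ M t≤ (cong (next M) done)) done)) (refl , e)
    where
    done : run M t (initial M (w ∷ [])) ≡ config (inj₁ tt) (T ∷ Ts)
    done = run-machine c (⇓⇒Steps x)

-- One shape for both reductions. The coefficients give `v` and the bound on the guess. `inputEnd`
-- is placed at the length of the input, `guessEnd` at the bound on the guess, `input b` at each
-- input bit, and `layer` is repeated once per bit of a block.
record Spec (A : Set) : Set where
  field
    columnBits         : ℕ
    coeffsV coeffsQ    : List ℕ
    pre mid layer post : Gen A
    inputEnd guessEnd  : Template A
    input              : Bool → Template A
    matrix             : Template A

module _ (s : Spec A) where
  open Spec s

  -- The argument is the reversed input, as it lies on the stack: the `length k` bits below the top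
  -- precede it in the input, which gives its position.
  inputs : ℕ → Word → Chain A
  inputs v []      = []
  inputs v (b ∷ k) = conj (inst v (length k) (input b)) ∷ inputs v k

  boundV boundQ : ℕ → ℕ
  boundV = eval (polynomial coeffsV)
  boundQ = eval (polynomial coeffsQ)

  wholeChain : (v q : ℕ) → Word → Chain A
  wholeChain v q w =
    chain columnBits pre v ++
    [ conj (inst v (length w) inputEnd) ] ++
    inputs v (reverse w) ++
    [ conj (inst v q guessEnd) ] ++
    chain columnBits mid v ++
    power (blockSize columnBits v) (chain columnBits layer v) ++
    chain columnBits post v

  whole : (v q : ℕ) → Word → QBF A ℕ
  whole v q w = apply (wholeChain v q w) (inst v 0 matrix)

  formula : Word → QBF A ℕ
  formula w = whole (boundV (length w)) (boundQ (length w)) w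

module Compiler (s : Spec A) (σ : Style A) where
  open Spec s
  open Style σ
  open Generator columnBits σ

  private
    e : ℕ
    e = columnBits

    itemCost : Polynomial
    itemCost = conjCost (input true) ⊕ conjCost (input false)

  -- `emitAtN` leaves `#I` at the input length, from where `emitInputs` counts down to zero as it
  -- pops; `emitAtQ` clears `#I` itself.
  emitAtN emitAtQ : Template A → Cmd #tapes
  emitAtN t = while≢0 #N (decr #N ⨟ incr #S ⨟ incr #I) ⨟ restore #N ⨟ emitConj t
  emitAtQ t = while≢0 #Q (decr #Q ⨟ incr #S ⨟ incr #I) ⨟ restore #Q ⨟ emitConj t ⨟ while≢0 #I (decr #I)

  emitAtN-runs : ∀ {o k n v q l} t → n ≤ v →
                 Runs (emitAtN t) (st o k n v q 0 0 0 l) (st (o ++ codeChain σ [ conj (inst v n t) ]) k n v q 0 n 0 l)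
                      (eval (loopCost 3 ⊕ (loopCost 2 ⊕ conjCost t)) v)
  emitAtN-runs {o} {k} {n} {v} {q} {l} t n≤v =
    weaken (+-mono-≤ (s≤s (*-monoˡ-≤ 4 n≤v)) (+-monoˡ-≤ (eval (conjCost t) v) (s≤s (*-monoˡ-≤ 3 n≤v))))
    (seq (countdown #N (λ x j → st o k x v q j j 0 l) (λ _ _ → refl)
           (λ x j _ → seq (decr-runs #N refl) (seq (incr-runs #S) (incr-runs #I))))
    (seq (countdown #S (λ x j → st o k j v q x n 0 l) (λ _ _ → refl)
           (λ x j _ → seq (decr-runs #S refl) (incr-runs #N)))
         (run-emit (emitConj-emits t) n≤v)))

  emitAtQ-runs : ∀ {o k n v q l} t → q ≤ v →
                 Runs (emitAtQ t) (st o k n v q 0 0 0 l) (st (o ++ codeChain σ [ conj (inst v q t) ]) k n v q 0 0 0 l)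
                      (eval (loopCost 3 ⊕ (loopCost 2 ⊕ (conjCost t ⊕ loopCost 1))) v)
  emitAtQ-runs {o} {k} {n} {v} {q} {l} t q≤v =
    weaken (+-mono-≤ (s≤s (*-monoˡ-≤ 4 q≤v)) (+-mono-≤ (s≤s (*-monoˡ-≤ 3 q≤v))
             (+-monoʳ-≤ (eval (conjCost t) v) (s≤s (*-monoˡ-≤ 2 q≤v)))))
    (seq (countdown #Q (λ x j → st o k n v x j j 0 l) (λ _ _ → refl)
           (λ x j _ → seq (decr-runs #Q refl) (seq (incr-runs #S) (incr-runs #I))))
    (seq (countdown #S (λ x j → st o k n v j x q 0 l) (λ _ _ → refl)
           (λ x j _ → seq (decr-runs #S refl) (incr-runs #Q)))
    (seq (run-emit (emitConj-emits t) q≤v)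
         (countdown #I (λ x j → st (o ++ codeChain σ [ conj (inst v q t) ]) k n v q 0 x 0 l) (λ _ _ → refl) (λ x j _ → decr-runs #I refl)))))

  pop : Cmd #tapes
  pop = only 1F (_, left)

  pop-runs : ∀ {o b k cs} → Runs pop (store o (b ∷ k) cs) (store o k cs) 1
  pop-runs {k = []}    = only-runs 1F _ λ where (rep o (_ , refl) cs) → rep o (_ , refl) cs
  pop-runs {k = _ ∷ _} = only-runs 1F _ λ where (rep o (_ , refl) cs) → rep o (_ , refl) cs

  isTrue : Sym → Bool
  isTrue (bit b) = b
  isTrue blank   = false

  onInput : Bool → Cmd #tapes
  onInput b = pop ⨟ decr #I ⨟ emitConj (input b)

  emitInputs : Cmd #tapes
  emitInputs = while (λ τ → isBit (lookup τ 1F)) (cond (λ τ → isTrue (lookup τ 1F)) (onInput true) (onInput false))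

  onInput-runs : ∀ {o k n v q l} b → length k ≤ v →
                 Runs (onInput b) (st o (b ∷ k) n v q 0 (suc (length k)) 0 l)
                   (st (o ++ codeChain σ [ conj (inst v (length k) (input b)) ]) k n v q 0 (length k) 0 l)
                   (2 + eval (conjCost (input b)) v)
  onInput-runs b k≤v = seq pop-runs (seq (decr-runs #I refl) (run-emit (emitConj-emits (input b)) k≤v))

  top-bit : ∀ {o b k cs T} → T ∼ store o (b ∷ k) cs → lookup (mapⱽ head T) 1F ≡ bit b
  top-bit (rep _ (_ , refl) _) = refl

  emitInputs-runs : ∀ {o n v q l} k → length k ≤ v →
                    Runs emitInputs (st o k n v q 0 (length k) 0 l)
                      (st (o ++ codeChain σ (inputs s v k)) [] n v q 0 0 0 l)
                      (1 + length k * (4 + eval itemCost v))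
  emitInputs-runs {o} [] _ = out-≡ (sym (++-identityʳ o)) (while-stop λ where (rep _ (_ , refl) _) → refl)
  emitInputs-runs {o} {n} {v} {q} {l} (b ∷ k) k<v =
    weaken (s≤s (≤-reflexive (+-suc (3 + eval itemCost v) (length k * (4 + eval itemCost v)))))
    (out-≡ (trans (++-assoc o _ _)
             (cong (λ u → o ++ u ++ codeChain σ (inputs s v k)) (++-identityʳ (codeItem σ (conj (inst v (length k) (input b)))))))
    (while-go (λ p → cong isBit (top-bit p)) (branch b) (emitInputs-runs k k≤v)))
    where
    k≤v : length k ≤ v
    k≤v = ≤-trans (n≤1+n _) k<v

    branch : ∀ b → Runs (cond (λ τ → isTrue (lookup τ 1F)) (onInput true) (onInput false))
                        (st o (b ∷ k) n v q 0 (suc (length k)) 0 l)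
                        (st (o ++ codeChain σ [ conj (inst v (length k) (input b)) ]) k n v q 0 (length k) 0 l)
                        (3 + eval itemCost v)
    branch true  = weaken (+-monoʳ-≤ 3 (m≤m+n (eval (conjCost (input true)) v) (eval (conjCost (input false)) v)))
      (then-go (λ p → cong isTrue (top-bit p)) (onInput-runs true k≤v))
    branch false = weaken (+-monoʳ-≤ 3 (m≤n+m (eval (conjCost (input false)) v) (eval (conjCost (input true)) v)))
      (else-go (λ p → cong isTrue (top-bit p)) (onInput-runs false k≤v))

  emitLayers : Cmd #tapes
  emitLayers = while≢0 #V (decr #V ⨟ incr #S ⨟ incrs #L e) ⨟ restore #V ⨟ incrs #L (2 * e)
    ⨟ while≢0 #L (decr #L ⨟ emitGen layer)

  layersCost : Polynomial
  layersCost = loopCost (3 + e) ⊕ (loopCost 2 ⊕ (const (1 + 2 * e) ⊕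
    (const 1 ⊕ (((const e ⊗ X) ⊕ const (2 * e)) ⊗ (const 2 ⊕ genCost layer)))))

  emitLayers-runs : ∀ {o k n v q} →
                    Runs emitLayers (st o k n v q 0 0 0 0)
                      (st (o ++ power (blockSize e v) (codeChain σ (chain e layer v))) k n v q 0 0 0 0)
                      (eval layersCost v)
  emitLayers-runs {o} {k} {n} {v} {q} =
    seq (countdown #V (λ x j → st o k n x q j 0 0 (j * e)) (λ _ _ → refl)
          (λ x j _ → seq (decr-runs #V refl) (seq (incr-runs #S) (incrs-runs #L e))))
    (seq (countdown #S (λ x j → st o k n j q x 0 0 (v * e)) (λ _ _ → refl)
          (λ x j _ → seq (decr-runs #S refl) (incr-runs #V)))
    (seq (counters-≡ (cong (λ l → n ∷ v ∷ q ∷ 0 ∷ 0 ∷ 0 ∷ l ∷ []) (count e v)) (incrs-runs #L (2 * e)))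
    (start-≡ (++-identityʳ o)
      (countdown #L (λ x j → st (o ++ power j (codeChain σ (chain e layer v))) k n v q 0 0 0 x) (λ _ _ → refl)
        (λ x j _ → out-≡ (++-snoc-power o j _) (seq (decr-runs #L refl) (run-emit₀ (emitGen-emits layer))))))))
    where
    count : ∀ e v → 2 * e + v * e ≡ e * v + 2 * e
    count = solve-∀

  emitWhole : Cmd #tapes
  emitWhole = emitGen pre ⨟ emitAtN inputEnd ⨟ emitInputs ⨟ emitAtQ guessEnd ⨟ emitGen mid ⨟ emitLayers ⨟ emitGen post
              ⨟ emitTemplate σ matrix

  emitCost : Polynomial
  emitCost = genCost pre ⊕ ((loopCost 3 ⊕ (loopCost 2 ⊕ conjCost inputEnd)) ⊕
    ((const 1 ⊕ (X ⊗ (const 4 ⊕ itemCost))) ⊕ ((loopCost 3 ⊕ (loopCost 2 ⊕ (conjCost guessEnd ⊕ loopCost 1))) ⊕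
    (genCost mid ⊕ (layersCost ⊕ (genCost post ⊕ templateCost σ matrix))))))

  Appends : Cmd #tapes → Word → Vec ℕ 7 → Word → Word → Vec ℕ 7 → ℕ → Set
  Appends c k cs w k′ cs′ b = ∀ o → Runs c (store o k cs) (store (o ++ w) k′ cs′) b

  seq-appends : ∀ {c d k k′ k″ cs cs′ cs″ u w a b} → Appends c k cs u k′ cs′ a → Appends d k′ cs′ w k″ cs″ b →
                Appends (c ⨟ d) k cs (u ++ w) k″ cs″ (a + b)
  seq-appends f g o = out-≡ (++-assoc o _ _) (seq (f o) (g _))

  emitWhole-runs : ∀ {v q} w → length w ≤ v → q ≤ v →
                   Runs emitWhole (st [] (reverse w) (length w) v q 0 0 0 0)
                     (st (code σ (whole s v q w)) [] (length w) v q 0 0 0 0) (eval emitCost v)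
  emitWhole-runs {v} {q} w n≤v q≤v =
    out-≡ eq
    (seq-appends (λ _ → run-emit₀ (emitGen-emits pre))
    (seq-appends (λ _ → emitAtN-runs inputEnd n≤v)
    (seq-appends {w = w₂} (λ _ → onInputs)
    (seq-appends (λ _ → emitAtQ-runs guessEnd q≤v)
    (seq-appends (λ _ → run-emit₀ (emitGen-emits mid))
    (seq-appends (λ _ → emitLayers-runs)
    (seq-appends (λ _ → run-emit₀ (emitGen-emits post))
                 (λ _ → run-emit₀ (at-zero (emitTemplate-emits σ matrix))))))))) [])
    where
    w₄ w₃ w₂ : Word
    w₄ = power (blockSize e v) (codeChain σ (chain e layer v)) ++ codeChain σ (chain e post v) ++ code σ (inst v 0 matrix)
    w₃ = codeChain σ (chain e mid v) ++ w₄
    w₂ = codeChain σ [ conj (inst v q guessEnd) ] ++ w₃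

    rw≤v : length (reverse w) ≤ v
    rw≤v = subst (_≤ v) (sym (length-reverse w)) n≤v

    onInputs : ∀ {o} → Runs emitInputs (st o (reverse w) (length w) v q 0 (length w) 0 0)
                 (st (o ++ codeChain σ (inputs s v (reverse w))) [] (length w) v q 0 0 0 0) (1 + v * (4 + eval itemCost v))
    onInputs {o} = weaken (s≤s (*-monoˡ-≤ (4 + eval itemCost v) rw≤v))
      (subst (λ m → Runs emitInputs (st o (reverse w) (length w) v q 0 m 0 0)
                      (st (o ++ codeChain σ (inputs s v (reverse w))) [] (length w) v q 0 0 0 0)
                      (1 + length (reverse w) * (4 + eval itemCost v)))
         (length-reverse w) (emitInputs-runs (reverse w) rw≤v))

    -- Wrapping the equation lets Agda infer the rest of the chain, which it cannot recover from the
    -- value of `codeChain`.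
    record Spells (xs : Chain A) (r : Word) : Set where
      constructor spells
      pattern
      field
        spelling : codeChain σ xs ++ code σ (inst v 0 matrix) ≡ r

    open Spells

    split : ∀ xs {ys r} → Spells ys r → Spells (xs ++ ys) (codeChain σ xs ++ r)
    split xs {ys} (spells refl) = spells (trans (cong (_++ code σ (inst v 0 matrix)) (codeChain-++ σ xs ys))
      (++-assoc (codeChain σ xs) (codeChain σ ys) (code σ (inst v 0 matrix))))

    eq : codeChain σ (chain e pre v) ++ codeChain σ [ conj (inst v (length w) inputEnd) ] ++
         codeChain σ (inputs s v (reverse w)) ++ w₂ ≡ code σ (whole s v q w)
    eq = sym (trans (code-apply σ (wholeChain s v q w) (inst v 0 matrix)) (spelling
      (split (chain e pre v)
      (split [ conj (inst v (length w) inputEnd) ]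
      (split (inputs s v (reverse w))
      (split [ conj (inst v q guessEnd) ]
      (split (chain e mid v)
      (spells (trans (spelling (split (power (blockSize e v) (chain e layer v)) (spells refl)))
        (cong (_++ codeChain σ (chain e post v) ++ code σ (inst v 0 matrix))
          (codeChain-power σ (blockSize e v) (chain e layer v))))))))))))

  computeBounds : Cmd #tapes
  computeBounds = horner coeffsQ ⨟ while≢0 #V (decr #V ⨟ incr #Q) ⨟ horner coeffsV

  boundsCost : Polynomial
  boundsCost = hornerCost coeffsQ ⊕ ((const 1 ⊕ (polynomial coeffsQ ⊗ const 3)) ⊕ hornerCost coeffsV)

  computeBounds-runs : ∀ {k n} → Runs computeBounds (st [] k n 0 0 0 0 0 0)
                       (st [] k n (boundV s n) (boundQ s n) 0 0 0 0) (eval boundsCost n)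
  computeBounds-runs {k} {n} =
    seq (horner-runs coeffsQ)
    (seq (countdown #V (λ x j → st [] k n x j 0 0 0 0) (λ _ _ → refl) (λ x j _ → seq (decr-runs #V refl) (incr-runs #Q)))
         (horner-runs coeffsV))

  generate program : Cmd #tapes
  generate = setup ⨟ load ⨟ computeBounds ⨟ emitWhole
  program  = generate ⨟ rewind

  -- Emission costs are polynomials in `v`, hence the substitution of the bound for `v`. The second
  -- occurrence of `generateCost` pays for the rewind, the output being no longer than the time that
  -- produced it.
  generateCost programCost : Polynomial
  generateCost = const 1 ⊕ (((const 1 ⊕ (X ⊗ const 2)) ⊕ const 1) ⊕ (boundsCost ⊕ emitCost ⟪ polynomial coeffsV ⟫))
  programCost  = generateCost ⊕ (const 1 ⊕ ((const 1 ⊕ (generateCost ⊗ const 2)) ⊕ const 1))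

  module _ (n≤V : ∀ n → n ≤ boundV s n) (Q≤V : ∀ n → boundQ s n ≤ boundV s n) where

    generate-runs : ∀ w → Hoare generate (_≡ (fromWord w ∷ replicateⱽ 8 (fromWord [])))
                      (_∼ st (code σ (formula s w)) [] (length w) _ _ 0 0 0 0) (eval generateCost (length w))
    generate-runs w =
      weaken (≤-reflexive (cong (λ z → 1 + (((1 + n * 2) + 1) + (eval boundsCost n + z)))
                            (sym (eval-⟪⟫ emitCost (polynomial coeffsV) n))))
      (seq (setup-runs w) (seq (load-runs w) (seq computeBounds-runs (emitWhole-runs w (n≤V _) (Q≤V _)))))
      where
      n = length w

    program-runs : ∀ w → ∃₂ λ T t → program ⊢ fromWord w ∷ replicateⱽ 8 (fromWord []) ⇓[ t ] T ×
                   toWord (lookup T 0F) ≡ code σ (formula s w) × t ≤ eval programCost (length w)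
    program-runs w with T , t , x , r , t≤ ← exec (generate-runs w) refl
                   with U , t′ , y , z , t′≤ ← exec rewind-runs r =
      U , t + t′ , seq⇓ x y , z ,
      +-mono-≤ t≤ (≤-trans t′≤ (+-monoʳ-≤ 1 (+-monoˡ-≤ 1 (+-monoʳ-≤ 1 (*-monoˡ-≤ 2 (≤-trans (output-length x r) t≤))))))
      where
      output-length : ∀ {T t o k cs} → generate ⊢ fromWord w ∷ replicateⱽ 8 (fromWord []) ⇓[ t ] T → T ∼ store o k cs →
                      length o ≤ t
      output-length {t = t} {o} x (rep (j , refl) _ _) = begin
        length o                                   ≡⟨ sym (length-reverse o) ⟩
        length (reverse o)                         ≡⟨ sym (length-map bit (reverse o)) ⟩
        length (mapᴸ bit (reverse o))              ≤⟨ m≤m+n _ (length (blanks j)) ⟩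
        length (mapᴸ bit (reverse o)) + length (blanks j) ≡⟨ sym (length-++ (mapᴸ bit (reverse o))) ⟩
        length (mapᴸ bit (reverse o) ++ blanks j)  ≤⟨ growth x 0F ⟩
        t + length (before (fromWord {⊥} w))       ≡⟨ cong (t +_) (nothing-before w) ⟩
        t + 0                                      ≡⟨ +-identityʳ t ⟩
        t                                          ∎
        where
        open ≤-Reasoning

        nothing-before : ∀ w → length (before (fromWord {⊥} w)) ≡ 0
        nothing-before []      = refl
        nothing-before (_ ∷ _) = refl

    computable : PolyTimeComputable (code σ ∘ formula s)
    computable = computes program programCost program-runs

-- Gadgets and the translation into positive equality-free formulas

_!?_ : List Z → ℕ → Maybe Z
[]       !? _     = nothing
(z ∷ zs) !? zero  = just z
(z ∷ zs) !? suc n = zs !? n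

at : List Bool → ℕ → Bool
at ρ x = fromMaybe false (ρ !? x)

agrees : Bool → Bool → Bool
agrees true  b = b
agrees false b = not b

choose : Quantifier → Bool → Bool → Bool
choose all = _∧ᵇ_
choose ex  = _∨ᵇ_

flip : Quantifier → Quantifier
flip all = ex
flip ex  = all

module _ (kind : A → Quantifier) where

  truth : QBF A ℕ → List Bool → Bool
  truth (lit a b x)  ρ = agrees b (at ρ x)
  truth (φ and ψ)    ρ = truth φ ρ ∧ᵇ truth ψ ρ
  truth (φ or ψ)     ρ = truth φ ρ ∨ᵇ truth ψ ρ
  truth (bind a φ)   ρ = choose (kind a) (truth φ (true ∷ ρ)) (truth φ (false ∷ ρ))

-- Besides the range of an index, this demands that the tag at a literal agree with the tag at its
-- binder.
Scoped : List A → QBF A ℕ → Set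
Scoped Γ (lit a b x) = Γ !? x ≡ just a
Scoped Γ (φ and ψ)   = Scoped Γ φ × Scoped Γ ψ
Scoped Γ (φ or ψ)    = Scoped Γ φ × Scoped Γ ψ
Scoped Γ (bind a φ)  = Scoped (a ∷ Γ) φ

-- Binders keep their tags; the exchange of quantifiers happens in the passage from `kind` to
-- `flip ∘ kind`.
dual : QBF A ℕ → QBF A ℕ
dual (lit a b x) = lit a (not b) x
dual (φ and ψ)   = dual φ or dual ψ
dual (φ or ψ)    = dual φ and dual ψ
dual (bind a φ)  = bind a (dual φ)

-- Exchanging the words of the connectives and of the literals emits the dual formula from the same
-- specification, so duality takes no further program.
dualStyle : Style A → Style A
dualStyle σ = record
  { width = Style.width σ
  ; andW = Style.orW σ
  ; orW = Style.andW σ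
  ; quW = Style.quW σ
  ; litW = λ a b → Style.litW σ a (not b)
  }

code-dual : ∀ (σ : Style A) φ → code σ (dual φ) ≡ code (dualStyle σ) φ
code-dual σ (lit a b x) = refl
code-dual σ (φ and ψ)   = cong₂ (λ u v → Style.orW σ ++ u ++ v) (code-dual σ φ) (code-dual σ ψ)
code-dual σ (φ or ψ)    = cong₂ (λ u v → Style.andW σ ++ u ++ v) (code-dual σ φ) (code-dual σ ψ)
code-dual σ (bind a φ)  = cong (Style.quW σ a ++_) (code-dual σ φ)

Scoped-dual : ∀ {Γ : List A} φ → Scoped Γ φ → Scoped Γ (dual φ)
Scoped-dual (lit a b x) s       = s
Scoped-dual (φ and ψ)   (s , t) = Scoped-dual φ s , Scoped-dual ψ t
Scoped-dual (φ or ψ)    (s , t) = Scoped-dual φ s , Scoped-dual ψ t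
Scoped-dual (bind a φ)  s       = Scoped-dual φ s

not-∧ : ∀ a b → not (a ∧ᵇ b) ≡ not a ∨ᵇ not b
not-∧ true  b = refl
not-∧ false b = refl

not-∨ : ∀ a b → not (a ∨ᵇ b) ≡ not a ∧ᵇ not b
not-∨ true  b = refl
not-∨ false b = refl

truth-dual : ∀ (kind : A → Quantifier) φ ρ → truth (flip ∘ kind) (dual φ) ρ ≡ not (truth kind φ ρ)
truth-dual kind (lit a true  x) ρ = refl
truth-dual kind (lit a false x) ρ = sym (Bool.not-involutive (at ρ x))
truth-dual kind (φ and ψ) ρ rewrite truth-dual kind φ ρ | truth-dual kind ψ ρ = sym (not-∧ (truth kind φ ρ) _)
truth-dual kind (φ or ψ)  ρ rewrite truth-dual kind φ ρ | truth-dual kind ψ ρ = sym (not-∨ (truth kind φ ρ) _)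
truth-dual kind (bind a φ) ρ rewrite truth-dual kind φ (true ∷ ρ) | truth-dual kind φ (false ∷ ρ) with kind a
... | all = sym (not-∧ (truth kind φ (true ∷ ρ)) _)
... | ex  = sym (not-∨ (truth kind φ (true ∷ ρ)) _)

-- Renaming of formulas, and codes of literals

module _ {σ : Signature} where

  extend : ∀ {m n} → (Fin m → Fin n) → Fin (suc m) → Fin (suc n)
  extend ρ zero    = zero
  extend ρ (suc x) = suc (ρ x)

  extends : ∀ {m n} d → (Fin m → Fin n) → Fin (d + m) → Fin (d + n)
  extends zero    ρ = ρ
  extends (suc d) ρ = extend (extends d ρ)

  rename : ∀ {m n} → (Fin m → Fin n) → Formula σ m → Formula σ n
  rename ρ (rel R xs)  = rel R (mapⱽ ρ xs)
  rename ρ (φ ∧ ψ)     = rename ρ φ ∧ rename ρ ψ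
  rename ρ (φ ∨ ψ)     = rename ρ φ ∨ rename ρ ψ
  rename ρ (quant q φ) = quant q (rename (extend ρ) φ)

  quantifyOver : ∀ {k n} → Vec Quantifier k → Formula σ (k + n) → Formula σ n
  quantifyOver []       φ = φ
  quantifyOver (q ∷ qs) φ = quantifyOver qs (quant q φ)

  quantW : Quantifier → Word
  quantW all = true ∷ false ∷ false ∷ []
  quantW ex  = true ∷ false ∷ true ∷ []

  prefixW : ∀ {k} → Vec Quantifier k → Word
  prefixW []       = []
  prefixW (q ∷ qs) = prefixW qs ++ quantW q

  encode-quant : ∀ {n} q (φ : Formula σ (suc n)) → encode (quant q φ) ≡ quantW q ++ encode φ
  encode-quant all φ = refl
  encode-quant ex  φ = refl

  encode-quantifyOver : ∀ {k n} (qs : Vec Quantifier k) (φ : Formula σ (k + n)) →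
                        encode (quantifyOver qs φ) ≡ prefixW qs ++ encode φ
  encode-quantifyOver []       φ = refl
  encode-quantifyOver (q ∷ qs) φ = trans (encode-quantifyOver qs (quant q φ))
    (trans (cong (prefixW qs ++_) (encode-quant q φ)) (sym (++-assoc (prefixW qs) (quantW q) (encode φ))))

  module _ {k : ℕ} where

    -- An index bound within the literal is fixed, whereas a free one moves with the position of the
    -- literal. In unary the shift is a run of ones, inserted where `nothing` stands: after the `d`
    -- local binders and before the index in the gadget.
    varTokens : ∀ d → Fin (d + k) → List (Maybe Bool)
    varTokens zero    x       = nothing ∷ mapᴸ just (unary x)
    varTokens (suc d) zero    = just false ∷ []
    varTokens (suc d) (suc x) = just true ∷ varTokens d x

    varsTokens : ∀ {a} d → Vec (Fin (d + k)) a → List (Maybe Bool)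
    varsTokens d []       = []
    varsTokens d (x ∷ xs) = varTokens d x ++ varsTokens d xs

    tokens : ∀ d → Formula σ (d + k) → List (Maybe Bool)
    tokens d (rel R xs)  = mapᴸ just (true ∷ true ∷ unary R) ++ varsTokens d xs
    tokens d (φ ∧ ψ)     = mapᴸ just (false ∷ false ∷ []) ++ tokens d φ ++ tokens d ψ
    tokens d (φ ∨ ψ)     = mapᴸ just (false ∷ true ∷ []) ++ tokens d φ ++ tokens d ψ
    tokens d (quant q φ) = mapᴸ just (quantW q) ++ tokens (suc d) φ

    fill-++ : ∀ s ts us → fill s (ts ++ us) ≡ fill s ts ++ fill s us
    fill-++ s []             us = refl
    fill-++ s (just b ∷ ts)  us = cong (b ∷_) (fill-++ s ts us)
    fill-++ s (nothing ∷ ts) us = trans (cong (replicate s true ++_) (fill-++ s ts us)) (sym (++-assoc (replicate s true) _ _))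

    fill-just : ∀ s w ts → fill s (mapᴸ just w ++ ts) ≡ w ++ fill s ts
    fill-just s []      ts = refl
    fill-just s (b ∷ w) ts = cong (b ∷_) (fill-just s w ts)

    module _ {n s : ℕ} {ρ : Fin k → Fin n} (shift : ∀ x → toℕ (ρ x) ≡ s + toℕ x) where

      fill-varTokens : ∀ d x → fill s (varTokens d x) ≡ unary (extends d ρ x)
      fill-varTokens zero    x       = trans (cong (replicate s true ++_) (fill-word (unary x))) (shifted s x (ρ x) (shift x))
        where
        fill-word : ∀ w → fill s (mapᴸ just w) ≡ w
        fill-word []      = refl
        fill-word (b ∷ w) = cong (b ∷_) (fill-word w)

        unary-cong : ∀ {m n} (x : Fin m) (y : Fin n) → toℕ y ≡ toℕ x → unary x ≡ unary y
        unary-cong zero    zero    e = refl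
        unary-cong (suc x) (suc y) e = cong (true ∷_) (unary-cong x y (cong pred e))

        shifted : ∀ {n} s (x : Fin k) (y : Fin n) → toℕ y ≡ s + toℕ x → replicate s true ++ unary x ≡ unary y
        shifted zero    x y       e = unary-cong x y e
        shifted (suc s) x (suc y) e = cong (true ∷_) (shifted s x y (cong pred e))
      fill-varTokens (suc d) zero    = refl
      fill-varTokens (suc d) (suc x) = cong (true ∷_) (fill-varTokens d x)

      fill-varsTokens : ∀ {a} d (xs : Vec (Fin (d + k)) a) → fill s (varsTokens d xs) ≡ unaries (mapⱽ (extends d ρ) xs)
      fill-varsTokens d []       = refl
      fill-varsTokens d (x ∷ xs) = trans (fill-++ s (varTokens d x) (varsTokens d xs))
        (cong₂ _++_ (fill-varTokens d x) (fill-varsTokens d xs))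

      fill-tokens : ∀ d φ → fill s (tokens d φ) ≡ encode (rename (extends d ρ) φ)
      fill-tokens d (rel R xs) = trans (fill-just s (true ∷ true ∷ unary R) (varsTokens d xs))
        (cong (λ w → true ∷ true ∷ unary R ++ w) (fill-varsTokens d xs))
      fill-tokens d (φ ∧ ψ)    = cong (λ w → false ∷ false ∷ w)
        (trans (fill-++ s (tokens d φ) (tokens d ψ)) (cong₂ _++_ (fill-tokens d φ) (fill-tokens d ψ)))
      fill-tokens d (φ ∨ ψ)    = cong (λ w → false ∷ true ∷ w)
        (trans (fill-++ s (tokens d φ) (tokens d ψ)) (cong₂ _++_ (fill-tokens d φ) (fill-tokens d ψ)))
      fill-tokens d (quant q φ) = trans (fill-just s (quantW q) (tokens (suc d) φ))
        (trans (cong (quantW q ++_) (fill-tokens (suc d) φ)) (sym (encode-quant q (rename (extends (suc d) ρ) φ))))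

-- Gadgets and correctness of the translation

module Semantics {ℓ : Level} {σ : Signature} (B : Structure σ ℓ) where
  open Structure B

  -- The prefix as an operator on arbitrary predicates: the predicate it meets is the rest of the
  -- formula under a fixed environment of outer variables.
  QSat : ∀ {k} → Vec Quantifier k → (Vec Carrier k → Set ℓ) → Set ℓ
  QSat []         P = P []
  QSat (all ∷ qs) P = QSat qs λ v → ∀ c → P (c ∷ v)
  QSat (ex ∷ qs)  P = QSat qs λ v → Σ[ c ∈ Carrier ] P (c ∷ v)

  QSat-mono : ∀ {k} (qs : Vec Quantifier k) {P P′} → (∀ v → P v → P′ v) → QSat qs P → QSat qs P′
  QSat-mono []         h p = h [] p
  QSat-mono (all ∷ qs) h p = QSat-mono qs (λ v g c → h (c ∷ v) (g c)) p
  QSat-mono (ex ∷ qs)  h p = QSat-mono qs (λ { v (c , g) → c , h (c ∷ v) g }) p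

  Sat-quantify : ∀ {k} (qs : Vec Quantifier k) φ → (B ⊨ quantify qs φ) ≡ QSat qs (Sat B φ)
  Sat-quantify []         φ = refl
  Sat-quantify (all ∷ qs) φ = Sat-quantify qs (quant all φ)
  Sat-quantify (ex ∷ qs)  φ = Sat-quantify qs (quant ex φ)

  Sat-quantifyOver : ∀ {k n} (qs : Vec Quantifier k) (φ : Formula σ (k + n)) η →
                     Sat B (quantifyOver qs φ) η ≡ QSat qs (λ v → Sat B φ (v ++ⱽ η))
  Sat-quantifyOver []         φ η = refl
  Sat-quantifyOver (all ∷ qs) φ η = Sat-quantifyOver qs (quant all φ) η
  Sat-quantifyOver (ex ∷ qs)  φ η = Sat-quantifyOver qs (quant ex φ) η

  rename-env : ∀ {m n} {ρ : Fin m → Fin n} {η θ} → (∀ x → lookup η (ρ x) ≡ lookup θ x) →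
               ∀ (c : Carrier) x → lookup (c ∷ η) (extend {σ} ρ x) ≡ lookup (c ∷ θ) x
  rename-env e c zero    = refl
  rename-env e c (suc x) = e x

  Sat-rename⁺ : ∀ {m n} {ρ : Fin m → Fin n} {η θ} φ → (∀ x → lookup η (ρ x) ≡ lookup θ x) →
                Sat B φ θ → Sat B (rename ρ φ) η
  Sat-rename⁻ : ∀ {m n} {ρ : Fin m → Fin n} {η θ} φ → (∀ x → lookup η (ρ x) ≡ lookup θ x) →
                Sat B (rename ρ φ) η → Sat B φ θ
  Sat-rename⁺ {ρ = ρ} {η} (rel R xs) e p =
    subst ⟦ R ⟧ᴿ (sym (trans (sym (map-∘ (lookup η) ρ xs)) (map-cong e xs))) p
  Sat-rename⁺ (φ ∧ ψ)       e (p , q)  = Sat-rename⁺ φ e p , Sat-rename⁺ ψ e q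
  Sat-rename⁺ (φ ∨ ψ)       e (inj₁ p) = inj₁ (Sat-rename⁺ φ e p)
  Sat-rename⁺ (φ ∨ ψ)       e (inj₂ p) = inj₂ (Sat-rename⁺ ψ e p)
  Sat-rename⁺ (quant all φ) e p c      = Sat-rename⁺ φ (rename-env e c) (p c)
  Sat-rename⁺ (quant ex φ)  e (c , p)  = c , Sat-rename⁺ φ (rename-env e c) p
  Sat-rename⁻ {ρ = ρ} {η} (rel R xs) e p =
    subst ⟦ R ⟧ᴿ (trans (sym (map-∘ (lookup η) ρ xs)) (map-cong e xs)) p
  Sat-rename⁻ (φ ∧ ψ)       e (p , q)  = Sat-rename⁻ φ e p , Sat-rename⁻ ψ e q
  Sat-rename⁻ (φ ∨ ψ)       e (inj₁ p) = inj₁ (Sat-rename⁻ φ e p)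
  Sat-rename⁻ (φ ∨ ψ)       e (inj₂ p) = inj₂ (Sat-rename⁻ ψ e p)
  Sat-rename⁻ (quant all φ) e p c      = Sat-rename⁻ φ (rename-env e c) (p c)
  Sat-rename⁻ (quant ex φ)  e (c , p)  = c , Sat-rename⁻ φ (rename-env e c) p

  -- A block of quantifiers together with two formulas that act as a Boolean
  -- quantifier and the two literals of its variable.
  record Gadget (q : Quantifier) (k : ℕ) : Set (Level.suc ℓ) where
    field
      prefix  : Vec Quantifier k
      literal : Bool → Formula σ k
      up      : ∀ (P : Vec Carrier k → Set ℓ) (g : Bool → Bool) → (∀ b v → g b ≡ true → Sat B (literal b) v → P v) →
                choose q (g true) (g false) ≡ true → QSat prefix P
      down    : ∀ (P : Vec Carrier k → Set ℓ) (g : Bool → Bool) → (∀ b v → ¬ Sat B (literal (not b)) v → P v → g b ≡ true) →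
                QSat prefix P → choose q (g true) (g false) ≡ true

  open Gadget

  -- A new innermost existential variable that the literals do not mention changes nothing, the
  -- domain being nonempty. It serves to bring two gadgets to the same width.
  pad : ∀ {q k} → Gadget q k → Gadget q (suc k)
  pad G .prefix = ex ∷ prefix G
  pad G .literal b = rename suc (literal G b)
  pad G .up P g h = up G (λ v → Σ[ c ∈ Carrier ] P (c ∷ v)) g
    λ b v e s → nonempty , h b (nonempty ∷ v) e (Sat-rename⁺ (literal G b) (λ _ → refl) s)
  pad G .down P g h = down G (λ v → Σ[ c ∈ Carrier ] P (c ∷ v)) g
    λ { b v n (c , p) → h b (c ∷ v) (n ∘ Sat-rename⁻ (literal G (not b)) (λ _ → refl)) p }

  pads : ∀ {q k} m → Gadget q k → Gadget q (m + k)
  pads zero    G = G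
  pads (suc m) G = pad (pads m G)

  module _ (em : ExcludedMiddle ℓ) where

    -- Upwards, `holds₁` or `holds₂` supplies the literal that is wanted, and the prefix is
    -- monotone. Downwards, if both values of `g` were false, every tuple with `P` would satisfy
    -- both literals, so the prefix would hold of `φ₁ ∧ φ₂`, against `fails`.
    ∧-gadget : ∀ {φ} (b : φ Breaks-∧-on B) → Gadget ex (_Breaks-∧-on_.length-prefix b)
    ∧-gadget record { prefix = qs ; φ₁ = φ₁ ; φ₂ = φ₂ ; shape = refl ; fails = fails ; holds₁ = holds₁ ; holds₂ = holds₂ } = record
      { prefix = qs ; literal = literal′ ; up = up′ ; down = down′ }
      where
      literal′ : Bool → Formula σ _
      literal′ true  = φ₁
      literal′ false = φ₂

      up′ : ∀ P (g : Bool → Bool) → (∀ b v → g b ≡ true → Sat B (literal′ b) v → P v) →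
            g true ∨ᵇ g false ≡ true → QSat qs P
      up′ P g h e with g true in e₁ | g false in e₂
      ... | true  | _    = QSat-mono qs (λ v → h true v e₁) (subst (λ S → S) (Sat-quantify qs φ₁) holds₁)
      ... | false | true = QSat-mono qs (λ v → h false v e₂) (subst (λ S → S) (Sat-quantify qs φ₂) holds₂)

      down′ : ∀ P (g : Bool → Bool) → (∀ b v → ¬ Sat B (literal′ (not b)) v → P v → g b ≡ true) →
              QSat qs P → g true ∨ᵇ g false ≡ true
      down′ P g h s with g true in e₁ | g false in e₂
      ... | true  | _     = refl
      ... | false | true  = refl
      ... | false | false = ⊥-elim (fails (subst (λ S → S) (sym (Sat-quantify qs (φ₁ ∧ φ₂))) (QSat-mono qs both s)))
        where
        both : ∀ v → P v → Sat B (φ₁ ∧ φ₂) v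
        both v p with em {Sat B φ₁ v} | em {Sat B φ₂ v}
        ... | yes s₁ | yes s₂ = s₁ , s₂
        ... | no ¬s₁ | _      with () ← trans (sym e₂) (h false v ¬s₁ p)
        ... | _      | no ¬s₂ with () ← trans (sym e₁) (h true v ¬s₂ p)

    -- Upwards, each tuple allowed by `holds` satisfies one of the literals, and `g` is true at both
    -- values. Downwards, if `g` is false at one value, every tuple with `P` satisfies the opposite
    -- literal, so the prefix would hold of that literal alone.
    ∨-gadget : ∀ {ψ} (b : ψ Breaks-∨-on B) → Gadget all (_Breaks-∨-on_.length-prefix b)
    ∨-gadget record { prefix = qs ; ψ₁ = ψ₁ ; ψ₂ = ψ₂ ; shape = refl ; holds = holds ; fails₁ = fails₁ ; fails₂ = fails₂ } = record
      { prefix = qs ; literal = literal′ ; up = up′ ; down = down′ }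
      where
      literal′ : Bool → Formula σ _
      literal′ true  = ψ₁
      literal′ false = ψ₂

      up′ : ∀ P (g : Bool → Bool) → (∀ b v → g b ≡ true → Sat B (literal′ b) v → P v) →
            g true ∧ᵇ g false ≡ true → QSat qs P
      up′ P g h e with g true in e₁ | g false in e₂
      ... | true | true = QSat-mono qs (λ { v (inj₁ s) → h true v e₁ s ; v (inj₂ s) → h false v e₂ s })
        (subst (λ S → S) (Sat-quantify qs (ψ₁ ∨ ψ₂)) holds)

      down′ : ∀ P (g : Bool → Bool) → (∀ b v → ¬ Sat B (literal′ (not b)) v → P v → g b ≡ true) →
              QSat qs P → g true ∧ᵇ g false ≡ true
      down′ P g h s with g true in e₁ | g false in e₂
      ... | true  | true  = refl
      ... | false | _     = ⊥-elim (fails₂ (subst (λ S → S) (sym (Sat-quantify qs ψ₂)) (QSat-mono qs other s)))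
        where
        other : ∀ v → P v → Sat B ψ₂ v
        other v p with em {Sat B ψ₂ v}
        ... | yes s₂ = s₂
        ... | no ¬s₂ with () ← trans (sym e₁) (h true v ¬s₂ p)
      ... | true  | false = ⊥-elim (fails₁ (subst (λ S → S) (sym (Sat-quantify qs ψ₁)) (QSat-mono qs other s)))
        where
        other : ∀ v → P v → Sat B ψ₁ v
        other v p with em {Sat B ψ₁ v}
        ... | yes s₁ = s₁
        ... | no ¬s₁ with () ← trans (sym e₂) (h false v ¬s₁ p)

  module Translation {A : Set} (kind : A → Quantifier) {k : ℕ} (G : ∀ a → Gadget (kind a) k) where

    style : Style A
    style = record
      { width = k
      ; andW = false ∷ false ∷ []
      ; orW = false ∷ true ∷ []
      ; quW = λ a → prefixW {σ} (prefix (G a))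
      ; litW = λ a b → tokens 0 (literal (G a) b)
      }

    offset : ∀ (Γ : List A) x {a} → Γ !? x ≡ just a → Fin k → Fin (length Γ * k)
    offset (_ ∷ Γ) zero    e j = j ↑ˡ (length Γ * k)
    offset (_ ∷ Γ) (suc x) e j = k ↑ʳ offset Γ x e j

    toℕ-offset : ∀ Γ x {a} (e : Γ !? x ≡ just a) j → toℕ (offset Γ x e j) ≡ k * x + toℕ j
    toℕ-offset (_ ∷ Γ) zero    e j = trans (toℕ-↑ˡ j _) (cong (_+ toℕ j) (sym (*-zeroʳ k)))
    toℕ-offset (_ ∷ Γ) (suc x) e j = trans (toℕ-↑ʳ k _) (trans (cong (k +_) (toℕ-offset Γ x e j))
      (trans (sym (+-assoc k (k * x) (toℕ j))) (cong (_+ toℕ j) (sym (*-suc k x)))))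

    translate : ∀ Γ F → Scoped Γ F → Formula σ (length Γ * k)
    translate Γ (lit a b x) s       = rename (offset Γ x s) (literal (G a) b)
    translate Γ (φ and ψ)   (s , t) = translate Γ φ s ∧ translate Γ ψ t
    translate Γ (φ or ψ)    (s , t) = translate Γ φ s ∨ translate Γ ψ t
    translate Γ (bind a φ)  s       = quantifyOver (prefix (G a)) (translate (a ∷ Γ) φ s)

    encode-translate : ∀ Γ F s → encode (translate Γ F s) ≡ code style F
    encode-translate Γ (lit a b x) s       = sym (fill-tokens (toℕ-offset Γ x s) 0 (literal (G a) b))
    encode-translate Γ (φ and ψ)   (s , t) =
      cong₂ (λ u v → false ∷ false ∷ u ++ v) (encode-translate Γ φ s) (encode-translate Γ ψ t)
    encode-translate Γ (φ or ψ)    (s , t) =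
      cong₂ (λ u v → false ∷ true ∷ u ++ v) (encode-translate Γ φ s) (encode-translate Γ ψ t)
    encode-translate Γ (bind a φ)  s       = trans (encode-quantifyOver (prefix (G a)) (translate (a ∷ Γ) φ s))
      (cong (prefixW {σ} (prefix (G a)) ++_) (encode-translate (a ∷ Γ) φ s))

    data Env (R : A → Bool → Vec Carrier k → Set ℓ) : ∀ (Γ : List A) → List Bool → Vec Carrier (length Γ * k) → Set ℓ where
      []  : Env R [] [] []
      _∷_ : ∀ {a b v Γ ρ η} → R a b v → Env R Γ ρ η → Env R (a ∷ Γ) (b ∷ ρ) (v ++ⱽ η)

    lookupEnv : ∀ {R Γ ρ η} → Env R Γ ρ η → ∀ x {a} (s : Γ !? x ≡ just a) →
                Σ[ v ∈ Vec Carrier k ] R a (at ρ x) v × (∀ j → lookup η (offset Γ x s j) ≡ lookup v j)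
    lookupEnv (_∷_ {v = v} {η = η} r rs) zero    refl = v , r , lookup-++ˡ v η
    lookupEnv (_∷_ {v = v} {η = η} r rs) (suc x) s with u , r′ , e ← lookupEnv rs x s =
      u , r′ , λ j → trans (lookup-++ʳ v η _) (e j)

    -- The two one-sided substitutes for "the tuple has the value b": its literal holds, or the
    -- opposite literal fails. As the formula is positive in literals, `sound` gets by with the
    -- first and `complete` with the second.
    Upper Lower : A → Bool → Vec Carrier k → Set ℓ
    Upper a b v = Sat B (literal (G a) b) v
    Lower a b v = ¬ Sat B (literal (G a) (not b)) v

    agrees⇒≡ : ∀ b c → agrees b c ≡ true → c ≡ b
    agrees⇒≡ true  true  e = refl
    agrees⇒≡ false false e = refl

    sound : ∀ {Γ ρ η} F s → Env Upper Γ ρ η → truth kind F ρ ≡ true → Sat B (translate Γ F s) η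
    sound (lit a b x) s env e with v , r , eq ← lookupEnv env x s =
      Sat-rename⁺ (literal (G a) b) eq (subst (λ c → Upper a c v) (agrees⇒≡ b _ e) r)
    sound {ρ = ρ} (φ and ψ) (s , t) env e with truth kind φ ρ in e₁ | truth kind ψ ρ in e₂
    ... | true | true = sound φ s env e₁ , sound ψ t env e₂
    sound {ρ = ρ} (φ or ψ) (s , t) env e with truth kind φ ρ in e₁ | truth kind ψ ρ in e₂
    ... | true  | _    = inj₁ (sound φ s env e₁)
    ... | false | true = inj₂ (sound ψ t env e₂)
    sound {Γ} {ρ} {η} (bind a φ) s env e =
      subst (λ S → S) (sym (Sat-quantifyOver (prefix (G a)) (translate (a ∷ Γ) φ s) η))
        (up (G a) (λ v → Sat B (translate (a ∷ Γ) φ s) (v ++ⱽ η)) (λ b → truth kind φ (b ∷ ρ))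
          (λ b v e′ r → sound φ s (r ∷ env) e′) e)

    complete : ∀ {Γ ρ η} F s → Env Lower Γ ρ η → Sat B (translate Γ F s) η → truth kind F ρ ≡ true
    complete {ρ = ρ} (lit a b x) s env p with v , r , eq ← lookupEnv env x s = go b (at ρ x) r (Sat-rename⁻ (literal (G a) b) eq p)
      where
      go : ∀ b c → Lower a c v → Sat B (literal (G a) b) v → agrees b c ≡ true
      go true  true  r q = refl
      go true  false r q = ⊥-elim (r q)
      go false true  r q = ⊥-elim (r q)
      go false false r q = refl
    complete {ρ = ρ} (φ and ψ) (s , t) env (p , q) rewrite complete φ s env p | complete ψ t env q = refl
    complete {ρ = ρ} (φ or ψ) (s , t) env (inj₁ p) rewrite complete φ s env p = refl
    complete {ρ = ρ} (φ or ψ) (s , t) env (inj₂ p) rewrite complete ψ t env p with truth kind φ ρ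
    ... | true  = refl
    ... | false = refl
    complete {Γ} {ρ} {η} (bind a φ) s env p =
      down (G a) (λ v → Sat B (translate (a ∷ Γ) φ s) (v ++ⱽ η)) (λ b → truth kind φ (b ∷ ρ))
        (λ b v n q → complete φ s (n ∷ env) q)
        (subst (λ S → S) (Sat-quantifyOver (prefix (G a)) (translate (a ∷ Γ) φ s) η) p)

    MC-code : ∀ F → Scoped [] F → MC B (code style F) ⇔ (truth kind F [] ≡ true)
    MC-code F s = mk⇔ to from
      where
      θ = translate [] F s

      to : MC B (code style F) → truth kind F [] ≡ true
      -- Membership only provides some sentence with this code; injectivity of codes identifies it
      -- with the translation.
      to (θ′ , e , p) with refl ← encode-injective θ θ′ (trans (encode-translate [] F s) e) = complete F s [] p

      from : truth kind F [] ≡ true → MC B (code style F)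
      from e = θ , sym (encode-translate [] F s) , sound F s [] e

-- Formulas over blocks of columns

∧-true : ∀ {a b} → a ∧ᵇ b ≡ true → a ≡ true × b ≡ true
∧-true {true} {true} _ = refl , refl

∧-intro : ∀ {a b} → a ≡ true → b ≡ true → a ∧ᵇ b ≡ true
∧-intro refl refl = refl

!?-++ˡ : ∀ (xs : List Z) {ys x} → x < length xs → (xs ++ ys) !? x ≡ xs !? x
!?-++ˡ (z ∷ xs) {x = zero}  _       = refl
!?-++ˡ (z ∷ xs) {x = suc x} (s≤s p) = !?-++ˡ xs p

!?-++ʳ : ∀ (xs : List Z) {ys} x → (xs ++ ys) !? (length xs + x) ≡ ys !? x
!?-++ʳ []       x = refl
!?-++ʳ (z ∷ xs) x = !?-++ʳ xs x

!?-toList : ∀ {n} (xs : Vec Z n) j → toList xs !? toℕ j ≡ just (lookup xs j)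
!?-toList (x ∷ xs) zero    = refl
!?-toList (x ∷ xs) (suc j) = !?-toList xs j

!?-replicate : ∀ n (z : Z) {x} → x < n → replicate n z !? x ≡ just z
!?-replicate (suc n) z {zero}  _       = refl
!?-replicate (suc n) z {suc x} (s≤s p) = !?-replicate n z p

length-toList : ∀ {n} (xs : Vec Z n) → length (toList xs) ≡ n
length-toList []       = refl
length-toList (x ∷ xs) = cong suc (length-toList xs)

replicate-∷ : ∀ n (z : Z) zs → replicate n z ++ z ∷ zs ≡ z ∷ replicate n z ++ zs
replicate-∷ zero    z zs = refl
replicate-∷ (suc n) z zs = cong (z ∷_) (replicate-∷ n z zs)

value-i : ∀ v i c → value v i (affine 0 1 c) ≡ c + i
value-i v i c = trans (cong (_+ c) (+-identityʳ i)) (+-comm i c)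

value-v : ∀ v i c → value v i (affine 1 0 c) ≡ c + v
value-v v i c = trans (cong (_+ c) (+-identityʳ v)) (+-comm v c)

-- Variables come in blocks of columns of e bits: bit j of column x of the
-- block at depth β has de Bruijn index β * ((2 + v) * e) + (x * e + j).
module Blocks {A : Set} (a : A) (e : ℕ) where

  Bits : Set
  Bits = Vec Bool e

  record Address : Set where
    constructor address
    field
      tag    : A
      depth  : ℕ
      column : Affine

  -- Depth and bit number are constants of the test, so the position remains affine in `v` and `i`.
  bitAt : Address → ℕ → Affine
  bitAt (address _ β (affine a b c)) j = affine (β * e + a * e) (b * e) (β * (2 * e) + (c * e + j))

  -- There are no truth constants to use. A fresh variable provides them, and since both its values
  -- give the same result, either quantifier will do.
  constant : Bool → Template A
  constant true  = bind a (lit a true (affine 0 0 0) or lit a false (affine 0 0 0))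
  constant false = bind a (lit a true (affine 0 0 0) and lit a false (affine 0 0 0))

  -- A decision tree on the values of the bits. It is exponential in the number of bits, but each
  -- test reads a number of columns that is fixed, so its size does not depend on the input.
  branch : ∀ n → A → (Fin n → Affine) → (Vec Bool n → Template A) → Template A
  branch zero    a x k = k []
  branch (suc n) a x k = (lit a true (x zero) and branch n a (x ∘ suc) (k ∘ (true ∷_)))
                      or (lit a false (x zero) and branch n a (x ∘ suc) (k ∘ (false ∷_)))

  checkT : ∀ {r} → Vec Address r → (Vec Bits r → Bool) → Template A
  checkT []       P = constant (P [])
  checkT (x ∷ xs) P = branch e (Address.tag x) (bitAt x ∘ toℕ) λ c → checkT xs (P ∘ (c ∷_))

  -- Tests are kept as Boolean functions on columns, so that the meaning `Sem` of a plan no longer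
  -- mentions formulas.
  data Plan : Set where
    block  : A → Plan
    check  : ∀ {r} → Vec Address r → (Vec Bits r → Bool) → Plan
    checks : ∀ {r} → Vec Address r → (Vec Bits r → Bool) → Plan
    _▹_    : Plan → Plan → Plan

  infixr 5 _▹_

  gen : Plan → Gen A
  gen (block t)     = block t
  gen (check xs P)  = test (checkT xs P)
  gen (checks xs P) = tests (checkT xs P)
  gen (g ▹ h)       = gen g ▸ gen h

  -- Truth and scope of formulas over blocks

  module Sized (kind : A → Quantifier) (v : ℕ) where

    private
      N W : ℕ
      N = 2 + v
      W = blockSize e v

    W≡ : W ≡ N * e
    W≡ = size≡ e v
      where
      size≡ : ∀ e v → e * v + 2 * e ≡ (2 + v) * e
      size≡ = solve-∀

    Block : Set
    Block = Vec Bits N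

    flat : ∀ {n} → Vec Bits n → List Bool
    flat []       = []
    flat (c ∷ cs) = toList c ++ flat cs

    flats : List Block → List Bool
    flats []       = []
    flats (b ∷ bs) = flat b ++ flats bs

    nth : ∀ {n} → Vec Bits n → ℕ → Bits
    nth []       _       = replicateⱽ e false
    nth (c ∷ cs) zero    = c
    nth (c ∷ cs) (suc x) = nth cs x

    nth-ext : ∀ {n} (cs ds : Vec Bits n) → (∀ x → x < n → nth cs x ≡ nth ds x) → cs ≡ ds
    nth-ext []       []       h = refl
    nth-ext (c ∷ cs) (d ∷ ds) h = cong₂ _∷_ (h 0 (s≤s z≤n)) (nth-ext cs ds (λ x p → h (suc x) (s≤s p)))

    col : List Block → ℕ → ℕ → Bits
    col bs β x = tabulate λ j → at (flats bs) (β * W + (x * e + toℕ j))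

    length-flat : ∀ {n} (cs : Vec Bits n) → length (flat cs) ≡ n * e
    length-flat []       = refl
    length-flat (c ∷ cs) = trans (length-++ (toList c)) (cong₂ _+_ (length-toList c) (length-flat cs))

    flat-!? : ∀ {n} (cs : Vec Bits n) {ρ x} j → x < n → (flat cs ++ ρ) !? (x * e + toℕ j) ≡ just (lookup (nth cs x) j)
    flat-!? (c ∷ cs) {ρ} {zero}  j _ = trans (cong (_!? toℕ j) (++-assoc (toList c) (flat cs) ρ))
      (trans (!?-++ˡ (toList c) (subst (toℕ j <_) (sym (length-toList c)) (toℕ<n j))) (!?-toList c j))
    flat-!? (c ∷ cs) {ρ} {suc x} j (s≤s p) = trans (cong₂ _!?_ (++-assoc (toList c) (flat cs) ρ)
        (trans (+-assoc e (x * e) (toℕ j)) (cong (_+ (x * e + toℕ j)) (sym (length-toList c)))))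
      (trans (!?-++ʳ (toList c) (x * e + toℕ j)) (flat-!? cs j p))

    col-zero : ∀ b bs {x} → x < N → col (b ∷ bs) 0 x ≡ nth b x
    col-zero b bs {x} p = trans (tabulate-cong λ j → cong (fromMaybe false) (flat-!? b {flats bs} j p)) (tabulate∘lookup (nth b x))

    col-suc : ∀ b bs β x → col (b ∷ bs) (suc β) x ≡ col bs β x
    col-suc b bs β x = tabulate-cong λ j → cong (fromMaybe false)
      (trans (cong ((flat b ++ flats bs) !?_) (trans (+-assoc W (β * W) _) (cong (_+ (β * W + (x * e + toℕ j)))
        (trans W≡ (sym (length-flat b)))))) (!?-++ʳ (flat b) _))

    columnAt : List Block → ℕ → Address → Bits
    columnAt bs i (address _ β c) = col bs β (value v i c)

    bitAt-value : ∀ i a β c j → value v i (bitAt (address a β c) j) ≡ β * W + (value v i c * e + j)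
    bitAt-value i _ β (affine a b c) j = expand e v i β a b c j
      where
      expand : ∀ e v i β a b c j → (β * e + a * e) * v + ((b * e) * i + (β * (2 * e) + (c * e + j)))
                                 ≡ β * (e * v + 2 * e) + ((a * v + (b * i + c)) * e + j)
      expand = solve-∀

    truth-constant : ∀ b i ρ → truth kind (inst v i (constant b)) ρ ≡ b
    truth-constant true  i ρ with kind a
    ... | all = refl
    ... | ex  = refl
    truth-constant false i ρ with kind a
    ... | all = refl
    ... | ex  = refl

    truth-branch : ∀ n a x k i ρ → truth kind (inst v i (branch n a x k)) ρ ≡
                  truth kind (inst v i (k (tabulate λ j → at ρ (value v i (x j))))) ρ
    truth-branch zero    a x k i ρ = refl
    truth-branch (suc n) a x k i ρ with at ρ (value v i (x zero))
    ... | true  = trans (Bool.∨-identityʳ _) (truth-branch n a (x ∘ suc) (k ∘ (true ∷_)) i ρ)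
    ... | false = truth-branch n a (x ∘ suc) (k ∘ (false ∷_)) i ρ

    truth-check : ∀ {r} (xs : Vec Address r) P i bs →
                 truth kind (inst v i (checkT xs P)) (flats bs) ≡ P (mapⱽ (columnAt bs i) xs)
    truth-check []       P i bs = truth-constant (P []) i (flats bs)
    truth-check (x@(address t β c) ∷ xs) P i bs = trans (truth-branch e t (bitAt x ∘ toℕ) _ i (flats bs))
      (trans (truth-check xs (P ∘ (_ ∷_)) i bs)
        (cong (λ d → P (d ∷ mapⱽ (columnAt bs i) xs))
          (tabulate-cong λ j → cong (at (flats bs)) (bitAt-value i t β c (toℕ j)))))

    flatTags : List A → List A
    flatTags []       = []
    flatTags (t ∷ ts) = replicate W t ++ flatTags ts

    flatTags-!? : ∀ ts β {t x} → ts !? β ≡ just t → x < W → flatTags ts !? (β * W + x) ≡ just t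
    flatTags-!? (t ∷ ts) zero    refl p =
      trans (!?-++ˡ (replicate W t) (subst (_ <_) (sym (length-replicate W)) p)) (!?-replicate W t p)
    flatTags-!? (t ∷ ts) (suc β) {x = x} h p = trans (cong ((replicate W t ++ flatTags ts) !?_)
        (trans (+-assoc W (β * W) x) (cong (_+ (β * W + x)) (sym (length-replicate W)))))
      (trans (!?-++ʳ (replicate W t) (β * W + x)) (flatTags-!? ts β h p))

    data InScope (ts : List A) (i : ℕ) : Address → Set where
      in-scope : ∀ {t β c} → ts !? β ≡ just t → value v i c < N → InScope ts i (address t β c)

    data AllInScope (ts : List A) (i : ℕ) : ∀ {r} → Vec Address r → Set where
      []  : AllInScope ts i []
      _∷_ : ∀ {r x} {xs : Vec Address r} → InScope ts i x → AllInScope ts i xs → AllInScope ts i (x ∷ xs)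

    Scoped-constant : ∀ Γ b i → Scoped Γ (inst v i (constant b))
    Scoped-constant Γ true  i = refl , refl
    Scoped-constant Γ false i = refl , refl

    Scoped-branch : ∀ Γ n {a x} k i → (∀ j → Γ !? value v i (x j) ≡ just a) → (∀ c → Scoped Γ (inst v i (k c))) →
                    Scoped Γ (inst v i (branch n a x k))
    Scoped-branch Γ zero    k i h s = s []
    Scoped-branch Γ (suc n) k i h s =
      (h zero , Scoped-branch Γ n (k ∘ (true ∷_)) i (h ∘ suc) (s ∘ (true ∷_))) ,
      (h zero , Scoped-branch Γ n (k ∘ (false ∷_)) i (h ∘ suc) (s ∘ (false ∷_)))

    Scoped-check : ∀ {r ts i} {xs : Vec Address r} P → AllInScope ts i xs → Scoped (flatTags ts) (inst v i (checkT xs P))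
    Scoped-check {i = i} P [] = Scoped-constant _ (P []) i
    Scoped-check {ts = ts} {i} {xs = address t β c ∷ xs} P (in-scope h p ∷ s) =
      Scoped-branch (flatTags ts) e _ i
        (λ j → trans (cong (flatTags ts !?_) (bitAt-value i t β c (toℕ j))) (flatTags-!? ts β h (within j)))
        (λ d → Scoped-check (P ∘ (d ∷_)) s)
      where
      within : ∀ j → value v i c * e + toℕ j < W
      within j = subst (value v i c * e + toℕ j <_) (sym W≡)
        (<-≤-trans (+-monoʳ-< (value v i c * e) (toℕ<n j))
          (≤-trans (≤-reflexive (+-comm (value v i c * e) e)) (*-monoˡ-≤ e p)))

    matrix : QBF A ℕ
    matrix = inst v 0 (constant true)

    Yields : Chain A → List Bool → Set
    Yields ch ρ = truth kind (apply ch matrix) ρ ≡ true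

    Holds : Chain A → List Block → Set
    Holds ch bs = Yields ch (flats bs)

    InContext : Chain A → List A → Set
    InContext ch ts = Scoped (flatTags ts) (apply ch matrix)

    private
      ex-bits⁻ : ∀ n {a ch ρ} → kind a ≡ ex → Yields (replicate n (bound a) ++ ch) ρ →
                 Σ[ xs ∈ Vec Bool n ] Yields ch (toList xs ++ ρ)
      ex-bits⁻ zero    k h = [] , h
      ex-bits⁻ (suc n) {a} {ch} {ρ} k h
        -- The innermost binder is split off, because its bit is the head of the environment.
        with xs , q ← ex-bits⁻ n {a} {bound a ∷ ch} {ρ} k (trans (cong (λ c → truth kind (apply c matrix) ρ)
          (replicate-∷ n (bound a) ch)) h)
        rewrite k with truth kind (apply ch matrix) (true ∷ toList xs ++ ρ) in p₁
      ... | true  = true ∷ xs , p₁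
      ... | false = false ∷ xs , q

      ex-bits⁺ : ∀ n {a ch ρ} → kind a ≡ ex → (xs : Vec Bool n) → Yields ch (toList xs ++ ρ) →
                 Yields (replicate n (bound a) ++ ch) ρ
      ex-bits⁺ zero    k []       h = h
      ex-bits⁺ (suc n) {a} {ch} {ρ} k (x ∷ xs) h =
        trans (cong (λ c → truth kind (apply c matrix) ρ)
          (sym (replicate-∷ n (bound a) ch)))
          (ex-bits⁺ n {a} {bound a ∷ ch} {ρ} k xs (one x h))
        where
        one : ∀ x → Yields ch (x ∷ toList xs ++ ρ) →
              Yields (bound a ∷ ch) (toList xs ++ ρ)
        one true  h rewrite k | h = refl
        one false h rewrite k | h with truth kind (apply ch matrix) (true ∷ toList xs ++ ρ)
        ... | true  = refl
        ... | false = refl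

      all-bits⁻ : ∀ n {a ch ρ} → kind a ≡ all → Yields (replicate n (bound a) ++ ch) ρ →
                  (xs : Vec Bool n) → Yields ch (toList xs ++ ρ)
      all-bits⁻ zero    k h [] = h
      all-bits⁻ (suc n) {a} {ch} {ρ} k h (x ∷ xs)
        with q ← all-bits⁻ n {a} {bound a ∷ ch} {ρ} k (trans (cong (λ c → truth kind (apply c matrix) ρ)
          (replicate-∷ n (bound a) ch)) h) xs
        rewrite k with p₁ , p₂ ← ∧-true {truth kind (apply ch matrix) (true ∷ toList xs ++ ρ)} q with x
      ... | true  = p₁
      ... | false = p₂

      all-bits⁺ : ∀ n {a ch ρ} → kind a ≡ all → ((xs : Vec Bool n) → Yields ch (toList xs ++ ρ)) →
                  Yields (replicate n (bound a) ++ ch) ρ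
      all-bits⁺ zero    k h = h []
      all-bits⁺ (suc n) {a} {ch} {ρ} k h =
        trans (cong (λ c → truth kind (apply c matrix) ρ)
          (sym (replicate-∷ n (bound a) ch)))
          (all-bits⁺ n {a} {bound a ∷ ch} {ρ} k one)
        where
        one : (xs : Vec Bool n) → Yields (bound a ∷ ch) (toList xs ++ ρ)
        one xs = subst (λ q → choose q (truth kind (apply ch matrix) (true ∷ toList xs ++ ρ))
                                       (truth kind (apply ch matrix) (false ∷ toList xs ++ ρ)) ≡ true)
                   (sym k) (∧-intro (h (true ∷ xs)) (h (false ∷ xs)))

      flat-concat : ∀ {n} (cs : Vec Bits n) → toList (concat cs) ≡ flat cs
      flat-concat []       = refl
      flat-concat (c ∷ cs) = trans (toList-++ c (concat cs)) (cong (toList c ++_) (flat-concat cs))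

      env-flat : ∀ b bs → toList (concat b) ++ flats bs ≡ flats (b ∷ bs)
      env-flat b bs = cong (_++ flats bs) (flat-concat b)

    ex-block⁻ : ∀ {a ch bs} → kind a ≡ ex → Holds (chain e (block a) v ++ ch) bs → Σ[ b ∈ Block ] Holds ch (b ∷ bs)
    ex-block⁻ {a} {ch} {bs} k h
      with xs , q ← ex-bits⁻ (N * e) {a} {ch} k (subst (λ w → Holds (replicate w (bound a) ++ ch) bs) W≡ h)
      with b , refl ← group N e xs =
      b , subst (Yields ch) (env-flat b bs) q

    ex-block⁺ : ∀ {a ch bs} → kind a ≡ ex → ∀ b → Holds ch (b ∷ bs) → Holds (chain e (block a) v ++ ch) bs
    ex-block⁺ {a} {ch} {bs} k b h = subst (λ w → Holds (replicate w (bound a) ++ ch) bs) (sym W≡)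
      (ex-bits⁺ (N * e) {a} {ch} k (concat b)
        (subst (Yields ch) (sym (env-flat b bs)) h))

    all-block⁻ : ∀ {a ch bs} → kind a ≡ all → Holds (chain e (block a) v ++ ch) bs → ∀ b → Holds ch (b ∷ bs)
    all-block⁻ {a} {ch} {bs} k h b = subst (Yields ch) (env-flat b bs)
      (all-bits⁻ (N * e) {a} {ch} k (subst (λ w → Holds (replicate w (bound a) ++ ch) bs) W≡ h) (concat b))

    all-block⁺ : ∀ {a ch bs} → kind a ≡ all → (∀ b → Holds ch (b ∷ bs)) → Holds (chain e (block a) v ++ ch) bs
    all-block⁺ {a} {ch} {bs} k h = subst (λ w → Holds (replicate w (bound a) ++ ch) bs) (sym W≡)
      (all-bits⁺ (N * e) {a} {ch} k each)
      where
      each : ∀ xs → Yields ch (toList xs ++ flats bs)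
      each xs with b , refl ← group N e xs =
        subst (Yields ch) (sym (env-flat b bs)) (h b)

    conj⁻ : ∀ {φ ch bs} → Holds (conj φ ∷ ch) bs → truth kind φ (flats bs) ≡ true × Holds ch bs
    conj⁻ = ∧-true

    conj⁺ : ∀ {φ ch bs} → truth kind φ (flats bs) ≡ true → Holds ch bs → Holds (conj φ ∷ ch) bs
    conj⁺ = ∧-intro

    conjs⁻ : ∀ n {φ : ℕ → QBF A ℕ} {ch bs} → Holds (concatUpTo (λ i → [ conj (φ i) ]) n ++ ch) bs →
             (∀ i → i < n → truth kind (φ i) (flats bs) ≡ true) × Holds ch bs
    conjs⁻ zero    h = (λ _ ()) , h
    conjs⁻ (suc n) {φ} {ch} {bs} h
      with p , q ← conjs⁻ n {φ} {conj (φ n) ∷ ch} {bs} (subst (λ c → Holds c bs) (++-assoc (concatUpTo (λ i → [ conj (φ i) ]) n) _ ch) h)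
      with q₁ , q₂ ← ∧-true q = (λ i i≤n → up-to p q₁ i (m≤n⇒m<n∨m≡n (≤-pred i≤n))) , q₂
      where
      open import Data.Sum.Base using (_⊎_; inj₁; inj₂; [_,_]′)
      up-to : (∀ i → i < n → truth kind (φ i) (flats bs) ≡ true) → truth kind (φ n) (flats bs) ≡ true →
              ∀ i → i < n ⊎ i ≡ n → truth kind (φ i) (flats bs) ≡ true
      up-to p q i (inj₁ i<n)  = p i i<n
      up-to p q i (inj₂ refl) = q

    conjs⁺ : ∀ n {φ : ℕ → QBF A ℕ} {ch bs} → (∀ i → i < n → truth kind (φ i) (flats bs) ≡ true) → Holds ch bs →
             Holds (concatUpTo (λ i → [ conj (φ i) ]) n ++ ch) bs
    conjs⁺ zero    p h = h
    conjs⁺ (suc n) {φ} {ch} {bs} p h =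
      subst (λ c → Holds c bs) (sym (++-assoc (concatUpTo (λ i → [ conj (φ i) ]) n) _ ch))
        (conjs⁺ n {φ} {conj (φ n) ∷ ch} {bs} (λ i i<n → p i (m<n⇒m<1+n i<n)) (∧-intro (p n ≤-refl) h))

    block-context : ∀ {a ch ts} → InContext ch (a ∷ ts) → InContext (chain e (block a) v ++ ch) ts
    block-context {a} {ch} {ts} = go W
      where
      go : ∀ n {ch} → Scoped (replicate n a ++ flatTags ts) (apply ch matrix) →
           Scoped (flatTags ts) (apply (replicate n (bound a) ++ ch) matrix)
      go zero    s = s
      go (suc n) {ch} s = subst (λ c → Scoped (flatTags ts) (apply c matrix)) (replicate-∷ n (bound a) ch) (go n s)

    conjs-context : ∀ n {φ : ℕ → QBF A ℕ} {ch ts} → (∀ i → i < n → Scoped (flatTags ts) (φ i)) → InContext ch ts →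
                    InContext (concatUpTo (λ i → [ conj (φ i) ]) n ++ ch) ts
    conjs-context zero    p h = h
    conjs-context (suc n) {φ} {ch} {ts} p h =
      subst (λ c → InContext c ts) (sym (++-assoc (concatUpTo (λ i → [ conj (φ i) ]) n) _ ch))
        (conjs-context n {φ} {conj (φ n) ∷ ch} {ts} (λ i i<n → p i (m<n⇒m<1+n i<n)) (p n ≤-refl , h))

    SemBlock : Quantifier → (List Block → Set) → List Block → Set
    SemBlock all K bs = ∀ b → K (b ∷ bs)
    SemBlock ex  K bs = Σ[ b ∈ Block ] K (b ∷ bs)

    Passes : ∀ {r} → ℕ → Vec Address r → (Vec Bits r → Bool) → List Block → Set
    Passes i xs P bs = P (mapⱽ (columnAt bs i) xs) ≡ true

    pass⁻ : ∀ {r} i (xs : Vec Address r) P ch bs → Holds (conj (inst v i (checkT xs P)) ∷ ch) bs → Passes i xs P bs × Holds ch bs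
    pass⁻ i xs P ch bs h with p , q ← conj⁻ {inst v i (checkT xs P)} {ch} {bs} h = trans (sym (truth-check xs P i bs)) p , q

    pass⁺ : ∀ {r} i (xs : Vec Address r) P ch bs → Passes i xs P bs → Holds ch bs → Holds (conj (inst v i (checkT xs P)) ∷ ch) bs
    pass⁺ i xs P ch bs p q = conj⁺ {inst v i (checkT xs P)} {ch} {bs} (trans (truth-check xs P i bs) p) q

    -- Continuation-passing form: `K` is what the rest of the chain demands of the environment at
    -- that point.
    Sem : Plan → (List Block → Set) → List Block → Set
    Sem (block t)     K bs = SemBlock (kind t) K bs
    Sem (check xs P)  K bs = Passes 0 xs P bs × K bs
    Sem (checks xs P) K bs = (∀ i → i < v → Passes i xs P bs) × K bs
    Sem (g ▹ h)       K bs = Sem g (Sem h K) bs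

    SemPower : ℕ → Plan → (List Block → Set) → List Block → Set
    SemPower zero    g K = K
    SemPower (suc n) g K = Sem g (SemPower n g K)

    sem⁻ : ∀ g {K ch bs} → (∀ {bs} → Holds ch bs → K bs) → Holds (chain e (gen g) v ++ ch) bs → Sem g K bs
    sem⁻ (block t) {ch = ch} {bs} k h with kind t in eq
    ... | all = λ b → k (all-block⁻ {ch = ch} {bs} eq h b)
    ... | ex  with b , h ← ex-block⁻ {ch = ch} {bs} eq h = b , k h
    sem⁻ (check xs P) {ch = ch} {bs} k h with p , q ← pass⁻ 0 xs P ch bs h = p , k q
    sem⁻ (checks xs P) {ch = ch} {bs} k h with p , q ← conjs⁻ v {ch = ch} {bs} h =
      (λ i i<v → trans (sym (truth-check xs P i bs)) (p i i<v)) , k q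
    sem⁻ (g ▹ g′) {ch = ch} {bs} k h =
      sem⁻ g (sem⁻ g′ k) (subst (λ c → Holds c bs) (++-assoc (chain e (gen g) v) (chain e (gen g′) v) ch) h)

    sem⁺ : ∀ g {K ch bs} → (∀ {bs} → K bs → Holds ch bs) → Sem g K bs → Holds (chain e (gen g) v ++ ch) bs
    sem⁺ (block t) {ch = ch} {bs} k h with kind t in eq
    ... | all = all-block⁺ {ch = ch} {bs} eq (λ b → k (h b))
    ... | ex  = ex-block⁺ {ch = ch} {bs} eq (proj₁ h) (k (proj₂ h))
    sem⁺ (check xs P) {ch = ch} {bs} k (p , q) = pass⁺ 0 xs P ch bs p (k q)
    sem⁺ (checks xs P) {ch = ch} {bs} k (p , q) =
      conjs⁺ v {ch = ch} {bs} (λ i i<v → trans (truth-check xs P i bs) (p i i<v)) (k q)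
    sem⁺ (g ▹ g′) {ch = ch} {bs} k h =
      subst (λ c → Holds c bs) (sym (++-assoc (chain e (gen g) v) (chain e (gen g′) v) ch)) (sem⁺ g (sem⁺ g′ k) h)

    semPower⁻ : ∀ n g {K ch bs} → (∀ {bs} → Holds ch bs → K bs) → Holds (power n (chain e (gen g) v) ++ ch) bs → SemPower n g K bs
    semPower⁻ zero    g k h = k h
    semPower⁻ (suc n) g {ch = ch} {bs} k h = sem⁻ g (semPower⁻ n g k)
      (subst (λ c → Holds c bs) (++-assoc (chain e (gen g) v) (power n (chain e (gen g) v)) ch) h)

    semPower⁺ : ∀ n g {K ch bs} → (∀ {bs} → K bs → Holds ch bs) → SemPower n g K bs → Holds (power n (chain e (gen g) v) ++ ch) bs
    semPower⁺ zero    g k h = k h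
    semPower⁺ (suc n) g {ch = ch} {bs} k h =
      subst (λ c → Holds c bs) (sym (++-assoc (chain e (gen g) v) (power n (chain e (gen g) v)) ch)) (sem⁺ g (semPower⁺ n g k) h)

    -- The tags of the blocks in scope before and after the plan, innermost first.
    data Fits : List A → Plan → List A → Set where
      block  : ∀ {t ts} → Fits ts (block t) (t ∷ ts)
      check  : ∀ {r ts P} {xs : Vec Address r} → AllInScope ts 0 xs → Fits ts (check xs P) ts
      checks : ∀ {r ts P} {xs : Vec Address r} → (∀ i → i < v → AllInScope ts i xs) → Fits ts (checks xs P) ts
      _▹_    : ∀ {g h ts us ws} → Fits ts g us → Fits us h ws → Fits ts (g ▹ h) ws

    fits-context : ∀ {ts g us} ch → Fits ts g us → InContext ch us → InContext (chain e (gen g) v ++ ch) ts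
    fits-context {ts} ch block s = block-context {ch = ch} {ts} s
    fits-context ch (check {P = P} xs) s = Scoped-check P xs , s
    fits-context {ts} ch (checks {P = P} xs) s = conjs-context v {ch = ch} {ts} (λ i i<v → Scoped-check P (xs i i<v)) s
    fits-context {ts} ch (_▹_ {g} {h} f f′) s =
      subst (λ c → InContext c ts) (sym (++-assoc (chain e (gen g) v) (chain e (gen h) v) ch))
        (fits-context (chain e (gen h) v ++ ch) f (fits-context ch f′ s))

-- Configurations as columns

Finite-↔ : ∀ {A B} → A ↔ B → Finite B → Finite A
Finite-↔ f (n , g) = n , g ↔-∘ f

Finite-× : ∀ {A B} → Finite A → Finite B → Finite (A × B)
Finite-× (m , f) (n , g) = m * n , ↔-sym *↔× ↔-∘ (f ×-↔ g)

Finite-Bool : Finite Bool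
Finite-Bool = 2 , ↔-sym 2↔Bool

Finite-Maybe : ∀ {A} → Finite A → Finite (Maybe A)
Finite-Maybe fin = Finite-↔ (mk↔ₛ′ (maybe′ inj₂ (inj₁ tt)) [ (λ _ → nothing) , just ]′
  (λ where
    (inj₁ _) → refl
    (inj₂ _) → refl)
  (λ where
    nothing  → refl
    (just _) → refl)) (Finite-⊎ Finite-⊤ fin)

Finite-Symbol : ∀ {A} → Finite A → Finite (Symbol A)
Finite-Symbol {A} fin = Finite-↔ (mk↔ₛ′ to from to∘from from∘to) (Finite-⊎ Finite-⊤ (Finite-⊎ Finite-Bool fin))
  where
  to : Symbol A → ⊤ ⊎ (Bool ⊎ A)
  to blank   = inj₁ tt
  to (bit b) = inj₂ (inj₁ b)
  to (aux a) = inj₂ (inj₂ a)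

  from : ⊤ ⊎ (Bool ⊎ A) → Symbol A
  from (inj₁ _)        = blank
  from (inj₂ (inj₁ b)) = bit b
  from (inj₂ (inj₂ a)) = aux a

  to∘from : ∀ x → to (from x) ≡ x
  to∘from (inj₁ _)        = refl
  to∘from (inj₂ (inj₁ b)) = refl
  to∘from (inj₂ (inj₂ a)) = refl

  from∘to : ∀ x → from (to x) ≡ x
  from∘to blank   = refl
  from∘to (bit b) = refl
  from∘to (aux a) = refl

Finite-Vec : ∀ {A} n → Finite A → Finite (Vec A n)
Finite-Vec zero fin = Finite-↔ (mk↔ₛ′ (λ _ → tt) (λ _ → []) (λ _ → refl) (λ where [] → refl)) Finite-⊤
Finite-Vec {A} (suc n) fin = Finite-↔ (mk↔ₛ′ to from (λ _ → refl) from∘to) (Finite-× fin (Finite-Vec n fin))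
  where
  to : Vec A (suc n) → A × Vec A n
  to (x ∷ xs) = x , xs

  from : A × Vec A n → Vec A (suc n)
  from (x , xs) = x ∷ xs

  from∘to : ∀ x → from (to x) ≡ x
  from∘to (x ∷ xs) = refl

oneHot : ∀ {n} → Fin n → Vec Bool n
oneHot zero    = true ∷ replicateⱽ _ false
oneHot (suc i) = false ∷ oneHot i

fromOneHot : ∀ {n} → Vec Bool n → Maybe (Fin n)
fromOneHot []           = nothing
fromOneHot (true ∷ _)   = just zero
fromOneHot (false ∷ bs) = mapᴹ suc (fromOneHot bs)

fromOneHot-oneHot : ∀ {n} (i : Fin n) → fromOneHot (oneHot i) ≡ just i
fromOneHot-oneHot zero    = refl
fromOneHot-oneHot (suc i) = cong (mapᴹ suc) (fromOneHot-oneHot i)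

-- One bit per element is affordable, since the number of elements depends on the machine alone.
-- Decoding is total: a word without a true bit yields `default`.
module BitCode {C : Set} (fin : Finite C) (default : C) where

  #bits : ℕ
  #bits = proj₁ fin

  enc : C → Vec Bool #bits
  enc c = oneHot (Inverse.to (proj₂ fin) c)

  dec : Vec Bool #bits → C
  dec bs = fromMaybe default (mapᴹ (Inverse.from (proj₂ fin)) (fromOneHot bs))

  dec-enc : ∀ c → dec (enc c) ≡ c
  dec-enc c = trans (cong (fromMaybe default ∘ mapᴹ (Inverse.from (proj₂ fin))) (fromOneHot-oneHot (Inverse.to (proj₂ fin) c)))
    (Inverse.strictlyInverseʳ (proj₂ fin) c)

module Columns {m : ℕ} (M : TM m) where
  open TM M

  Letter : Set
  Letter = Symbol Aux

  -- Measuring distance on each tape from its own head puts all heads into column 0, so one step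
  -- stays local even when the tapes move in different directions. The state is recorded in column 0
  -- only, which also lets a column reveal whether it is that one.
  Column : Set
  Column = Maybe State × Vec (Letter × Letter) (m + #work)

  Finite-Column : Finite Column
  Finite-Column = Finite-× (Finite-Maybe finite-State)
    (Finite-Vec (m + #work) (Finite-× (Finite-Symbol finite-Aux) (Finite-Symbol finite-Aux)))

  cellAt : List Letter → ℕ → Letter
  cellAt []       _       = blank
  cellAt (x ∷ xs) zero    = x
  cellAt (x ∷ xs) (suc i) = cellAt xs i

  -- The cells at distance i from the head, on the left and on the right.
  pairAt : ℕ → Tape Aux → Letter × Letter
  pairAt zero    (tape l h r) = h , h
  pairAt (suc i) (tape l h r) = cellAt l i , cellAt r i

  column : Config M → ℕ → Column
  column (config q T) zero    = just q , mapⱽ (pairAt 0) T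
  column (config q T) (suc i) = nothing , mapⱽ (pairAt (suc i)) T

  -- The neighbour on the side of the head may be the head cell itself, which then carries the
  -- symbol just written.
  written : Bool → Letter → Letter × Letter → Letter × Letter
  written true  s p = s , s
  written false s p = p

  headPair : Letter × Direction → Letter × Letter → Letter × Letter
  headPair (s , left)  (l , r) = l , l
  headPair (s , stay)  (l , r) = s , s
  headPair (s , right) (l , r) = r , r

  -- A move brings the cells of one side closer to the head and takes those of the other side
  -- farther away, so one component comes from the outer neighbour and the other from the inner one.
  innerPair : Bool → Letter × Direction → Letter × Letter → Letter × Letter → Letter × Letter → Letter × Letter
  innerPair b (s , left)  p q r = proj₁ r , proj₂ (written b s p)
  innerPair b (s , stay)  p q r = q
  innerPair b (s , right) p q r = proj₁ (written b s p) , proj₂ r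

  is-zero? : ℕ → Bool
  is-zero? zero    = true
  is-zero? (suc _) = false

  headPair-act : ∀ a t → pairAt 0 (act a t) ≡ headPair a (pairAt 1 t)
  headPair-act (s , left)  (tape []      h r)       = refl
  headPair-act (s , left)  (tape (x ∷ l) h r)       = refl
  headPair-act (s , stay)  (tape l       h r)       = refl
  headPair-act (s , right) (tape l       h [])      = refl
  headPair-act (s , right) (tape l       h (x ∷ r)) = refl

  innerPair-act : ∀ i a t → pairAt (suc i) (act a t) ≡
                  innerPair (is-zero? i) a (pairAt i t) (pairAt (suc i) t) (pairAt (suc (suc i)) t)
  innerPair-act zero    (s , left)  (tape []      h r)       = refl
  innerPair-act zero    (s , left)  (tape (x ∷ l) h r)       = refl
  innerPair-act zero    (s , stay)  (tape l       h r)       = refl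
  innerPair-act zero    (s , right) (tape l       h [])      = refl
  innerPair-act zero    (s , right) (tape l       h (x ∷ r)) = refl
  innerPair-act (suc i) (s , left)  (tape []      h r)       = refl
  innerPair-act (suc i) (s , left)  (tape (x ∷ l) h r)       = refl
  innerPair-act (suc i) (s , stay)  (tape l       h r)       = refl
  innerPair-act (suc i) (s , right) (tape l       h [])      = refl
  innerPair-act (suc i) (s , right) (tape l       h (x ∷ r)) = refl

  headPairs : ∀ {k} → Vec (Letter × Direction) k → Vec (Letter × Letter) k → Vec (Letter × Letter) k
  headPairs []       []       = []
  headPairs (a ∷ as) (r ∷ rs) = headPair a r ∷ headPairs as rs

  innerPairs : ∀ {k} → Bool → Vec (Letter × Direction) k → (ps qs rs : Vec (Letter × Letter) k) → Vec (Letter × Letter) k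
  innerPairs b []       []       []       []       = []
  innerPairs b (a ∷ as) (p ∷ ps) (q ∷ qs) (r ∷ rs) = innerPair b a p q r ∷ innerPairs b as ps qs rs

  headPairs-act : ∀ {k} (as : Vec _ k) T → mapⱽ (pairAt 0) (zipWith act as T) ≡ headPairs as (mapⱽ (pairAt 1) T)
  headPairs-act []       []      = refl
  headPairs-act (a ∷ as) (t ∷ T) = cong₂ _∷_ (headPair-act a t) (headPairs-act as T)

  innerPairs-act : ∀ {k} i (as : Vec _ k) T → mapⱽ (pairAt (suc i)) (zipWith act as T) ≡
                   innerPairs (is-zero? i) as (mapⱽ (pairAt i) T) (mapⱽ (pairAt (suc i)) T) (mapⱽ (pairAt (suc (suc i))) T)
  innerPairs-act i []       []      = refl
  innerPairs-act i (a ∷ as) (t ∷ T) = cong₂ _∷_ (innerPair-act i a t) (innerPairs-act i as T)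

  transition : Column → Maybe (State × Vec (Letter × Direction) (m + #work))
  transition (nothing , _) = nothing
  transition (just q , ps) = δ q (mapⱽ proj₁ ps)

  -- From column 0, the left neighbour, the column itself and the right neighbour;
  -- the left neighbour of column 0 is ignored.
  nextColumn : (c₀ p q r : Column) → Column
  nextColumn c₀ p q r with transition c₀
  ... | nothing        = q
  ... | just (s , as) with proj₁ q
  ...   | just _  = just s , headPairs as (proj₂ r)
  ...   | nothing = nothing , innerPairs (is-just (proj₁ p)) as (proj₂ p) (proj₂ q) (proj₂ r)

  heads-column : ∀ {k} (T : Vec (Tape Aux) k) → mapⱽ proj₁ (mapⱽ (pairAt 0) T) ≡ mapⱽ head T
  heads-column []      = refl
  heads-column (t ∷ T) = cong (head t ∷_) (heads-column T)

  transition-column : ∀ c → transition (column c 0) ≡ next M c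
  transition-column (config q T) = cong (δ q) (heads-column T)

  nextColumn-zero : ∀ c p → nextColumn (column c 0) p (column c 0) (column c 1) ≡ column (step M c) 0
  nextColumn-zero c@(config q T) p rewrite transition-column c with next M c
  ... | nothing       = refl
  ... | just (s , as) = cong (just s ,_) (sym (headPairs-act as T))

  nextColumn-suc : ∀ c i → nextColumn (column c 0) (column c i) (column c (suc i)) (column c (suc (suc i))) ≡
                   column (step M c) (suc i)
  nextColumn-suc c@(config q T) i rewrite transition-column c with next M c
  ... | nothing       = refl
  ... | just (s , as) with i
  ...   | zero  = cong (nothing ,_) (sym (innerPairs-act zero as T))
  ...   | suc i = cong (nothing ,_) (sym (innerPairs-act (suc i) as T))

  blankColumn : Column
  blankColumn = nothing , replicateⱽ _ (blank , blank)

  SmallTape : ℕ → Tape Aux → Set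
  SmallTape v t = length (before t) ≤ v × length (after t) ≤ v

  Small : ℕ → Config M → Set
  Small v c = All (SmallTape v) (Config.tapes c)

  cellAt-beyond : ∀ xs i → length xs ≤ i → cellAt xs i ≡ blank
  cellAt-beyond []       i       p       = refl
  cellAt-beyond (x ∷ xs) (suc i) (s≤s p) = cellAt-beyond xs i p

  -- The reason why column `v + 1`, which has no right neighbour in its block, can simply be
  -- required to be blank.
  column-beyond : ∀ {v} c → Small v c → column c (suc v) ≡ blankColumn
  column-beyond {v} (config q T) small = cong (nothing ,_) (go small)
    where
    go : ∀ {k} {T : Vec (Tape Aux) k} → All (SmallTape v) T → mapⱽ (pairAt (suc v)) T ≡ replicateⱽ k (blank , blank)
    go []            = refl
    go {T = t ∷ _} ((p , q) ∷ s) = cong₂ _∷_ (cong₂ _,_ (cellAt-beyond (before t) v p) (cellAt-beyond (after t) v q)) (go s)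

  letter : Maybe Bool → Letter
  letter nothing  = blank
  letter (just b) = bit b

  startPair : Bool → Maybe Bool → Letter × Letter
  startPair true  b = letter b , letter b
  startPair false b = blank , letter b

  pairAt-fromWord : ∀ i w → pairAt i (fromWord w) ≡ startPair (is-zero? i) (w !? i)
  pairAt-fromWord zero    []      = refl
  pairAt-fromWord zero    (b ∷ w) = refl
  pairAt-fromWord (suc i) []      = refl
  pairAt-fromWord (suc i) (b ∷ w) = cong (blank ,_) (go w i)
    where
    go : ∀ w i → cellAt (mapᴸ bit w) i ≡ letter (w !? i)
    go []      i       = refl
    go (b ∷ w) zero    = refl
    go (b ∷ w) (suc i) = go w i

  startColumn : Bool → Vec (Maybe Bool) m → Column
  startColumn first bs =
    (if first then just start else nothing) , mapⱽ (startPair first) bs ++ⱽ replicateⱽ #work (startPair first nothing)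

  pairs-initial : ∀ (ws : Vec Word m) i → mapⱽ (pairAt i) (mapⱽ fromWord ws ++ⱽ replicateⱽ #work (fromWord [])) ≡
                  mapⱽ (startPair (is-zero? i)) (mapⱽ (_!? i) ws) ++ⱽ replicateⱽ #work (startPair (is-zero? i) nothing)
  pairs-initial ws i = trans (map-++ (pairAt i) (mapⱽ fromWord ws) _)
    (cong₂ _++ⱽ_ (trans (sym (map-∘ (pairAt i) fromWord ws)) (trans (map-cong (pairAt-fromWord i) ws) (map-∘ _ _ ws)))
      (trans (map-replicate (pairAt i) (fromWord []) #work) (cong (replicateⱽ #work) (pairAt-fromWord i []))))

  column-initial : ∀ ws i → column (initial M ws) i ≡ startColumn (is-zero? i) (mapⱽ (_!? i) ws)
  column-initial ws zero    = cong (just start ,_) (pairs-initial ws zero)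
  column-initial ws (suc i) = cong (nothing ,_) (pairs-initial ws (suc i))

  acceptingColumn : Column → Bool
  acceptingColumn (nothing , _) = false
  acceptingColumn (just q , _)  = accepting q

-- Tests on blocks that encode configurations

same : ∀ {n} → Vec Bool n → Vec Bool n → Bool
same x y = does (≡-dec Bool._≟_ x y)

same⁻ : ∀ {n} (x y : Vec Bool n) → same x y ≡ true → x ≡ y
same⁻ x y e with yes x≡y ← ≡-dec Bool._≟_ x y = x≡y

same⁺ : ∀ {n} {x y : Vec Bool n} → x ≡ y → same x y ≡ true
same⁺ {x = x} {y} = dec-true (≡-dec Bool._≟_ x y)

-- The second summand holds one symbol of the input and one of the guess.
Cell : ∀ {m} → TM m → Set
Cell M = Columns.Column M ⊎ (Maybe Bool × Maybe Bool)

snoc-!? : ∀ (xs : List Z) {z} x {y} → (xs ++ [ z ]) !? x ≡ just y → xs !? x ≡ just y ⊎ (x ≡ length xs × z ≡ y)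
snoc-!? []       zero    refl = inj₂ (refl , refl)
snoc-!? (x ∷ xs) zero    e    = inj₁ e
snoc-!? (_ ∷ xs) (suc x) e with snoc-!? xs x e
... | inj₁ e′         = inj₁ e′
... | inj₂ (e₁ , e₂) = inj₂ (cong suc e₁ , e₂)

snoc-last : ∀ (xs : List Z) {z n} → n ≡ length xs → (xs ++ [ z ]) !? n ≡ just z
snoc-last []       refl = refl
snoc-last (_ ∷ xs) refl = snoc-last xs refl

snoc-init : ∀ (xs : List Z) {z} x {y} → xs !? x ≡ just y → (xs ++ [ z ]) !? x ≡ just y
snoc-init (_ ∷ xs) zero    e = e
snoc-init (_ ∷ xs) (suc x) e = snoc-init xs x e

-- The code of cells is a parameter, and the only fact about it is `dec-enc`; codes that decode to
-- nothing sensible do no harm, because tests compare a column with the code that it should be.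
module Encoding {m : ℕ} (M : TM m) (pick : Vec Bool m) {A : Set} (a : A) (kind : A → Quantifier) (kind-a : kind a ≡ ex)
  {e : ℕ} (enc : Cell M → Vec Bool e) (dec : Vec Bool e → Cell M) (dec-enc : ∀ c → dec (enc c) ≡ c) where
  open TM M
  open Columns M
  open Blocks {A} a e public

  decColumn : Bits → Column
  decColumn x with dec x
  ... | inj₁ c = c
  ... | inj₂ _ = blankColumn

  decWords : Bits → Maybe Bool × Maybe Bool
  decWords x with dec x
  ... | inj₁ _ = nothing , nothing
  ... | inj₂ w = w

  encColumn : Column → Bits
  encColumn c = enc (inj₁ c)

  decColumn-enc : ∀ c → decColumn (encColumn c) ≡ c
  decColumn-enc c rewrite dec-enc (inj₁ c) = refl

  decWords-enc : ∀ w → decWords (enc (inj₂ w)) ≡ w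
  decWords-enc w rewrite dec-enc (inj₂ w) = refl

  -- pick tells which input tapes receive the input; the others receive the guess.
  choice : Z → Z → Vec Z m
  choice z y = mapⱽ (λ b → if b then z else y) pick

  map-choice : ∀ (f : Y → Z) x y → mapⱽ f (choice x y) ≡ choice (f x) (f y)
  map-choice f x y = trans (sym (map-∘ f _ pick)) (map-cong (λ b → Bool.if-float f b) pick)

  -- Columns `c`, `c + i` and `c + v`. A family of tests ranges over `i < v`, so the remaining
  -- columns are tested one by one.
  firstCol innerCol endCol : ℕ → ℕ → Address
  firstCol β c = address a β (affine 0 0 c)
  innerCol β c = address a β (affine 0 1 c)
  endCol   β c = address a β (affine 1 0 c)

  wordAt : Vec Address 1
  wordAt = innerCol 1 0 ∷ []

  stepTest : Vec Bits 5 → Bool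
  stepTest (c₀ ∷ p ∷ q ∷ r ∷ n ∷ []) = same n (encColumn (nextColumn (decColumn c₀) (decColumn p) (decColumn q) (decColumn r)))

  blankTest : Vec Bits 1 → Bool
  blankTest (n ∷ []) = same n (encColumn blankColumn)

  -- The old configuration is at depth 1 and the new one at depth 0. The three tests cover column 0,
  -- columns 1 to `v`, and column `v + 1`.
  stepPlan : Plan
  stepPlan = check (firstCol 1 0 ∷ firstCol 1 0 ∷ firstCol 1 0 ∷ firstCol 1 1 ∷ firstCol 0 0 ∷ []) stepTest
    ▹ checks (firstCol 1 0 ∷ innerCol 1 0 ∷ innerCol 1 1 ∷ innerCol 1 2 ∷ innerCol 0 1 ∷ []) stepTest
    ▹ check (endCol 0 1 ∷ []) blankTest

  acceptTest : Vec Bits 1 → Bool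
  acceptTest (c₀ ∷ []) = acceptingColumn (decColumn c₀)

  acceptPlan : Plan
  acceptPlan = check (firstCol 0 0 ∷ []) acceptTest

  startBits : Bool → Maybe Bool × Maybe Bool → Bits
  startBits first (z , y) = encColumn (startColumn first (choice z y))

  startTest : Bool → Vec Bits 2 → Bool
  startTest first (u ∷ c ∷ []) = same c (startBits first (decWords u))

  -- No symbol may follow a gap. Together with one cell known to be empty, this makes a row of cells
  -- spell a word.
  ends : Maybe Bool → Maybe Bool → Bool
  ends nothing  (just _) = false
  ends nothing  nothing  = true
  ends (just _) _        = true

  endsTest : Vec Bits 2 → Bool
  endsTest (u ∷ u′ ∷ []) = ends (proj₁ (decWords u)) (proj₁ (decWords u′)) ∧ᵇ ends (proj₂ (decWords u)) (proj₂ (decWords u′))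

  inputEndTest guessEndTest : Vec Bits 1 → Bool
  inputEndTest (u ∷ []) = is-nothing (proj₁ (decWords u))
  guessEndTest (u ∷ []) = is-nothing (proj₂ (decWords u))

  is-bit : Bool → Maybe Bool → Bool
  is-bit b nothing  = false
  is-bit b (just c) = agrees b c

  inputTest : Bool → Vec Bits 1 → Bool
  inputTest b (u ∷ []) = is-bit b (proj₁ (decWords u))

  -- Depth 1 holds the words and depth 0 the configuration that must be initial for them. `endsTest`
  -- compares neighbouring columns and so runs over one position fewer than `startTest`.
  startPlan : Plan
  startPlan = check (firstCol 1 0 ∷ firstCol 0 0 ∷ []) (startTest true)
    ▹ checks (innerCol 1 1 ∷ innerCol 0 1 ∷ []) (startTest false)
    ▹ check (endCol 1 1 ∷ endCol 0 1 ∷ []) (startTest false)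
    ▹ checks (innerCol 1 0 ∷ innerCol 1 1 ∷ []) endsTest
    ▹ check (endCol 1 0 ∷ endCol 1 1 ∷ []) endsTest

  module NPPlans where

    layer extra : Plan
    layer = block a ▹ stepPlan
    -- A trivial test, as there is no empty plan.
    extra = check [] (λ _ → true)

  module PSPACEPlans (b : A) where

    selects : Bits → Bool
    selects x = is-just (proj₁ (decWords x))

    -- The universal choice s in Savitch's recursion: (a , a′) is either half (c , m) or (m , c′).
    copyTest : Vec Bits 6 → Bool
    copyTest (s ∷ a′ ∷ a ∷ m ∷ c′ ∷ c ∷ []) = if selects s then same a c ∧ᵇ same a′ m else same a m ∧ᵇ same a′ c′

    copyAddresses : (ℕ → Address) → Vec Address 6
    copyAddresses f = address b 2 (affine 0 0 0) ∷ f 0 ∷ f 1 ∷ f 3 ∷ f 4 ∷ f 5 ∷ []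

    copyPlan layer extra : Plan
    copyPlan = checks (copyAddresses (λ β → innerCol β 0)) copyTest
      ▹ check (copyAddresses (λ β → endCol β 0)) copyTest
      ▹ check (copyAddresses (λ β → endCol β 1)) copyTest
    -- The midpoint, the selector, then fresh ends for the chosen half. Copying puts the new ends at
    -- depths 0 and 1, where the next layer expects them, so all layers have the same text and the
    -- recursion never duplicates a subformula.
    layer = block a ▹ block b ▹ block a ▹ block a ▹ copyPlan
    -- The guess of an accepting configuration, the far end of the run that the layers halve.
    extra = block a ▹ acceptPlan

  spec : (coeffsV coeffsQ : List ℕ) (mid layer post : Plan) → Spec A
  spec pV pQ mid layer post = record
    { columnBits = e
    ; coeffsV = pV
    ; coeffsQ = pQ
    ; pre = gen (block a ▹ block a)
    ; mid = gen mid
    ; layer = gen layer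
    ; post = gen post
    ; inputEnd = checkT wordAt inputEndTest
    ; guessEnd = checkT wordAt guessEndTest
    ; input = λ b → checkT wordAt (inputTest b)
    ; matrix = constant true
    }

  -- Meaning of the tests on encoded configurations

  module Size (v : ℕ) where
    open Sized kind v

    Env : Set
    Env = List Block

    private
      N : ℕ
      N = 2 + v

    block⁻ : ∀ {K : Env → Set} {bs} → Sem (block a) K bs → Σ[ b ∈ Block ] K (b ∷ bs)
    block⁻ {K} {bs} = subst (λ q → SemBlock q K bs) kind-a

    block⁺ : ∀ {K : Env → Set} {bs} b → K (b ∷ bs) → Sem (block a) K bs
    block⁺ {K} {bs} b h = subst (λ q → SemBlock q K bs) (sym kind-a) (b , h)

    Enc : Config M → Block
    Enc c = tabulate λ i → encColumn (column c (toℕ i))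

    encWords : Word → Word → Block
    encWords w y = tabulate λ i → enc (inj₂ (w !? toℕ i , y !? toℕ i))

    nth-tabulate : ∀ {n} (f : ℕ → Bits) x → x < n → nth {n} (tabulate (f ∘ toℕ)) x ≡ f x
    nth-tabulate f zero    (s≤s _) = refl
    nth-tabulate f (suc x) (s≤s p) = nth-tabulate (f ∘ suc) x p

    nth-Enc : ∀ c {x} → x < N → nth (Enc c) x ≡ encColumn (column c x)
    nth-Enc c p = nth-tabulate (λ x → encColumn (column c x)) _ p

    Enc-≡ : ∀ {c} (b : Block) → (∀ x → x < N → nth b x ≡ encColumn (column c x)) → b ≡ Enc c
    Enc-≡ {c} b h = nth-ext b (Enc c) λ x p → trans (h x p) (sym (nth-Enc c p))

    inner≡ : ∀ β c bs i → columnAt bs i (innerCol β c) ≡ col bs β (c + i)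
    inner≡ β c bs i = cong (col bs β) (value-i v i c)

    end≡ : ∀ β c bs i → columnAt bs i (endCol β c) ≡ col bs β (c + v)
    end≡ β c bs i = cong (col bs β) (value-v v i c)

    zeroth : ∀ b (bs : Env) {x} → x < N → col (b ∷ bs) 0 x ≡ nth b x
    zeroth = col-zero

    first : ∀ b c (bs : Env) {x} → x < N → col (b ∷ c ∷ bs) 1 x ≡ nth c x
    first b c bs {x} p = trans (col-suc b (c ∷ bs) 0 x) (col-zero c bs p)

    0<N : 0 < N
    0<N = s≤s z≤n

    1<N : 1 < N
    1<N = s≤s (s≤s z≤n)

    inner< : ∀ {i} c → c ≤ 2 → i < v → c + i < N
    inner< {i} c c≤2 i<v = ≤-<-trans (+-monoˡ-≤ i c≤2) (+-monoʳ-< 2 i<v)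

    ≤v⇒<N : ∀ {x} → x ≤ v → x < N
    ≤v⇒<N p = m<n⇒m<1+n (s≤s p)

    stepTest-≡ : ∀ {x₀ x y z w C₀ C D E n R} → decColumn x₀ ≡ C₀ → decColumn x ≡ C → decColumn y ≡ D → decColumn z ≡ E →
                 w ≡ n → nextColumn C₀ C D E ≡ R → stepTest (x₀ ∷ x ∷ y ∷ z ∷ w ∷ []) ≡ same n (encColumn R)
    stepTest-≡ refl refl refl refl refl refl = refl

    module _ (y : Block) (c : Config M) (bs : Env) where

      private
        env : Env
        env = y ∷ Enc c ∷ bs

        old : ∀ {x} → x < N → decColumn (col env 1 x) ≡ column c x
        old {x} p = trans (cong decColumn (trans (first y (Enc c) bs p) (nth-Enc c p))) (decColumn-enc (column c x))

        oldAt : ∀ i k → k ≤ 2 → i < v → decColumn (columnAt env i (innerCol 1 k)) ≡ column c (k + i)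
        oldAt i k k≤2 i<v = trans (cong decColumn (inner≡ 1 k env i)) (old (inner< k k≤2 i<v))

        firstStep : stepTest (mapⱽ (columnAt env 0) (firstCol 1 0 ∷ firstCol 1 0 ∷ firstCol 1 0 ∷ firstCol 1 1 ∷ firstCol 0 0 ∷ []))
                    ≡ same (nth y 0) (encColumn (column (step M c) 0))
        firstStep = stepTest-≡ (old 0<N) refl (old 0<N) (old 1<N) (zeroth y (Enc c ∷ bs) 0<N) (nextColumn-zero c _)

        innerStep : ∀ i → i < v → stepTest (mapⱽ (columnAt env i)
                      (firstCol 1 0 ∷ innerCol 1 0 ∷ innerCol 1 1 ∷ innerCol 1 2 ∷ innerCol 0 1 ∷ []))
                    ≡ same (nth y (suc i)) (encColumn (column (step M c) (suc i)))
        innerStep i i<v = stepTest-≡ (old 0<N) (oldAt i 0 z≤n i<v) (oldAt i 1 (s≤s z≤n) i<v) (oldAt i 2 ≤-refl i<v)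
          (trans (inner≡ 0 1 env i) (zeroth y (Enc c ∷ bs) (inner< 1 (s≤s z≤n) i<v))) (nextColumn-suc c i)

        lastStep : Small v (step M c) → blankTest (mapⱽ (columnAt env 0) (endCol 0 1 ∷ []))
                   ≡ same (nth y (suc v)) (encColumn (column (step M c) (suc v)))
        lastStep s = cong₂ (λ b d → same b (encColumn d)) (trans (end≡ 0 1 env 0) (zeroth y (Enc c ∷ bs) ≤-refl)) (sym (column-beyond (step M c) s))

      step⁻ : ∀ {K : Env → Set} → Small v (step M c) → Sem stepPlan K env → y ≡ Enc (step M c) × K env
      step⁻ s (p , q , r , k) = Enc-≡ y columns , k
        where
        columns : ∀ x → x < N → nth y x ≡ encColumn (column (step M c) x)
        columns zero    _       = same⁻ _ _ (trans (sym firstStep) p)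
        columns (suc x) (s≤s l) with m≤n⇒m<n∨m≡n (≤-pred l)
        ... | inj₁ x<v  = same⁻ _ _ (trans (sym (innerStep x x<v)) (q x x<v))
        ... | inj₂ refl = same⁻ _ _ (trans (sym (lastStep s)) r)

      step⁺ : ∀ {K : Env → Set} → Small v (step M c) → y ≡ Enc (step M c) → K env → Sem stepPlan K env
      step⁺ s eq k = trans firstStep (column-same 0<N) , (λ i i<v → trans (innerStep i i<v) (column-same (≤v⇒<N i<v))) ,
        trans (lastStep s) (column-same ≤-refl) , k
        where
        column-same : ∀ {x} → x < N → same (nth y x) (encColumn (column (step M c) x)) ≡ true
        column-same {x} p = same⁺ (trans (cong (λ b → nth b x) eq) (nth-Enc (step M c) p))

    accept≡ : ∀ c (bs : Env) → acceptTest (mapⱽ (columnAt (Enc c ∷ bs) 0) (firstCol 0 0 ∷ [])) ≡ accepting (Config.state c)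
    accept≡ c bs = cong acceptingColumn (trans (cong decColumn (trans (zeroth (Enc c) bs 0<N) (nth-Enc c 0<N)))
      (decColumn-enc (column c 0)))

    accept⁻ : ∀ c bs {K : Env → Set} → Sem acceptPlan K (Enc c ∷ bs) → Accepting M c × K (Enc c ∷ bs)
    accept⁻ c bs (p , k) = trans (sym (accept≡ c bs)) p , k

    accept⁺ : ∀ c bs {K : Env → Set} → Accepting M c → K (Enc c ∷ bs) → Sem acceptPlan K (Enc c ∷ bs)
    accept⁺ c bs p k = trans (accept≡ c bs) p , k

    ends⁻ : ∀ {y z} → ends y z ≡ true → y ≡ nothing → z ≡ nothing
    ends⁻ {nothing} {nothing} e refl = refl

    ends-!? : ∀ w i → ends (w !? i) (w !? suc i) ≡ true
    ends-!? []          i       = refl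
    ends-!? (b ∷ [])    zero    = refl
    ends-!? (b ∷ c ∷ w) zero    = refl
    ends-!? (b ∷ w)     (suc i) = ends-!? w i

    !?-length : ∀ (w : Word) {i} → length w ≤ i → w !? i ≡ nothing
    !?-length []      p       = refl
    !?-length (b ∷ w) (s≤s p) = !?-length w p

    is-nothing⁻ : ∀ {y : Maybe Bool} → is-nothing y ≡ true → y ≡ nothing
    is-nothing⁻ {nothing} _ = refl

    is-bit⁻ : ∀ b {y} → is-bit b y ≡ true → y ≡ just b
    is-bit⁻ true  {just true}  e = refl
    is-bit⁻ false {just false} e = refl

    is-bit⁺ : ∀ b → is-bit b (just b) ≡ true
    is-bit⁺ true  = refl
    is-bit⁺ false = refl

    stays-empty : ∀ n (y : ℕ → Maybe Bool) → (∀ i → i < n → y i ≡ nothing → y (suc i) ≡ nothing) →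
                  y 0 ≡ nothing → ∀ i → i ≤ n → y i ≡ nothing
    stays-empty n y h e zero    _ = e
    stays-empty n y h e (suc i) p = h i p (stays-empty n y h e i (≤-trans (n≤1+n i) p))

    -- The word ends at the first empty cell. As cell `q` is empty, that happens at `q` or before,
    -- which bounds the length of the word.
    spelled : ∀ n (y : ℕ → Maybe Bool) q → q ≤ n → (∀ i → i < n → y i ≡ nothing → y (suc i) ≡ nothing) → y q ≡ nothing →
              Σ[ w ∈ Word ] (length w ≤ q × (∀ i → i ≤ n → y i ≡ w !? i))
    spelled n y zero    q≤n h e = [] , z≤n , stays-empty n y h e
    spelled (suc n) y (suc q) (s≤s q≤n) h e with y 0 in e₀
    ... | nothing = [] , z≤n , stays-empty (suc n) y h e₀
    ... | just b with w , l , f ← spelled n (y ∘ suc) q q≤n (λ i p → h (suc i) (s≤s p)) e =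
      b ∷ w , s≤s l , λ where
        zero    _       → e₀
        (suc i) (s≤s p) → f i p

    agrees-with : ∀ n (z : ℕ → Maybe Bool) w → (∀ i → i < n → z i ≡ nothing → z (suc i) ≡ nothing) → length w ≤ n →
                  (∀ x b → w !? x ≡ just b → z x ≡ just b) → z (length w) ≡ nothing → ∀ i → i ≤ n → z i ≡ w !? i
    agrees-with n       z []      h l f e i       p       = stays-empty n z h e i p
    agrees-with (suc n) z (b ∷ w) h l f e zero    p       = f 0 b refl
    agrees-with (suc n) z (b ∷ w) h (s≤s l) f e (suc i) (s≤s p) =
      agrees-with n (z ∘ suc) w (λ i q → h (suc i) (s≤s q)) l (f ∘ suc) e i p

    InputTests : Word → Env → Set
    InputTests w bs = ∀ x b → w !? x ≡ just b → Passes x wordAt (inputTest b) bs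

    module _ (u c : Block) (bs : Env) where

      private
        env : Env
        env = c ∷ u ∷ bs

        inputs⇐ guesses⇐ : ℕ → Maybe Bool
        inputs⇐ x  = proj₁ (decWords (nth u x))
        guesses⇐ x = proj₂ (decWords (nth u x))

        atInner : ∀ i k → k + i < N → columnAt env i (innerCol 1 k) ≡ nth u (k + i)
        atInner i k p = trans (inner≡ 1 k env i) (first c u bs p)

        atInner₀ : ∀ i k → k + i < N → columnAt env i (innerCol 0 k) ≡ nth c (k + i)
        atInner₀ i k p = trans (inner≡ 0 k env i) (zeroth c (u ∷ bs) p)

        atEnd : ∀ i k → k + v < N → columnAt env i (endCol 1 k) ≡ nth u (k + v)
        atEnd i k p = trans (end≡ 1 k env i) (first c u bs p)

        atEnd₀ : ∀ i k → k + v < N → columnAt env i (endCol 0 k) ≡ nth c (k + v)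
        atEnd₀ i k p = trans (end≡ 0 k env i) (zeroth c (u ∷ bs) p)

        start≡ : ∀ {b x y x′ y′} → x ≡ x′ → y ≡ y′ → startTest b (x ∷ y ∷ []) ≡ startTest b (x′ ∷ y′ ∷ [])
        start≡ refl refl = refl

        ends≡ : ∀ {x y x′ y′} → x ≡ x′ → y ≡ y′ → endsTest (x ∷ y ∷ []) ≡ endsTest (x′ ∷ y′ ∷ [])
        ends≡ refl refl = refl

      StartsAt : ℕ → Set
      StartsAt x = startTest (is-zero? x) (nth u x ∷ nth c x ∷ []) ≡ true

      EndsAt : ℕ → Set
      EndsAt x = endsTest (nth u x ∷ nth u (suc x) ∷ []) ≡ true

      start⁻ : ∀ {K : Env → Set} → Sem startPlan K env → (∀ x → x < N → StartsAt x) × (∀ x → x ≤ v → EndsAt x) × K env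
      start⁻ {K} (p , q , r , s , t , k) = starts , ending , k
        where
        starts : ∀ x → x < N → StartsAt x
        starts zero    _       = trans (sym (start≡ {true} (first c u bs 0<N) (zeroth c (u ∷ bs) 0<N))) p
        starts (suc x) (s≤s l) with m≤n⇒m<n∨m≡n (≤-pred l)
        ... | inj₁ x<v  = trans (sym (start≡ {false} (atInner x 1 (≤v⇒<N x<v)) (atInner₀ x 1 (≤v⇒<N x<v)))) (q x x<v)
        ... | inj₂ refl = trans (sym (start≡ {false} (atEnd 0 1 ≤-refl) (atEnd₀ 0 1 ≤-refl))) r

        ending : ∀ x → x ≤ v → EndsAt x
        ending x x≤v with m≤n⇒m<n∨m≡n x≤v
        ... | inj₁ x<v  = trans (sym (ends≡ (atInner x 0 (≤v⇒<N (<⇒≤ x<v))) (atInner x 1 (≤v⇒<N x<v)))) (s x x<v)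
        ... | inj₂ refl = trans (sym (ends≡ (atEnd 0 0 (≤v⇒<N ≤-refl)) (atEnd 0 1 ≤-refl))) t

      start⁺ : ∀ {K : Env → Set} → (∀ x → x < N → StartsAt x) → (∀ x → x ≤ v → EndsAt x) → K env → Sem startPlan K env
      start⁺ starts ending k =
        trans (start≡ {true} (first c u bs 0<N) (zeroth c (u ∷ bs) 0<N)) (starts 0 0<N) ,
        (λ x x<v → let p = ≤v⇒<N x<v in trans (start≡ {false} (atInner x 1 p) (atInner₀ x 1 p)) (starts (suc x) p)) ,
        trans (start≡ {false} (atEnd 0 1 ≤-refl) (atEnd₀ 0 1 ≤-refl)) (starts (suc v) ≤-refl) ,
        (λ x x<v → trans (ends≡ (atInner x 0 (≤v⇒<N (<⇒≤ x<v))) (atInner x 1 (≤v⇒<N x<v))) (ending x (<⇒≤ x<v))) ,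
        trans (ends≡ (atEnd 0 0 (≤v⇒<N ≤-refl)) (atEnd 0 1 ≤-refl)) (ending v ≤-refl) ,
        k

      WordTests : Word → ℕ → Set
      WordTests w q = Passes (length w) wordAt inputEndTest env ×
                      InputTests w env ×
                      Passes q wordAt guessEndTest env

      private
        atWord : ∀ x → x < N → columnAt env x (innerCol 1 0) ≡ nth u x
        atWord x = atInner x 0

        !?-just : ∀ (w : Word) x {b} → w !? x ≡ just b → x < length w
        !?-just (b ∷ w) zero    e = s≤s z≤n
        !?-just (b ∷ w) (suc x) e = s≤s (!?-just w x e)

      -- The input row is forced to be `w` by its bits and its end. The guess row is free up to
      -- length `q`, and `y` is read off from it.
      words⁻ : ∀ {w q} → length w ≤ v → q ≤ v → WordTests w q → (∀ x → x < N → StartsAt x) → (∀ x → x ≤ v → EndsAt x) →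
               Σ[ y ∈ Word ] (length y ≤ q × c ≡ Enc (initial M (choice w y)))
      words⁻ {w} {q} n≤v q≤v (p , f , e) starts ending
        with y , l , g ← spelled (suc v) guesses⇐ q (m≤n⇒m≤1+n q≤v)
               (λ i i≤v → ends⁻ (proj₂ (∧-true {ends (inputs⇐ i) (inputs⇐ (suc i))} (ending i (≤-pred i≤v)))))
               (is-nothing⁻ (trans (sym (cong (is-nothing ∘ proj₂ ∘ decWords) (atWord q (≤v⇒<N q≤v)))) e)) =
        y , l , Enc-≡ c columns
        where
        h : ∀ i → i ≤ suc v → inputs⇐ i ≡ w !? i
        h = agrees-with (suc v) inputs⇐ w
              (λ i i≤v → ends⁻ (proj₁ (∧-true (ending i (≤-pred i≤v))))) (m≤n⇒m≤1+n n≤v)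
              (λ x b x≡b → is-bit⁻ b (trans (sym (cong (is-bit b ∘ proj₁ ∘ decWords)
                (atWord x (≤v⇒<N (≤-trans (<⇒≤ (!?-just w x x≡b)) n≤v))))) (f x b x≡b)))
              (is-nothing⁻ (trans (sym (cong (is-nothing ∘ proj₁ ∘ decWords) (atWord (length w) (≤v⇒<N n≤v)))) p))

        columns : ∀ x → x < N → nth c x ≡ encColumn (column (initial M (choice w y)) x)
        columns x l = trans (same⁻ _ _ (starts x l)) (cong encColumn
          (trans (cong₂ (λ b d → startColumn (is-zero? x) (choice b d)) (h x (≤-pred l)) (g x (≤-pred l)))
            (trans (cong (startColumn (is-zero? x)) (sym (map-choice (_!? x) w y))) (sym (column-initial (choice w y) x)))))

      words⁺ : ∀ {w y q} → length w ≤ v → length y ≤ q → q ≤ v → u ≡ encWords w y → c ≡ Enc (initial M (choice w y)) →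
               WordTests w q × (∀ x → x < N → StartsAt x) × (∀ x → x ≤ v → EndsAt x)
      words⁺ {w} {y} {q} n≤v l q≤v refl refl =
        (trans (cong is-nothing (trans (cong (proj₁ ∘ decWords) (atWord (length w) (≤v⇒<N n≤v)))
           (trans (cong proj₁ (words (≤v⇒<N n≤v))) (!?-length w ≤-refl)))) refl ,
         (λ x b e → let x<N = ≤v⇒<N (≤-trans (<⇒≤ (!?-just w x e)) n≤v) in
            trans (cong (is-bit b) (trans (cong (proj₁ ∘ decWords) (atWord x x<N)) (trans (cong proj₁ (words x<N)) e))) (is-bit⁺ b)) ,
         trans (cong is-nothing (trans (cong (proj₂ ∘ decWords) (atWord q (≤v⇒<N q≤v)))
           (trans (cong proj₂ (words (≤v⇒<N q≤v))) (!?-length y l)))) refl) ,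
        (λ x p → same⁺ (trans (nth-Enc (initial M (choice w y)) p) (cong encColumn
          (trans (column-initial (choice w y) x) (cong (startColumn (is-zero? x))
            (trans (map-choice (_!? x) w y) (cong (λ d → choice (proj₁ d) (proj₂ d)) (sym (words p)))))))) ) ,
        (λ x p → ∧-intro (trans (cong₂ (λ d d′ → ends (proj₁ d) (proj₁ d′)) (words (≤v⇒<N p)) (words (s≤s (s≤s p)))) (ends-!? w x))
                         (trans (cong₂ (λ d d′ → ends (proj₂ d) (proj₂ d′)) (words (≤v⇒<N p)) (words (s≤s (s≤s p)))) (ends-!? y x)))
        where
        words : ∀ {x} → x < N → decWords (nth (encWords w y) x) ≡ (w !? x , y !? x)
        words {x} p = trans (cong decWords (nth-tabulate (λ i → enc (inj₂ (w !? i , y !? i))) x p)) (decWords-enc _)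

    Small-run : ∀ {c} s → (∀ t → Small v (run M t c)) → ∀ t → Small v (run M t (run M s c))
    Small-run {c} s small t = subst (Small v) (run-+ M s t c) (small (s + t))

    module _ (pV pQ : List ℕ) (extra layer post : Plan) where

      private
        sp : Spec A
        sp = spec pV pQ (startPlan ▹ extra) layer post

        W : ℕ
        W = blockSize e v

        ⊤′ : Env → Set
        ⊤′ _ = ⊤

      Tail : Env → Set
      Tail = Sem extra (SemPower W layer (Sem post ⊤′))

      layersChain tailChain : Chain A
      layersChain = power W (chain e (gen layer) v) ++ chain e (gen post) v
      tailChain = chain e (gen extra) v ++ layersChain

      inputs⁻ : ∀ k {ch bs} → Holds (inputs sp v k ++ ch) bs → InputTests (reverse k) bs × Holds ch bs
      inputs⁻ []      h = (λ _ _ ()) , h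
      inputs⁻ (b ∷ k) {ch} {bs} h
        with p , h ← pass⁻ (length k) wordAt (inputTest b) (inputs sp v k ++ ch) bs h
        with f , h ← inputs⁻ k {ch} {bs} h = g , h
        where
        g : InputTests (reverse (b ∷ k)) bs
        g x b′ e with snoc-!? (reverse k) x (subst (λ l → l !? x ≡ just b′) (unfold-reverse b k) e)
        ... | inj₁ e′            = f x b′ e′
        -- The bit at the bottom of the recursion is the last one of the reversed stack, at position
        -- `length k`.
        ... | inj₂ (refl , refl) =
          subst (λ x → Passes x wordAt (inputTest b) bs) (sym (length-reverse k)) p

      inputs⁺ : ∀ k {ch bs} → InputTests (reverse k) bs → Holds ch bs → Holds (inputs sp v k ++ ch) bs
      inputs⁺ []      f h = h
      inputs⁺ (b ∷ k) {ch} {bs} f h = pass⁺ (length k) wordAt (inputTest b) (inputs sp v k ++ ch) bs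
        (f (length k) b (trans (cong (_!? length k) (unfold-reverse b k)) (snoc-last (reverse k) (sym (length-reverse k)))))
        (inputs⁺ k {ch} {bs} (λ x b′ e → f x b′ (trans (cong (_!? x) (unfold-reverse b k)) (snoc-init (reverse k) x e))) h)

      tail⁻ : ∀ {bs} → Holds tailChain bs → Tail bs
      tail⁻ {bs} h = sem⁻ extra (semPower⁻ W layer λ {cs} h → sem⁻ post {ch = []} {cs} (λ _ → tt)
        (subst (λ c → Holds c cs) (sym (++-identityʳ (chain e (gen post) v))) h)) h

      tail⁺ : ∀ {bs} → Tail bs → Holds tailChain bs
      tail⁺ {bs} h = sem⁺ extra (semPower⁺ W layer λ {cs} h →
        subst (λ c → Holds c cs) (++-identityʳ (chain e (gen post) v))
          (sem⁺ post {ch = []} {cs} (λ {ds} _ → truth-constant true 0 (flats ds)) h)) h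

      midChain : Chain A
      midChain = chain e (gen (startPlan ▹ extra)) v ++ layersChain

      guessChain : ℕ → Chain A
      guessChain q = conj (inst v q (checkT wordAt guessEndTest)) ∷ midChain

      wordChain : ℕ → Word → Chain A
      wordChain q w = conj (inst v (length w) (checkT wordAt inputEndTest)) ∷ inputs sp v (reverse w) ++ guessChain q

      whole⁻ : ∀ {q} w → length w ≤ v → q ≤ v → truth kind (whole sp v q w) [] ≡ true →
               Σ[ y ∈ Word ] Σ[ u ∈ Block ] (length y ≤ q × Tail (Enc (initial M (choice w y)) ∷ u ∷ []))
      whole⁻ {q} w n≤v q≤v h =
        let u , h₁             = block⁻ {Sem (block a) (Holds (wordChain q w))} {[]}
                                   (sem⁻ (block a ▹ block a) {Holds (wordChain q w)} {wordChain q w} {[]} (λ h → h) h)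
            c , h₂             = block⁻ {Holds (wordChain q w)} {u ∷ []} h₁
            p , h₃             = pass⁻ (length w) wordAt inputEndTest (inputs sp v (reverse w) ++ guessChain q) (c ∷ u ∷ []) h₂
            f , h₄             = inputs⁻ (reverse w) {guessChain q} {c ∷ u ∷ []} h₃
            r , h₅             = pass⁻ q wordAt guessEndTest midChain (c ∷ u ∷ []) h₄
            starts , ending , k = start⁻ u c [] {Tail} (sem⁻ startPlan {Tail} {tailChain} {c ∷ u ∷ []} (λ {bs} → tail⁻ {bs}) (mid⁻ c u h₅))
            y , l , c≡         = words⁻ u c [] {w} {q} n≤v q≤v
              (p , subst (λ w → InputTests w (c ∷ u ∷ [])) (reverse-involutive w) f , r) starts ending
        in y , u , l , subst (λ c → Tail (c ∷ u ∷ [])) c≡ k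
        where
        mid⁻ : ∀ c u → Holds midChain (c ∷ u ∷ []) → Holds (chain e (gen startPlan) v ++ tailChain) (c ∷ u ∷ [])
        mid⁻ c u = subst (λ ch → Holds ch (c ∷ u ∷ []))
          (++-assoc (chain e (gen startPlan) v) (chain e (gen extra) v) layersChain)

      whole⁺ : ∀ {q} w y → length w ≤ v → length y ≤ q → q ≤ v → Tail (Enc (initial M (choice w y)) ∷ encWords w y ∷ []) →
               truth kind (whole sp v q w) [] ≡ true
      whole⁺ {q} w y n≤v l q≤v k =
        let (p , f , r) , starts , ending = words⁺ u c [] {w} {y} {q} n≤v l q≤v refl refl in
        sem⁺ (block a ▹ block a) {Holds (wordChain q w)} {wordChain q w} {[]} (λ h → h)
          (block⁺ {Sem (block a) (Holds (wordChain q w))} {[]} u (block⁺ {Holds (wordChain q w)} {u ∷ []} c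
            (pass⁺ (length w) wordAt inputEndTest (inputs sp v (reverse w) ++ guessChain q) (c ∷ u ∷ []) p
              (inputs⁺ (reverse w) {guessChain q} {c ∷ u ∷ []}
                (subst (λ w → InputTests w (c ∷ u ∷ [])) (sym (reverse-involutive w)) f)
                (pass⁺ q wordAt guessEndTest midChain (c ∷ u ∷ []) r
                  (subst (λ ch → Holds ch (c ∷ u ∷ []))
                    (sym (++-assoc (chain e (gen startPlan) v) (chain e (gen extra) v) layersChain))
                    (sem⁺ startPlan {Tail} {tailChain} {c ∷ u ∷ []} (λ {bs} → tail⁺ {bs}) (start⁺ u c [] {Tail} starts ending k))))))))
        where
        u : Block
        u = encWords w y

        c : Block
        c = Enc (initial M (choice w y))

-- Chains of configurations and runs of exponential length

run-suc : ∀ {m} (M : TM m) t c → run M (suc t) c ≡ step M (run M t c)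
run-suc M zero    c = refl
run-suc M (suc t) c = run-suc M t (step M c)

vecToFin : ∀ {k n} → (Z → Fin k) → Vec Z n → Fin (k ^ n)
vecToFin f []       = zero
vecToFin f (z ∷ zs) = combine (f z) (vecToFin f zs)

vecToFin-injective : ∀ {k n} {f : Z → Fin k} → (∀ {x y} → f x ≡ f y → x ≡ y) →
                     ∀ {xs ys : Vec Z n} → vecToFin f xs ≡ vecToFin f ys → xs ≡ ys
vecToFin-injective h {[]}     {[]}     e = refl
vecToFin-injective h {x ∷ xs} {y ∷ ys} e with p , q ← combine-injective _ _ _ _ e =
  cong₂ _∷_ (h p) (vecToFin-injective h q)

boolToFin : Bool → Fin 2
boolToFin true  = zero
boolToFin false = suc zero

boolToFin-injective : ∀ {b c} → boolToFin b ≡ boolToFin c → b ≡ c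
boolToFin-injective {true}  {true}  _ = refl
boolToFin-injective {false} {false} _ = refl

module Tails {m : ℕ} (M : TM m) (pick : Vec Bool m) {A : Set} (a : A) (kind : A → Quantifier) (kind-a : kind a ≡ ex)
  {e : ℕ} (enc : Cell M → Vec Bool e) (dec : Vec Bool e → Cell M) (dec-enc : ∀ c → dec (enc c) ≡ c) (v : ℕ) where
  open TM M
  open Columns M
  open Encoding M pick a kind kind-a enc dec dec-enc
  open Size v
  open Sized kind v

  private
    N W : ℕ
    N = 2 + v
    W = blockSize e v

  encColumn-injective : ∀ {c d} → encColumn c ≡ encColumn d → c ≡ d
  encColumn-injective {c} {d} h = inj₁-injective (trans (sym (dec-enc (inj₁ c))) (trans (cong dec h) (dec-enc (inj₁ d))))

  Enc-column : ∀ {c d} → Enc c ≡ Enc d → ∀ {x} → x < N → column c x ≡ column d x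
  Enc-column {c} {d} h {x} p = encColumn-injective (trans (sym (nth-Enc c p)) (trans (cong (λ b → nth b x) h) (nth-Enc d p)))

  Enc-next : ∀ {c d} → Enc c ≡ Enc d → next M c ≡ next M d
  Enc-next {c} {d} h = trans (sym (transition-column c)) (trans (cong transition (Enc-column h {0} (s≤s z≤n))) (transition-column d))

  nextColumn-cong : ∀ {c c′ p p′ q q′ r r′} → c ≡ c′ → p ≡ p′ → q ≡ q′ → r ≡ r′ → nextColumn c p q r ≡ nextColumn c′ p′ q′ r′
  nextColumn-cong refl refl refl refl = refl

  -- `Enc` is not injective, for it does not see how many blanks a tape records. Repeated encodings
  -- need not be repeated configurations, so the pigeonhole argument rests on encodings determining
  -- their successors.
  Enc-step : ∀ {c d} → Small v (step M c) → Small v (step M d) → Enc c ≡ Enc d → Enc (step M c) ≡ Enc (step M d)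
  Enc-step {c} {d} s s′ h = Enc-≡ (Enc (step M c)) λ x p → trans (nth-Enc (step M c) p) (cong encColumn (columns x p))
    where
    columns : ∀ x → x < N → column (step M c) x ≡ column (step M d) x
    columns zero p = trans (sym (nextColumn-zero c (column c 0)))
      (trans (nextColumn-cong (Enc-column h {0} (s≤s z≤n)) (Enc-column h {0} (s≤s z≤n))
        (Enc-column h {0} (s≤s z≤n)) (Enc-column h {1} (s≤s (s≤s z≤n)))) (nextColumn-zero d (column d 0)))
    columns (suc x) (s≤s l) with m≤n⇒m<n∨m≡n (≤-pred l)
    ... | inj₂ refl = trans (column-beyond (step M c) s) (sym (column-beyond (step M d) s′))
    ... | inj₁ x<v  = trans (sym (nextColumn-suc c x)) (trans (same-next x<v) (nextColumn-suc d x))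
      where
      same-next : x < v → nextColumn (column c 0) (column c x) (column c (suc x)) (column c (suc (suc x)))
                        ≡ nextColumn (column d 0) (column d x) (column d (suc x)) (column d (suc (suc x)))
      same-next x<v = nextColumn-cong (Enc-column h (s≤s z≤n)) (Enc-column h (≤v⇒<N (<⇒≤ x<v)))
        (Enc-column h (≤v⇒<N x<v)) (Enc-column h (s≤s (s≤s x<v)))

  private
    size≡ : (2 ^ e) ^ N ≡ 2 ^ W
    size≡ = trans (^-*-assoc 2 e N) (cong (2 ^_) (trans (*-comm e N) (sym (W≡))))

    blockToFin : Block → Fin (2 ^ W)
    blockToFin b = subst Fin size≡ (vecToFin (vecToFin boolToFin) b)

    blockToFin-injective : ∀ {b d} → blockToFin b ≡ blockToFin d → b ≡ d
    blockToFin-injective = vecToFin-injective (vecToFin-injective boolToFin-injective) ∘ subst-injective size≡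
      where
      subst-injective : ∀ {m n} (eq : m ≡ n) {x y : Fin m} → subst Fin eq x ≡ subst Fin eq y → x ≡ y
      subst-injective refl e = e

  -- With only 2 ^ W encodings, the run up to time 2 ^ W already shows every encoding.
  halts-early : ∀ {c} → (∀ t → Small v (run M t c)) → ∀ t → Halted M (run M t c) →
                Σ[ s ∈ ℕ ] (s ≤ 2 ^ W × Halted M (run M s c))
  halts-early {c} small t halted = found (pigeonhole ≤-refl (λ (i : Fin (suc (2 ^ W))) → blockToFin (Enc (run M (toℕ i) c))))
    where
    Enc-suc : ∀ {s t} → Enc (run M s c) ≡ Enc (run M t c) → Enc (run M (suc s) c) ≡ Enc (run M (suc t) c)
    Enc-suc {s} {t} h = trans (cong Enc (run-suc M s c)) (trans
      (Enc-step (subst (Small v) (run-suc M s c) (small (suc s))) (subst (Small v) (run-suc M t c) (small (suc t))) h)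
      (sym (cong Enc (run-suc M t c))))

    -- After the repetition at `i` and `j` the encodings cycle, so whatever occurs at all occurs
    -- before `j`.
    earlier : ∀ {i j} → i < j → Enc (run M i c) ≡ Enc (run M j c) → ∀ t → Σ[ s ∈ ℕ ] (s < j × Enc (run M t c) ≡ Enc (run M s c))
    earlier i<j repeat zero = 0 , ≤-<-trans z≤n i<j , refl
    earlier {i} {j} i<j repeat (suc t) with s , s<j , h ← earlier i<j repeat t with m≤n⇒m<n∨m≡n s<j
    ... | inj₁ s+1<j = suc s , s+1<j , Enc-suc {t} {s} h
    ... | inj₂ s+1≡j = i , i<j , trans (Enc-suc {t} {s} h) (trans (cong (λ t → Enc (run M t c)) s+1≡j) (sym repeat))

    found : (∃₂ λ (i j : Fin (suc (2 ^ W))) → i Fin.< j × blockToFin (Enc (run M (toℕ i) c)) ≡ blockToFin (Enc (run M (toℕ j) c))) →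
            Σ[ s ∈ ℕ ] (s ≤ 2 ^ W × Halted M (run M s c))
    found (i , j , i<j , eq) with s , s<j , h ← earlier i<j (blockToFin-injective eq) t =
      s , ≤-trans (<⇒≤ s<j) (≤-pred (toℕ<n j)) , trans (sym (Enc-next h)) halted

  module NPTail where

    open NPPlans

    SemTail : ℕ → List (Block) → Set
    SemTail n = SemPower n layer (Sem acceptPlan (λ _ → ⊤))

    accepts⁻ : ∀ n c bs → (∀ t → Small v (run M t c)) → SemTail n (Enc c ∷ bs) → Accepting M (run M n c)
    accepts⁻ zero    c bs small h = proj₁ (accept⁻ c bs {λ _ → ⊤} h)
    accepts⁻ (suc n) c bs small h with y , h ← block⁻ {Sem stepPlan (SemTail n)} {Enc c ∷ bs} h
                               with refl , h ← step⁻ y c bs {SemTail n} (small 1) h =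
      accepts⁻ n (step M c) (Enc c ∷ bs) (λ t → small (suc t)) h

    accepts⁺ : ∀ n c bs → (∀ t → Small v (run M t c)) → Accepting M (run M n c) → SemTail n (Enc c ∷ bs)
    accepts⁺ zero    c bs small h = accept⁺ c bs {λ _ → ⊤} h tt
    accepts⁺ (suc n) c bs small h = block⁺ {Sem stepPlan (SemTail n)} {Enc c ∷ bs} (Enc (step M c))
      (step⁺ (Enc (step M c)) c bs {SemTail n} (small 1) refl (accepts⁺ n (step M c) (Enc c ∷ bs) (λ t → small (suc t)) h))

  module PSPACETail (b : A) (kind-b : kind b ≡ all) where

    open PSPACEPlans b

    module _ (a′ a₁ s m c′ c : Block) (bs : List (Block)) where

      private
        env : List (Block)
        env = a′ ∷ a₁ ∷ s ∷ m ∷ c′ ∷ c ∷ bs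

        col-depth : ∀ (bs : List (Block)) β {b x} → bs !? β ≡ just b → x < N → col bs β x ≡ nth b x
        col-depth (b ∷ bs) zero    refl p = col-zero b bs p
        col-depth (b ∷ bs) (suc β) {x = x} h p = trans (col-suc b bs β x) (col-depth bs β h p)

        blockColumns : ℕ → Vec Bits 6
        blockColumns x = nth s 0 ∷ nth a′ x ∷ nth a₁ x ∷ nth m x ∷ nth c′ x ∷ nth c x ∷ []

        copy≡ : ∀ i f {x} → (∀ β → columnAt env i (f β) ≡ col env β x) → x < N →
                copyTest (mapⱽ (columnAt env i) (copyAddresses f)) ≡
                copyTest (blockColumns x)
        copy≡ i f {x} h p
          rewrite h 0 | h 1 | h 3 | h 4 | h 5
                | col-depth env 0 refl p | col-depth env 1 refl p | col-depth env 3 refl p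
                | col-depth env 4 refl p | col-depth env 5 refl p | col-depth env 2 {x = 0} refl (s≤s z≤n) = refl

      Copies : Set
      Copies = if selects (nth s 0) then a₁ ≡ c × a′ ≡ m else (a₁ ≡ m × a′ ≡ c′)

      copy⁻ : ∀ {K : List (Block) → Set} → Sem copyPlan K env → Copies × K env
      copy⁻ (p , q , r , k) = copies , k
        where
        columns : ∀ x → x < N → copyTest (blockColumns x) ≡ true
        columns x (s≤s l) with m≤n⇒m<n∨m≡n l
        ... | inj₂ refl = trans (sym (copy≡ 0 (λ β → endCol β 1) (λ β → end≡ β 1 env 0) ≤-refl)) r
        ... | inj₁ x<1+v with m≤n⇒m<n∨m≡n (≤-pred x<1+v)
        ...   | inj₂ refl = trans (sym (copy≡ 0 (λ β → endCol β 0) (λ β → end≡ β 0 env 0) (≤v⇒<N ≤-refl))) q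
        ...   | inj₁ x<v  = trans (sym (copy≡ x (λ β → innerCol β 0) (λ β → inner≡ β 0 env x) (≤v⇒<N (<⇒≤ x<v)))) (p x x<v)

        copies : Copies
        copies with selects (nth s 0) | columns
        ... | true  | h = nth-ext a₁ c (λ x l → same⁻ _ _ (proj₁ (∧-true (h x l)))) ,
                          nth-ext a′ m (λ x l → same⁻ _ _ (proj₂ (∧-true {same (nth a₁ x) _} (h x l))))
        ... | false | h = nth-ext a₁ m (λ x l → same⁻ _ _ (proj₁ (∧-true (h x l)))) ,
                          nth-ext a′ c′ (λ x l → same⁻ _ _ (proj₂ (∧-true {same (nth a₁ x) _} (h x l))))

      copy⁺ : ∀ {K : List (Block) → Set} → Copies → K env → Sem copyPlan K env
      copy⁺ copies k =
        (λ i i<v → trans (copy≡ i (λ β → innerCol β 0) (λ β → inner≡ β 0 env i) (≤v⇒<N (<⇒≤ i<v))) (columns i)) ,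
        trans (copy≡ 0 (λ β → endCol β 0) (λ β → end≡ β 0 env 0) (≤v⇒<N ≤-refl)) (columns v) ,
        trans (copy≡ 0 (λ β → endCol β 1) (λ β → end≡ β 1 env 0) ≤-refl) (columns (suc v)) , k
        where
        columns : ∀ x → copyTest (blockColumns x) ≡ true
        columns x = pass (selects (nth s 0)) copies
          where
          pass : ∀ b → (if b then a₁ ≡ c × a′ ≡ m else (a₁ ≡ m × a′ ≡ c′)) →
                 (if b then same (nth a₁ x) (nth c x) ∧ᵇ same (nth a′ x) (nth m x)
                       else same (nth a₁ x) (nth m x) ∧ᵇ same (nth a′ x) (nth c′ x)) ≡ true
          pass true  (refl , refl) = ∧-intro (same⁺ {x = nth a₁ x} refl) (same⁺ {x = nth a′ x} refl)
          pass false (refl , refl) = ∧-intro (same⁺ {x = nth a₁ x} refl) (same⁺ {x = nth a′ x} refl)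

    Env′ : Set
    Env′ = List (Block)

    all⁻ : ∀ {K : Env′ → Set} {bs} → Sem (block b) K bs → ∀ s → K (s ∷ bs)
    all⁻ {K} {bs} = subst (λ q → SemBlock q K bs) kind-b

    all⁺ : ∀ {K : Env′ → Set} {bs} → (∀ s → K (s ∷ bs)) → Sem (block b) K bs
    all⁺ {K} {bs} h = subst (λ q → SemBlock q K bs) (sym kind-b) h

    -- The universal block is instantiated only with these two kinds of value, one for each half of
    -- the run.
    selector : Maybe Bool → Block
    selector x = replicateⱽ N (enc (inj₂ (x , nothing)))

    selects-selector : ∀ x → selects (nth (selector x) 0) ≡ is-just x
    selects-selector x = cong (is-just ∘ proj₁) (decWords-enc (x , nothing))

    Reach : ℕ → Env′ → Set
    Reach k = SemPower k layer (Sem stepPlan (λ _ → ⊤))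

    -- The midpoint is chosen before the selector, so the two instances of the universal block share
    -- it.
    layer⁻ : ∀ {K : Env′ → Set} {c′ c bs} → Sem layer K (c′ ∷ c ∷ bs) →
             Σ[ m ∈ _ ] ((Σ[ s ∈ _ ] K (m ∷ c ∷ s ∷ m ∷ c′ ∷ c ∷ bs)) × (Σ[ s ∈ _ ] K (c′ ∷ m ∷ s ∷ m ∷ c′ ∷ c ∷ bs)))
    layer⁻ {K} {c′} {c} {bs} h
      with m , h ← block⁻ {Sem (block b ▹ block a ▹ block a ▹ copyPlan) K} {c′ ∷ c ∷ bs} h =
      m , (selector (just true) , halves (just true)) , (selector nothing , halves nothing)
      where
      at-selector : ∀ s → Σ[ a₁ ∈ _ ] Σ[ a′ ∈ _ ] (Copies a′ a₁ s m c′ c bs × K (a′ ∷ a₁ ∷ s ∷ m ∷ c′ ∷ c ∷ bs))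
      at-selector s
        with a₁ , h ← block⁻ {Sem (block a ▹ copyPlan) K} {s ∷ m ∷ c′ ∷ c ∷ bs}
                        (all⁻ {Sem (block a ▹ block a ▹ copyPlan) K} {m ∷ c′ ∷ c ∷ bs} h s)
        with a′ , h ← block⁻ {Sem copyPlan K} {a₁ ∷ s ∷ m ∷ c′ ∷ c ∷ bs} h =
        a₁ , a′ , copy⁻ a′ a₁ s m c′ c bs {K} h

      halves : ∀ x → if is-just x then K (m ∷ c ∷ selector x ∷ m ∷ c′ ∷ c ∷ bs) else K (c′ ∷ m ∷ selector x ∷ m ∷ c′ ∷ c ∷ bs)
      halves x with a₁ , a′ , copies , k ← at-selector (selector x)
               with selects (nth (selector x) 0) | selects-selector x
      halves (just _) | true  | _ with refl , refl ← copies = k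
      halves nothing  | false | _ with refl , refl ← copies = k

    layer⁺ : ∀ {K : Env′ → Set} {c′ c bs} m → (∀ s → K (m ∷ c ∷ s ∷ m ∷ c′ ∷ c ∷ bs)) → (∀ s → K (c′ ∷ m ∷ s ∷ m ∷ c′ ∷ c ∷ bs)) →
             Sem layer K (c′ ∷ c ∷ bs)
    layer⁺ {K} {c′} {c} {bs} m f g =
      block⁺ {Sem (block b ▹ block a ▹ block a ▹ copyPlan) K} {c′ ∷ c ∷ bs} m
        (all⁺ {Sem (block a ▹ block a ▹ copyPlan) K} {m ∷ c′ ∷ c ∷ bs} each)
      where
      choose-pair : ∀ s → Σ[ a₁ ∈ _ ] Σ[ a′ ∈ _ ] (Copies a′ a₁ s m c′ c bs × K (a′ ∷ a₁ ∷ s ∷ m ∷ c′ ∷ c ∷ bs))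
      choose-pair s with selects (nth s 0) in eq
      ... | true  = c , m , (refl , refl) , f s
      ... | false = m , c′ , (refl , refl) , g s

      each : ∀ s → Sem (block a ▹ block a ▹ copyPlan) K (s ∷ m ∷ c′ ∷ c ∷ bs)
      each s with a₁ , a′ , copies , k ← choose-pair s =
        block⁺ {Sem (block a ▹ copyPlan) K} {s ∷ m ∷ c′ ∷ c ∷ bs} a₁
          (block⁺ {Sem copyPlan K} {a₁ ∷ s ∷ m ∷ c′ ∷ c ∷ bs} a′ (copy⁺ a′ a₁ s m c′ c bs {K} copies k))

    doubling : ∀ k c → run M (2 ^ suc k) c ≡ run M (2 ^ k) (run M (2 ^ k) c)
    doubling k c = trans (cong (λ t → run M t c) (cong (2 ^ k +_) (+-identityʳ (2 ^ k)))) (run-+ M (2 ^ k) (2 ^ k) c)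

    reach⁻ : ∀ k c → (∀ t → Small v (run M t c)) → ∀ x bs → Reach k (x ∷ Enc c ∷ bs) → x ≡ Enc (run M (2 ^ k) c)
    reach⁻ zero    c small x bs h = proj₁ (step⁻ x c bs {λ _ → ⊤} (small 1) h)
    reach⁻ (suc k) c small x bs h with m , (s , h₁) , (s′ , h₂) ← layer⁻ {Reach k} h
                                  -- The first half forces the midpoint to encode the configuration
                                  -- after `2 ^ k` steps, so that the induction hypothesis applies
                                  -- to the second half.
                                  with refl ← reach⁻ k c small m (s ∷ m ∷ x ∷ Enc c ∷ bs) h₁ =
      trans (reach⁻ k (run M (2 ^ k) c) (Small-run (2 ^ k) small) x _ h₂) (cong Enc (sym (doubling k c)))

    reach⁺ : ∀ k c → (∀ t → Small v (run M t c)) → ∀ bs → Reach k (Enc (run M (2 ^ k) c) ∷ Enc c ∷ bs)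
    reach⁺ zero    c small bs = step⁺ (Enc (step M c)) c bs {λ _ → ⊤} (small 1) refl tt
    reach⁺ (suc k) c small bs = layer⁺ {Reach k} (Enc (run M (2 ^ k) c))
      (λ s → reach⁺ k c small _)
      (λ s → subst (λ d → Reach k (Enc d ∷ Enc (run M (2 ^ k) c) ∷ s ∷ Enc (run M (2 ^ k) c) ∷ Enc (run M (2 ^ suc k) c) ∷ Enc c ∷ bs))
               (sym (doubling k c)) (reach⁺ k (run M (2 ^ k) c) (Small-run (2 ^ k) small) _))

    accepts⁻ : ∀ c bs → (∀ t → Small v (run M t c)) → Sem extra (Reach W) (Enc c ∷ bs) → Accepting M (run M (2 ^ W) c)
    accepts⁻ c bs small h with x , p , h ← block⁻ {Sem acceptPlan (Reach W)} {Enc c ∷ bs} h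
                       with refl ← reach⁻ W c small x bs h = proj₁ (accept⁻ (run M (2 ^ W) c) (Enc c ∷ bs) {Reach W} (p , h))

    accepts⁺ : ∀ c bs → (∀ t → Small v (run M t c)) → Accepting M (run M (2 ^ W) c) → Sem extra (Reach W) (Enc c ∷ bs)
    accepts⁺ c bs small h = block⁺ {Sem acceptPlan (Reach W)} {Enc c ∷ bs} (Enc (run M (2 ^ W) c))
      (accept⁺ (run M (2 ^ W) c) (Enc c ∷ bs) {Reach W} h (reach⁺ W c small bs))

-- Polynomials by coefficients, and bounds on tapes

addCoeffs : List ℕ → List ℕ → List ℕ
addCoeffs []       ys       = ys
addCoeffs (x ∷ xs) []       = x ∷ xs
addCoeffs (x ∷ xs) (y ∷ ys) = x + y ∷ addCoeffs xs ys

mulCoeffs : List ℕ → List ℕ → List ℕ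
mulCoeffs []       ys = []
mulCoeffs (x ∷ xs) ys = addCoeffs (mapᴸ (x *_) ys) (0 ∷ mulCoeffs xs ys)

-- The program evaluates by Horner's rule, which takes a list of coefficients and not an expression.
coeffs : Polynomial → List ℕ
coeffs X         = 0 ∷ 1 ∷ []
coeffs (const c) = c ∷ []
coeffs (p ⊕ q)   = addCoeffs (coeffs p) (coeffs q)
coeffs (p ⊗ q)   = mulCoeffs (coeffs p) (coeffs q)

eval-addCoeffs : ∀ xs ys n → eval (polynomial (addCoeffs xs ys)) n ≡ eval (polynomial xs) n + eval (polynomial ys) n
eval-addCoeffs []       ys       n = refl
eval-addCoeffs (x ∷ xs) []       n = sym (+-identityʳ _)
eval-addCoeffs (x ∷ xs) (y ∷ ys) n rewrite eval-addCoeffs xs ys n =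
  rearrange x y n (eval (polynomial xs) n) (eval (polynomial ys) n)
  where
  rearrange : ∀ x y n p q → x + y + (p + q) * n ≡ x + p * n + (y + q * n)
  rearrange = solve-∀

eval-scale : ∀ x ys n → eval (polynomial (mapᴸ (x *_) ys)) n ≡ x * eval (polynomial ys) n
eval-scale x []       n = sym (*-zeroʳ x)
eval-scale x (y ∷ ys) n rewrite eval-scale x ys n = rearrange x y n (eval (polynomial ys) n)
  where
  rearrange : ∀ x y n p → x * y + x * p * n ≡ x * (y + p * n)
  rearrange = solve-∀

eval-mulCoeffs : ∀ xs ys n → eval (polynomial (mulCoeffs xs ys)) n ≡ eval (polynomial xs) n * eval (polynomial ys) n
eval-mulCoeffs []       ys n = refl
eval-mulCoeffs (x ∷ xs) ys n
  rewrite eval-addCoeffs (mapᴸ (x *_) ys) (0 ∷ mulCoeffs xs ys) n | eval-scale x ys n | eval-mulCoeffs xs ys n =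
  rearrange x n (eval (polynomial xs) n) (eval (polynomial ys) n)
  where
  rearrange : ∀ x n p q → x * q + p * q * n ≡ (x + p * n) * q
  rearrange = solve-∀

eval-coeffs : ∀ p n → eval (polynomial (coeffs p)) n ≡ eval p n
eval-coeffs X         n = trans (cong (_* n) (+-identityʳ 1)) (*-identityˡ n)
eval-coeffs (const c) n = +-identityʳ c
eval-coeffs (p ⊕ q)   n = trans (eval-addCoeffs (coeffs p) (coeffs q) n) (cong₂ _+_ (eval-coeffs p n) (eval-coeffs q n))
eval-coeffs (p ⊗ q)   n = trans (eval-mulCoeffs (coeffs p) (coeffs q) n) (cong₂ _*_ (eval-coeffs p n) (eval-coeffs q n))

eval-mono : ∀ p {m n} → m ≤ n → eval p m ≤ eval p n
eval-mono X         m≤n = m≤n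
eval-mono (const c) m≤n = ≤-refl
eval-mono (p ⊕ q)   m≤n = +-mono-≤ (eval-mono p m≤n) (eval-mono q m≤n)
eval-mono (p ⊗ q)   m≤n = *-mono-≤ (eval-mono p m≤n) (eval-mono q m≤n)

module Bounds {m : ℕ} (M : TM m) where
  open TM M
  open Columns M

  SmallTapes : ∀ {k} → ℕ → Vec (Tape Aux) k → Set
  SmallTapes v = All (SmallTape v)

  SmallTapes-mono : ∀ {k u v} {T : Vec (Tape Aux) k} → u ≤ v → SmallTapes u T → SmallTapes v T
  SmallTapes-mono u≤v []            = []
  SmallTapes-mono u≤v ((p , q) ∷ s) = (≤-trans p u≤v , ≤-trans q u≤v) ∷ SmallTapes-mono u≤v s

  SmallTapes-act : ∀ {k v} as {T : Vec (Tape Aux) k} → SmallTapes v T → SmallTapes (suc v) (zipWith act as T)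
  SmallTapes-act []             []                              = []
  SmallTapes-act ((s , d) ∷ as) {tape l h r ∷ T} ((p , q) ∷ ps) =
    (≤-trans (move-growthˡ d (tape l s r)) (s≤s p) , ≤-trans (move-growthʳ d (tape l s r)) (s≤s q)) ∷ SmallTapes-act as ps

  Small-step : ∀ {v} c → Small v c → Small (suc v) (step M c)
  Small-step c s with next M c
  ... | nothing       = SmallTapes-mono (n≤1+n _) s
  ... | just (_ , as) = SmallTapes-act as s

  Small-after : ∀ {v} t c → Small v c → Small (t + v) (run M t c)
  Small-after zero    c s = s
  Small-after {v} (suc t) c s = subst (λ u → Small u (run M t (step M c))) (+-suc t v) (Small-after t (step M c) (Small-step c s))

  Small-initial : ∀ {v} ws → size ws ≤ v → Small v (initial M ws)
  Small-initial {v} ws size≤ = go ws size≤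
    where
    fromWord-small : ∀ w → length w ≤ v → SmallTape v (fromWord w)
    fromWord-small []      l = z≤n , z≤n
    fromWord-small (b ∷ w) l = z≤n , ≤-trans (≤-reflexive (length-map bit w)) (≤-trans (n≤1+n _) l)

    go : ∀ {k} (ws : Vec Word k) → size ws ≤ v → SmallTapes v (mapⱽ fromWord ws ++ⱽ replicateⱽ #work (fromWord []))
    go []       _     = blanks′ #work
      where
      blanks′ : ∀ k → SmallTapes v (replicateⱽ k (fromWord []))
      blanks′ zero    = []
      blanks′ (suc k) = (z≤n , z≤n) ∷ blanks′ k
    go (w ∷ ws) size≤ = fromWord-small w (≤-trans (m≤m+n _ _) size≤) ∷ go ws (≤-trans (m≤n+m _ (length w)) size≤)

  Small-space : ∀ {v} c → space M c ≤ v → Small v c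
  Small-space (config q T) = go T
    where
    go : ∀ {k v} (T : Vec (Tape Aux) k) → sum (mapⱽ cells T) ≤ v → SmallTapes v T
    go []                p = []
    go (tape l h r ∷ T) p =
      (≤-trans (m≤m+n (length l) _) cells≤ , ≤-trans (n≤1+n _) (≤-trans (m≤n+m _ (length l)) cells≤)) ∷
      go T (≤-trans (m≤n+m _ (cells (tape l h r))) p)
      where
      cells≤ = ≤-trans (m≤m+n (cells (tape l h r)) _) p

-- Scope of the formulas

module Scoping {m : ℕ} (M : TM m) (pick : Vec Bool m) {A : Set} (a : A) (kind : A → Quantifier) (kind-a : kind a ≡ ex)
  {e : ℕ} (enc : Cell M → Vec Bool e) (dec : Vec Bool e → Cell M) (dec-enc : ∀ c → dec (enc c) ≡ c) (v : ℕ) where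
  open Encoding M pick a kind kind-a enc dec dec-enc
  open Size v
  open Sized kind v

  private
    Context : Chain A → List A → Set
    Context = InContext

    F : List A → Plan → List A → Set
    F = Fits

    first∈ : ∀ {ts β t c i} → ts !? β ≡ just t → c ≤ 1 → InScope ts i (address t β (affine 0 0 c))
    first∈ h c≤1 = in-scope h (s≤s (≤-trans c≤1 (m≤m+n 1 v)))

    inner∈ : ∀ {ts β c i} → ts !? β ≡ just a → c ≤ 2 → i < v → InScope ts i (innerCol β c)
    inner∈ {c = c} {i} h c≤2 i<v = in-scope h (subst (_< 2 + v) (sym (value-i v i c)) (inner< c c≤2 i<v))

    end∈ : ∀ {ts β c i} → ts !? β ≡ just a → c ≤ 1 → InScope ts i (endCol β c)
    end∈ {c = c} {i} h c≤1 = in-scope h (subst (_< 2 + v) (sym (value-v v i c)) (s≤s (+-monoˡ-≤ v c≤1)))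

  startPlan-fits : ∀ {ts} → F (a ∷ a ∷ ts) startPlan (a ∷ a ∷ ts)
  startPlan-fits = check (first∈ refl z≤n ∷ first∈ refl z≤n ∷ [])
    ▹ checks (λ i p → inner∈ refl (s≤s z≤n) p ∷ inner∈ refl (s≤s z≤n) p ∷ [])
    ▹ check (end∈ refl ≤-refl ∷ end∈ refl ≤-refl ∷ [])
    ▹ checks (λ i p → inner∈ refl z≤n p ∷ inner∈ refl (s≤s z≤n) p ∷ [])
    ▹ check (end∈ refl z≤n ∷ end∈ refl ≤-refl ∷ [])

  stepPlan-fits : ∀ {ts} → F (a ∷ a ∷ ts) stepPlan (a ∷ a ∷ ts)
  stepPlan-fits = check (first∈ refl z≤n ∷ first∈ refl z≤n ∷ first∈ refl z≤n ∷ first∈ refl ≤-refl ∷ first∈ refl z≤n ∷ [])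
    ▹ checks (λ i p → first∈ refl z≤n ∷ inner∈ refl z≤n p ∷ inner∈ refl (s≤s z≤n) p ∷ inner∈ refl ≤-refl p ∷ inner∈ refl (s≤s z≤n) p ∷ [])
    ▹ check (end∈ refl ≤-refl ∷ [])

  acceptPlan-fits : ∀ {ts} → F (a ∷ ts) acceptPlan (a ∷ ts)
  acceptPlan-fits = check (first∈ refl z≤n ∷ [])

  -- Each layer enlarges the context, so the induction carries an invariant `P` on the innermost
  -- tags instead of a fixed context.
  power-context : ∀ {P : List A → Set} {layer ch} → (∀ {ts} → P ts → Σ[ us ∈ List A ] (F ts layer us × P us)) →
                  (∀ {ts} → P ts → Context ch ts) → ∀ n {ts} → P ts → Context (power n (chain e (gen layer) v) ++ ch) ts
  power-context f g zero    p = g p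
  power-context {P} {layer} {ch} f g (suc n) {ts} p with us , h , p′ ← f p =
    subst (λ c → Context c ts) (sym (++-assoc (chain e (gen layer) v) (power n (chain e (gen layer) v)) ch))
      (fits-context (power n (chain e (gen layer) v) ++ ch) h (power-context {P} {layer} {ch} f g n p′))

  module _ (pV pQ : List ℕ) (extra layer post : Plan) (P : List A → Set)
    (extra-fits : Σ[ us ∈ List A ] (F (a ∷ a ∷ []) extra us × P us))
    (layer-fits : ∀ {ts} → P ts → Σ[ us ∈ List A ] (F ts layer us × P us))
    (post-fits : ∀ {ts} → P ts → Σ[ us ∈ List A ] F ts post us) where

    private
      sp : Spec A
      sp = spec pV pQ (startPlan ▹ extra) layer post

      post-context : ∀ {ts} → P ts → Context (chain e (gen post) v) ts
      post-context {ts} p with us , f ← post-fits p =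
        subst (λ c → Context c ts) (++-identityʳ (chain e (gen post) v))
          (fits-context [] f (Scoped-constant (flatTags us) true 0))

      word∈ : ∀ {i} → i ≤ v → AllInScope (a ∷ a ∷ []) i wordAt
      word∈ {i} p = in-scope refl (subst (_< 2 + v) (sym (value-i v i 0)) (≤v⇒<N p)) ∷ []

      inputs-context : ∀ k {ch} → length k ≤ v → Context ch (a ∷ a ∷ []) → Context (inputs sp v k ++ ch) (a ∷ a ∷ [])
      inputs-context []      l s = s
      inputs-context (b ∷ k) {ch} l s =
        Scoped-check (inputTest b) (word∈ (≤-trans (n≤1+n _) l)) , inputs-context k {ch} (≤-trans (n≤1+n _) l) s

    whole-scoped : ∀ {q} w → length w ≤ v → q ≤ v → Scoped [] (whole sp v q w)
    whole-scoped {q} w n≤v q≤v =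
      fits-context {ts = []} (wordChain pV pQ extra layer post q w) (block {t = a} ▹ block {t = a})
        (Scoped-check inputEndTest (word∈ n≤v) ,
         inputs-context (reverse w) {guessChain pV pQ extra layer post q} (≤-trans (≤-reflexive (length-reverse w)) n≤v)
           (Scoped-check guessEndTest (word∈ q≤v) ,
            fits-context (power (blockSize e v) (chain e (gen layer) v) ++ chain e (gen post) v) (startPlan-fits
              ▹ proj₁ (proj₂ extra-fits))
              (power-context {P} {layer} {chain e (gen post) v} layer-fits post-context (blockSize e v) (proj₂ (proj₂ extra-fits)))))

  module NPScoping where
    open NPPlans

    data Prefix : List A → Set where
      prefix : ∀ ts → Prefix (a ∷ ts)

    NP-scoped : ∀ pV pQ {q} w → length w ≤ v → q ≤ v →
      Scoped [] (whole (spec pV pQ (startPlan ▹ extra) layer acceptPlan) v q w)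
    NP-scoped pV pQ = whole-scoped pV pQ extra layer acceptPlan Prefix (_ , check [] , prefix _)
      (λ where (prefix ts) → _ , block ▹ stepPlan-fits , prefix _)
      (λ where (prefix ts) → _ , acceptPlan-fits)

  module PSPACEScoping (b : A) where
    open PSPACEPlans b

    data Prefix : List A → Set where
      prefix : ∀ ts → Prefix (a ∷ a ∷ ts)

    copyPlan-fits : ∀ {ts} → F (a ∷ a ∷ b ∷ a ∷ a ∷ a ∷ ts) copyPlan (a ∷ a ∷ b ∷ a ∷ a ∷ a ∷ ts)
    copyPlan-fits = checks (λ i p → first∈ refl z≤n ∷ inner∈ refl z≤n p ∷ inner∈ refl z≤n p ∷ inner∈ refl z≤n p ∷ inner∈ refl z≤n p ∷ inner∈ refl z≤n p ∷ [])
      ▹ check (first∈ refl z≤n ∷ end∈ refl z≤n ∷ end∈ refl z≤n ∷ end∈ refl z≤n ∷ end∈ refl z≤n ∷ end∈ refl z≤n ∷ [])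
      ▹ check (first∈ refl z≤n ∷ end∈ refl ≤-refl ∷ end∈ refl ≤-refl ∷ end∈ refl ≤-refl ∷ end∈ refl ≤-refl ∷ end∈ refl ≤-refl ∷ [])

    PSPACE-scoped : ∀ pV pQ {q} w → length w ≤ v → q ≤ v →
      Scoped [] (whole (spec pV pQ (startPlan ▹ extra) layer stepPlan) v q w)
    PSPACE-scoped pV pQ = whole-scoped pV pQ extra layer stepPlan Prefix (_ , block ▹ acceptPlan-fits , prefix _)
      (λ where (prefix ts) → _ , block ▹ block ▹ block ▹ block ▹ copyPlan-fits , prefix _)
      (λ where (prefix ts) → _ , stepPlan-fits)

-- The reductions

open Equivalence using (to; from)

record Reduction (L : Language 0ℓ) {A : Set} (kind : A → Quantifier) : Set₁ where
  field
    program : Spec A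
    n≤V     : ∀ n → n ≤ boundV program n
    Q≤V     : ∀ n → boundQ program n ≤ boundV program n
    scoped  : ∀ w → Scoped [] (formula program w)
    correct : ∀ w → L w ⇔ (truth kind (formula program w) [] ≡ true)

DecidesInTime : ∀ {m} → TM m → Polynomial → Pred (Vec Word m) 0ℓ → Set
DecidesInTime M p R = ∀ ws →
  let c = run M (eval p (size ws)) (initial M ws) in
  Halted M c × (R ws ⇔ Accepting M c)

DecidesInSpace : TM 1 → Polynomial → Language 0ℓ → Set
DecidesInSpace M p L = ∀ w →
  let c = λ t → run M t (initial M (w ∷ [])) in
  (∀ t → space M (c t) ≤ eval p (length w)) × (∃[ t ] (Halted M (c t) × (L w ⇔ Accepting M (c t))))

module NPReduction (M : TM 2)
  {e : ℕ} (enc : Cell M → Vec Bool e) (dec : Vec Bool e → Cell M) (dec-enc : ∀ c → dec (enc c) ≡ c)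
  {L : Language 0ℓ} {R : Pred (Vec Word 2) 0ℓ} (p q : Polynomial)
  (decides : DecidesInTime M p R)
  (L⇔ : ∀ w → L w ⇔ (∃[ y ] (length y ≤ eval q (length w) × R (w ∷ y ∷ [])))) where

  private
    pick : Vec Bool 2
    pick = true ∷ false ∷ []

    kind : ⊤ → Quantifier
    kind _ = ex

    P : Polynomial
    -- Running time plus total input size. This bounds at once the cells recorded on either side of
    -- a head, the input length and the length of the guess.
    P = p ⟪ X ⊕ q ⟫ ⊕ (X ⊕ q)

  open Encoding M pick tt kind refl enc dec dec-enc
  module T (v : ℕ) = Tails M pick tt kind refl enc dec dec-enc v
  module S (v : ℕ) = Scoping M pick tt kind refl enc dec dec-enc v
  open Columns M
  open Bounds M

  -- With no bits all cells would have the same code, yet there are two different ones. A positive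
  -- `e` makes the number of layers at least `v`, hence at least the running time.
  e-positive : 1 ≤ e
  e-positive = go enc dec dec-enc
    where
    go : ∀ {e} (enc : Cell M → Vec Bool e) (dec : Vec Bool e → Cell M) → (∀ c → dec (enc c) ≡ c) → 1 ≤ e
    go {suc e} enc dec dec-enc = s≤s z≤n
    go {zero}  enc dec dec-enc with enc (inj₁ blankColumn) | dec-enc (inj₁ blankColumn)
                                  | enc (inj₂ (nothing , nothing)) | dec-enc (inj₂ (nothing , nothing))
    ... | [] | h₁ | [] | h₂ with () ← trans (sym h₁) h₂

  v≤blockSize : ∀ v → v ≤ blockSize e v
  v≤blockSize v = ≤-trans (≤-trans (≤-reflexive (sym (+-identityʳ v))) (*-monoˡ-≤ v e-positive)) (m≤m+n (e * v) (2 * e))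

  private
    layer extra : Plan
    layer = NPPlans.layer
    extra = NPPlans.extra

    sp : Spec ⊤
    sp = spec (coeffs P) (coeffs q) (startPlan ▹ extra) layer acceptPlan

    V Q : ℕ → ℕ
    V = boundV sp
    Q = boundQ sp

    V≡ : ∀ n → V n ≡ eval p (n + eval q n) + (n + eval q n)
    V≡ n = trans (eval-coeffs P n) (cong (_+ (n + eval q n)) (eval-⟪⟫ p (X ⊕ q) n))

    Q≡ : ∀ n → Q n ≡ eval q n
    Q≡ = eval-coeffs q

    n≤V : ∀ n → n ≤ V n
    n≤V n = ≤-trans (≤-trans (m≤m+n n (eval q n)) (m≤n+m _ (eval p (n + eval q n)))) (≤-reflexive (sym (V≡ n)))

    Q≤V : ∀ n → Q n ≤ V n
    Q≤V n = ≤-trans (≤-reflexive (Q≡ n)) (≤-trans (≤-trans (m≤n+m (eval q n) n) (m≤n+m _ (eval p (n + eval q n)))) (≤-reflexive (sym (V≡ n))))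

    module _ (w y : Word) (l : length y ≤ eval q (length w)) where

      n = length w

      c₀ : Config M
      c₀ = initial M (w ∷ y ∷ [])

      time : ℕ
      time = eval p (size (w ∷ y ∷ []))

      size≤ : size (w ∷ y ∷ []) ≤ n + eval q n
      size≤ = +-monoʳ-≤ n (≤-trans (≤-reflexive (+-identityʳ (length y))) l)

      budget : time + size (w ∷ y ∷ []) ≤ V n
      budget = ≤-trans (+-mono-≤ (eval-mono p size≤) size≤) (≤-reflexive (sym (V≡ n)))

      halted : Halted M (run M time c₀)
      halted = proj₁ (decides (w ∷ y ∷ []))

      small : ∀ t → Small (V n) (run M t c₀)
      small t with ≤-total t time
      ... | inj₁ t≤ = SmallTapes-mono (≤-trans (+-monoˡ-≤ _ t≤) budget) (Small-after t c₀ (Small-initial (w ∷ y ∷ []) ≤-refl))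
      -- The configuration no longer changes after halting, so the bound extends to all times.
      ... | inj₂ t≥ = subst (Small (V n)) (sym (run-halted-≤ M t≥ halted))
                        (SmallTapes-mono budget (Small-after time c₀ (Small-initial (w ∷ y ∷ []) ≤-refl)))

      at-W : run M (blockSize e (V n)) c₀ ≡ run M time c₀
      at-W = run-halted-≤ M (≤-trans (≤-trans (m≤m+n time _) budget) (v≤blockSize (V n))) halted

    to′ : ∀ w → L w → truth kind (formula sp w) [] ≡ true
    to′ w Lw with y , l , r ← to (L⇔ w) Lw =
      Size.whole⁺ (V (length w)) (coeffs P) (coeffs q) extra layer acceptPlan w y (n≤V _) (≤-trans l (≤-reflexive (sym (Q≡ _)))) (Q≤V _)
        (refl , T.NPTail.accepts⁺ v (blockSize e v) (c₀ w y l) _ (small w y l)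
                  (subst (Accepting M) (sym (at-W w y l)) (to (proj₂ (decides (w ∷ y ∷ []))) r)))
      where
      v = V (length w)

    from′ : ∀ w → truth kind (formula sp w) [] ≡ true → L w
    from′ w h =
      let y , u , l , _ , t = Size.whole⁻ v (coeffs P) (coeffs q) extra layer acceptPlan w (n≤V _) (Q≤V _) h
          l′ = ≤-trans l (≤-reflexive (Q≡ _))
      in from (L⇔ w) (y , l′ , from (proj₂ (decides (w ∷ y ∷ [])))
           (subst (Accepting M) (at-W w y l′) (T.NPTail.accepts⁻ v (blockSize e v) (c₀ w y l′) (u ∷ []) (small w y l′) t)))
      where
      v = V (length w)

  reduction : Reduction L kind
  reduction = record
    { program = sp
    ; n≤V = n≤V
    ; Q≤V = Q≤V
    ; scoped = λ w → S.NPScoping.NP-scoped (V (length w)) (coeffs P) (coeffs q) w (n≤V _) (Q≤V _)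
    ; correct = λ w → mk⇔ (to′ w) (from′ w)
    }

boolKind : Bool → Quantifier
boolKind true  = ex
boolKind false = all

module PSPACEReduction (M : TM 1)
  {e : ℕ} (enc : Cell M → Vec Bool e) (dec : Vec Bool e → Cell M) (dec-enc : ∀ c → dec (enc c) ≡ c)
  {L : Language 0ℓ} (p : Polynomial)
  (decides : DecidesInSpace M p L) where

  private
    pick : Vec Bool 1
    pick = true ∷ []

    P : Polynomial
    -- The summand `X` makes `v` at least the length of the input, whose bits are addressed by
    -- column.
    P = p ⊕ X

  open Encoding M pick true boolKind refl enc dec dec-enc
  module T (v : ℕ) = Tails M pick true boolKind refl enc dec dec-enc v
  module S (v : ℕ) = Scoping M pick true boolKind refl enc dec dec-enc v
  open Columns M
  open Bounds M

  private
    layer extra : Plan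
    layer = PSPACEPlans.layer false
    extra = PSPACEPlans.extra false

    sp : Spec Bool
    sp = spec (coeffs P) [] (startPlan ▹ extra) layer stepPlan

    V : ℕ → ℕ
    V = boundV sp

    n≤V : ∀ n → n ≤ V n
    n≤V n = ≤-trans (m≤n+m n (eval p n)) (≤-reflexive (sym (eval-coeffs P n)))

    module _ (w : Word) where

      n v W : ℕ
      n = length w
      v = V n
      W = blockSize e v

      c₀ : Config M
      c₀ = initial M (w ∷ [])

      small : ∀ t → Small v (run M t c₀)
      small t = Small-space (run M t c₀)
        (≤-trans (proj₁ (decides w) t) (≤-trans (m≤m+n (eval p n) n) (≤-reflexive (sym (eval-coeffs P n)))))

      -- The definition of PSPACE gives a halting time without a bound. `halts-early` gives another
      -- one, at most `2 ^ W`, and all halted configurations of one run coincide.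
      accepts : L w ⇔ Accepting M (run M (2 ^ W) c₀)
      accepts =
        let t , halted , L⇔  = proj₂ (decides w)
            s , s≤ , halted′ = T.halts-early v small t halted
        in subst (λ c → L w ⇔ Accepting M c) (trans (coincide t s halted halted′) (sym (run-halted-≤ M s≤ halted′))) L⇔
        where
        coincide : ∀ t s → Halted M (run M t c₀) → Halted M (run M s c₀) → run M t c₀ ≡ run M s c₀
        coincide t s h h′ with ≤-total s t
        ... | inj₁ s≤t = run-halted-≤ M s≤t h′
        ... | inj₂ t≤s = sym (run-halted-≤ M t≤s h)

      to′ : L w → truth boolKind (formula sp w) [] ≡ true
      to′ Lw = Size.whole⁺ v (coeffs P) [] extra layer stepPlan w [] (n≤V n) z≤n z≤n
        (T.PSPACETail.accepts⁺ v false refl c₀ _ small (to accepts Lw))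

      from′ : truth boolKind (formula sp w) [] ≡ true → L w
      from′ h =
        let y , u , l , t = Size.whole⁻ v (coeffs P) [] extra layer stepPlan w (n≤V n) z≤n h
        in from accepts (T.PSPACETail.accepts⁻ v false refl c₀ (u ∷ []) small t)

  reduction : Reduction L boolKind
  reduction = record
    { program = sp
    ; n≤V = n≤V
    ; Q≤V = λ _ → z≤n
    ; scoped = λ w → S.PSPACEScoping.PSPACE-scoped (V (length w)) false (coeffs P) [] w (n≤V _) z≤n
    ; correct = λ w → mk⇔ (to′ w) (from′ w)
    }

Finite-Cell : ∀ {m} (M : TM m) → Finite (Cell M)
Finite-Cell M = Finite-⊎ (Columns.Finite-Column M) (Finite-× (Finite-Maybe Finite-Bool) (Finite-Maybe Finite-Bool))

module CellCode {m : ℕ} (M : TM m) = BitCode (Finite-Cell M) (inj₁ (Columns.blankColumn M))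

NP-reduction : ∀ {L} → NP L → Reduction L {⊤} (λ _ → ex)
NP-reduction (R , (M , p , decides) , q , L⇔) =
  NPReduction.reduction M (CellCode.enc M) (CellCode.dec M) (CellCode.dec-enc M) {R = R} p q decides L⇔

PSPACE-reduction : ∀ {L} → PSPACE L → Reduction L boolKind
PSPACE-reduction (M , p , decides) =
  PSPACEReduction.reduction M (CellCode.enc M) (CellCode.dec M) (CellCode.dec-enc M) p decides

module _ {ℓ : Level} {σ : Signature} (B : Structure σ ℓ) where
  open Semantics B
  open Reduction

  reduce : ∀ {L A} {kind : A → Quantifier} {k} → (∀ a → Gadget (kind a) k) → Reduction L kind → L ≤ₚ MC B
  reduce {kind = kind} G r = code style ∘ formula (program r) , Compiler.computable (program r) style (n≤V r) (Q≤V r) , λ w →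
    let MC⇔ = MC-code (formula (program r) w) (scoped r w)
    in mk⇔ (from MC⇔ ∘ to (correct r w)) (from (correct r w) ∘ to MC⇔)
    where
    open Translation kind G

  -- The formula for the complement of `L` is negated by duality, so its existential variables
  -- become universal and need gadgets of the other kind. Its truth only refutes that a word lies
  -- outside `L`, hence `stable`.
  reduce-dual : ∀ {L A} {kind : A → Quantifier} {k} → (∀ {Z : Set} → ¬ ¬ Z → Z) →
                (∀ a → Gadget (flip (kind a)) k) → Reduction (∁ L) kind → L ≤ₚ MC B
  reduce-dual {L} {kind = kind} stable G r =
    code (dualStyle style) ∘ formula (program r) , Compiler.computable (program r) (dualStyle style) (n≤V r) (Q≤V r) ,
    λ w → member w (formula (program r) w) (scoped r w) (correct r w)
    where
    open Translation (flip ∘ kind) G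

    negated : ∀ {b} → ¬ (b ≡ true) → not b ≡ true
    negated {true}  h = contradiction refl h
    negated {false} h = refl

    absurd : ∀ {b} → b ≡ true → ¬ (not b ≡ true)
    absurd refl ()

    member : ∀ w φ → Scoped [] φ → (¬ L w) ⇔ (truth kind φ [] ≡ true) → L w ⇔ MC B (code (dualStyle style) φ)
    member w φ s L⇔ = mk⇔
      (λ Lw → subst (MC B) (code-dual style φ)
        (from MC⇔ (trans (truth-dual kind φ []) (negated (λ e → from L⇔ e Lw)))))
      (λ h → stable λ ¬Lw → absurd (to L⇔ ¬Lw)
        (trans (sym (truth-dual kind φ [])) (to MC⇔ (subst (MC B) (sym (code-dual style φ)) h))))
      where
      MC⇔ : MC B (code style (dual φ)) ⇔ (truth (flip ∘ kind) (dual φ) [] ≡ true)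
      MC⇔ = MC-code (dual φ) (Scoped-dual φ s)

  module _ (em : ExcludedMiddle ℓ) where

    NP-hard-MC : ∀ {φ} → φ Breaks-∧-on B → NP-hard (MC B)
    NP-hard-MC b L L∈NP = reduce (λ _ → ∧-gadget em b) (NP-reduction L∈NP)

    coNP-hard-MC : ∀ {ψ} → ψ Breaks-∨-on B → coNP-hard (MC B)
    coNP-hard-MC b L L∈coNP = reduce-dual stable (λ _ → ∨-gadget em b) (NP-reduction L∈coNP)
      where
      stable : ∀ {Z : Set} → ¬ ¬ Z → Z
      -- Excluded middle is given at level `ℓ` while membership in `L` lives at level zero, hence
      -- the lifting.
      stable {Z} h with em {Lift ℓ Z}
      ... | yes z = lower z
      ... | no ¬z = contradiction (λ z → ¬z (lift z)) h

    PSPACE-hard-MC : ∀ {φ ψ} → φ Breaks-∧-on B → ψ Breaks-∨-on B → PSPACE-hard (MC B)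
    PSPACE-hard-MC b c L L∈PSPACE = reduce gadget (PSPACE-reduction L∈PSPACE)
      where
      k l : ℕ
      k = _Breaks-∧-on_.length-prefix b
      l = _Breaks-∨-on_.length-prefix c

      -- Each gadget is padded by the width of the other, since a position is turned into an index
      -- by multiplying with one common width.
      gadget : ∀ a → Gadget (boolKind a) (k + l)
      gadget true  = subst (Gadget ex) (+-comm l k) (pads l (∧-gadget em b))
      gadget false = pads k (∨-gadget em c)

lemma4 : ∀ {ℓ} → ExcludedMiddle ℓ →
    ∀ {σ : Signature} (B : Structure σ ℓ) →
    ((∃[ φ ] (φ Breaks-∧-on B)) → NP-hard (MC B))
    × ((∃[ ψ ] (ψ Breaks-∨-on B)) → coNP-hard (MC B))
    × ((∃[ φ ] ∃[ ψ ] (φ Breaks-∧-on B × ψ Breaks-∨-on B)) → PSPACE-hard (MC B))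
lemma4 em B =
  (λ (_ , b) → NP-hard-MC B em b) ,
  (λ (_ , b) → coNP-hard-MC B em b) ,
  (λ (_ , _ , b , c) → PSPACE-hard-MC B em b c)
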